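{- Let $K$ be a finite field of characteristic $p$ with $[K:\mathbb{F}_p]$ even, and let $d$ be an integer with $\gcd(d,|K|-1)=1$. If $d\equiv p^j\pmod{\sqrt{|K|}-1}$ for some integer $j$, then $W_{K,d}(a)$ does not take exactly three distinct values as $a$ runs through $K^\times$.
   Context: $\psi_K(x)=\exp(2\pi i\,\mathrm{Tr}_{K/\mathbb{F}_p}(x)/p)$ is the canonical additive character of $K$, and for $a\in K$ the Weil sum is $W_{K,d}(a)=\sum_{x\in K}\psi_K(x^d+ax)$. -}

module Defs where

open import Algebra.Apartness.Bundles using (HeytingCommutativeRing; HeytingField)
open import Algebra.Bundles using (CommutativeRing; Semiring)
import Algebra.Definitions.RawSemiring as RawSemiringDefs
open import Data.Fin.Base using (Fin; toℕ)
import Data.Fin.Properties as Fin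
open import Data.Integer.Base as ℤ using (ℤ; +_; -[1+_])
import Data.Integer.Divisibility as ℤ
open import Data.Nat.Base as ℕ using (ℕ; suc; NonZero)
import Data.Nat.Divisibility as ℕ
open import Data.Product using (Σ-syntax; ∃-syntax; ∃!; _,_; proj₁) renaming (_×_ to _∧_)
open import Data.Sum.Base using (_⊎_)
open import Data.Vec.Functional using (Vector)
open import Function.Bundles using (Inverse; _⇔_)
open import Level using (Level; _⊔_) renaming (suc to lsuc)
open import Relation.Binary.Core using (Rel)
open import Relation.Binary.Definitions using (Decidable)
open import Relation.Binary.PropositionalEquality.Core using (_≡_; _≗_)
import Relation.Binary.PropositionalEquality.Properties as ≡
open import Relation.Nullary.Decidable using (map′; yes; no)

private
  variable
    a b c ℓ ℓ₁ ℓ₂ : Level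

module Field (F : HeytingField c ℓ₁ ℓ₂) where
  open HeytingField F public

  commutativeRing : CommutativeRing c ℓ₁
  commutativeRing = HeytingCommutativeRing.commutativeRing heytingCommutativeRing

  open RawSemiringDefs (Semiring.rawSemiring (CommutativeRing.semiring commutativeRing)) public
    using (_×_; _^_; sum)

  HasCharacteristic : ℕ → Set ℓ₁
  HasCharacteristic p = ∀ n → (n × 1# ≈ 0#) ⇔ (p ℕ.∣ n)

  -- For F of characteristic p: b is a basis of F over its prime subfield,
  -- whose elements are k × 1# for 0 ≤ k < p.
  IsPrimeBasis : (p : ℕ) → ∀ {n} → Vector Carrier n → Set (c ⊔ ℓ₁)
  IsPrimeBasis p {n} b =
    ∀ x → ∃! {A = Vector (Fin p) n} _≗_ (λ k → x ≈ sum (λ i → (toℕ (k i) × 1#) * b i))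

  -- [F : 𝔽ₚ] = n
  HasPrimeDegree : ℕ → ℕ → Set (c ⊔ ℓ₁)
  HasPrimeDegree p n = ∃[ b ] IsPrimeBasis p {n} b

-- On a finite field the apartness is decidable and is just inequality.
record FiniteField c ℓ₁ ℓ₂ : Set (lsuc (c ⊔ ℓ₁ ⊔ ℓ₂)) where
  field
    heytingField : HeytingField c ℓ₁ ℓ₂

  open Field heytingField public

  field
    order       : ℕ
    enumeration : Inverse (≡.setoid (Fin order)) setoid

  open Inverse enumeration public using () renaming (to to element; from to index)

  private
    index-injective : ∀ {x y} → index x ≡ index y → x ≈ y
    index-injective eq =
      trans (sym (Inverse.strictlyInverseˡ enumeration _)) (Inverse.inverseˡ enumeration eq)

  _≟_ : Decidable _≈_
  x ≟ y = map′ index-injective (Inverse.from-cong enumeration) (index x Fin.≟ index y)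

  -- The inverse, found by search; 0# ⁻¹ is 0#.
  infix 9 _⁻¹
  _⁻¹ : Carrier → Carrier
  x ⁻¹ with Fin.any? (λ j → (x * element j) ≟ 1#)
  ... | yes (j , _) = element j
  ... | no  _       = 0#

  -- Negative powers of 0# are 0#.
  infixr 8 _^ᶻ_
  _^ᶻ_ : Carrier → ℤ → Carrier
  x ^ᶻ (+ n)    = x ^ n
  x ^ᶻ -[1+ n ] = (x ⁻¹) ^ suc n

  -- The absolute trace x + xᵖ + … + x^(pⁿ⁻¹) of a field of degree n over 𝔽ₚ,
  -- as an element of the prime subfield of K.
  trace : (p n : ℕ) → Carrier → Carrier
  trace p n x = sum {n} (λ i → x ^ (p ℕ.^ toℕ i))

  -- The identification of the prime subfield with ℤ/p: the k with 0 ≤ k < p and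
  -- k × 1# ≈ y. The value outside the prime subfield is irrelevant, as traces lie in it.
  residue : (p : ℕ) → Carrier → ℕ
  residue p y with Fin.any? {p} (λ k → (toℕ k × 1#) ≟ y)
  ... | yes (k , _) = toℕ k
  ... | no  _       = 0

-- The library has no complex numbers. This records the properties of ℂ needed to write
-- exp(2πi k/p) and compare sums of such values: ℂ is a field of characteristic zero, with
-- an exponential map of kernel 2πiℤ. The field ℂ with its usual exp, i and π is an
-- instance, and results are stated for every instance.
record ComplexNumbers c ℓ₁ ℓ₂ : Set (lsuc (c ⊔ ℓ₁ ⊔ ℓ₂)) where
  field
    heytingField : HeytingField c ℓ₁ ℓ₂

  open Field heytingField public

  field
    char-0   : ∀ n → .{{NonZero n}} → (n × 1#) # 0#
    i π      : Carrier
    i²≈-1    : i * i ≈ - 1#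
    π#0      : π # 0#
    exp      : Carrier → Carrier
    exp-cong : ∀ {x y} → x ≈ y → exp x ≈ exp y
    exp-+    : ∀ x y → exp (x + y) ≈ exp x * exp y

  2πi : Carrier
  2πi = 2 × (π * i)

  field
    exp-kernel : ∀ z → (exp z ≈ 1#) ⇔ (∃[ k ] ((z ≈ k × 2πi) ⊎ (z ≈ - (k × 2πi))))

  infixl 7 _/_
  _/_ : Carrier → (n : ℕ) → .{{NonZero n}} → Carrier
  z / n = z * proj₁ (#⇒invertible (char-0 n))

module WeilSum {c₁ ℓ₁ m₁ c₂ ℓ₂ m₂}
  (ℂ : ComplexNumbers c₁ ℓ₁ m₁) (K : FiniteField c₂ ℓ₂ m₂)
  (p : ℕ) .{{_ : NonZero p}} (n : ℕ)   -- the characteristic of K and its degree over 𝔽ₚ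
  where

  private
    module ℂ = ComplexNumbers ℂ
    module K = FiniteField K

  ψ : K.Carrier → ℂ.Carrier
  ψ x = ℂ.exp ((K.residue p (K.trace p n x) ℂ.× ℂ.2πi) ℂ./ p)

  W : ℤ → K.Carrier → ℂ.Carrier
  W d a = ℂ.sum (λ j → let x = K.element j in ψ ((x K.^ᶻ d) K.+ (a K.* x)))

-- f takes exactly n values, distinct with respect to ≈, on the elements satisfying P.
TakesExactly : {A : Set a} {B : Set b} → Rel B ℓ → ℕ → (A → Set ℓ₁) → (A → B) →
               Set (a ⊔ b ⊔ ℓ ⊔ ℓ₁)
TakesExactly {B = B} _≈_ n P f =
  Σ[ v ∈ Vector B n ]
      ( (∀ {i j} → v i ≈ v j → i ≡ j)
      ∧ (∀ i → ∃[ x ] (P x ∧ (f x ≈ v i)))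
      ∧ (∀ x → P x → ∃[ i ] (f x ≈ v i)))

-- d ≡ pʲ (mod m) for p coprime to m, so that pʲ is defined mod m for negative j as well.
_≡_^_mod_ : ℤ → ℕ → ℤ → ℕ → Set
d ≡ p ^ (+ k)    mod m = + m ℤ.∣ (d ℤ.- + (p ℕ.^ k))
d ≡ p ^ -[1+ k ] mod m = + m ℤ.∣ (d ℤ.* + (p ℕ.^ suc k) ℤ.- + 1)

-- Let q = √|K|, let L be the subfield of order q, and let H be the orthogonal complement of L
-- under ψ, so that |H| = q. Since ψ is invariant under Frobenius, d can be replaced by an
-- exponent E ≡ 1 (mod q - 1), for which φ(x) = x^E is L-homogeneous. Hence
-- W(a) = q (N(a) - 1), where N(a) counts the lines Lx ⊂ K with φ(x) + a x ∈ H.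
-- The power moments of W give ∑ N = q + q² and ∑ N² = 2 ∑ N, so that
-- ∑ (N - 1)(N - q - 1) = 0 and ∑ N (N - 2) = 0, where N(0) = 1 and N ≤ q + 1.
-- If three values occur, the first identity shows that 0 is one of them and the second that 1
-- is one of them; let c ≥ 2 be the third. For φ(t) ≠ t consider the q² forms b φ(x) + a x
-- taking values in H at both 1 and t. The nonzero ones can be scaled to b = 1 and a ≠ 0, and
-- have N ≥ 2 because of the lines L and Lt, so they have N = c. On the other hand the sum of N
-- over all q² forms is divisible by q, which forces q ∣ c - 1, so c = q + 1, and then the first
-- identity fails. If φ is the identity, then W takes only two values.
{-# OPTIONS --safe #-}
module Submission where

open import Defs
open import Algebra.Apartness.Bundles using (HeytingField)
open import Algebra.Bundles using (CommutativeMonoid; CommutativeRing; CommutativeSemiring)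
import Algebra.Properties.CommutativeMonoid.Mult as CMMult
import Algebra.Properties.CommutativeMonoid.Sum as CMSum
import Algebra.Properties.CommutativeSemiring.Binomial as Binomial
import Algebra.Properties.CommutativeSemiring.Exp as CSExp
import Algebra.Properties.Ring as RingProperties
import Algebra.Properties.Semiring.Mult as SRMult
import Algebra.Properties.Semiring.Sum as SRSum
open import Data.Empty using (⊥; ⊥-elim)
open import Data.Fin.Base using (Fin; zero; suc; punchIn; toℕ; fromℕ; inject₁; funToFin; finToFun; combine)
open import Data.Fin.Permutation using (Permutation; permutation)
import Data.Fin.Properties as Fin
open import Data.Integer.Base as ℤ using (ℤ; +_; -[1+_])
import Data.Integer.Divisibility.Signed as ℤ
open import Data.Integer.GCD using (gcd)
import Data.Integer.Properties as ℤ
open import Data.Integer.Tactic.RingSolver using () renaming (solve-∀ to ℤ-solve-∀)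
open import Data.Nat.Base as ℕ using (ℕ; zero; suc; _∸_; _≤_; _<_; z≤n; s≤s; NonZero; _!)
open import Data.Nat.Combinatorics using (_C_; nCn≡1; k![n∸k]!∣n!)
open import Data.Nat.Combinatorics.Specification using (nCk≡n!/k![n-k]!)
open import Data.Nat.Coprimality using (Coprime; gcd≡1⇒coprime; coprime-Bézout)
import Data.Nat.Divisibility as ℕ
open import Data.Nat.DivMod using (m/n*n≡m)
open import Data.Nat.GCD using (module Bézout)
open import Data.Nat.Primality as Primality using (Prime; euclidsLemma)
open import Data.Nat.Properties using (_!*_!≢0)
import Data.Nat.Properties as ℕ
open import Data.Nat.Tactic.RingSolver using () renaming (solve-∀ to ℕ-solve-∀)
open import Data.Product.Base using (_,_; proj₁; proj₂; ∃-syntax) renaming (_×_ to _∧_)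
open import Data.Sum.Base using (_⊎_; inj₁; inj₂; [_,_]′)
open import Data.Unit.Base using (⊤; tt)
open import Data.Vec.Functional using (Vector)
open import Function.Base using (_∘_)
open import Function.Bundles using (Inverse; module Equivalence)
open import Level using (Level; _⊔_)
open import Relation.Binary.Bundles using (Setoid)
open import Relation.Binary.Definitions using (Decidable)
open import Relation.Binary.PropositionalEquality as ≡ using (_≡_; _≢_)
import Relation.Binary.Reasoning.Setoid as ≈-Reasoning
open import Relation.Nullary.Decidable
  using (Dec; yes; no; map′; _×-dec_; _⊎-dec_; _→-dec_; ¬?; decidable-stable; toWitness)
open import Relation.Nullary.Negation using (¬_; contradiction)

-- Equality in the field that carries the Weil sums is stable but not assumed decidable, and this
-- shapes the argument. Character sums are evaluated there, rewritten as casts of natural numbers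
-- and read back in ℕ, because the cast is injective in characteristic zero. Case distinctions,
-- inequalities and divisibilities then concern the natural number N, and identities that contain
-- differences are stated with both sides moved. The only question decided about character values is
-- whether `ψ x` is 1; it reduces to divisibility by p and makes H decidable. The two moments fix
-- the multiplicities of the values 0, 1, c but do not by themselves exclude c, so a congruence is
-- needed as well. It comes from forms determined by their values at 1 and t: evaluation at these
-- points is invertible exactly when φ(t) ≠ t, so H × H parametrises q² forms. The zero form has N =
-- q + 1 and the other q² - 1 have N = c, so the total is congruent to 1 - c modulo q.

private
  variable
    c r ℓ ℓ′ ℓr p p′ : Level
    P Q : Set p

-- Arithmetic of the exponents

*-square-injective : ∀ {s t} → s ℕ.* s ≡ t ℕ.* t → s ≡ t
*-square-injective {s} {t} eq = ℕ.≤-antisym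
  (ℕ.≮⇒≥ (λ t<s → ℕ.<⇒≢ (ℕ.*-mono-< t<s t<s) (≡.sym eq)))
  (ℕ.≮⇒≥ (λ s<t → ℕ.<⇒≢ (ℕ.*-mono-< s<t s<t) eq))

-- Applied to s modulo s - 1 and to |K| modulo |K| - 1; both ways of inverting a power of p rest on
-- it.
^-mod-pred : ∀ b J → ∃[ v ] suc b ℕ.^ J ≡ 1 ℕ.+ v ℕ.* b
^-mod-pred b zero    = 0 , ≡.refl
^-mod-pred b (suc J) with ^-mod-pred b J
... | v , eq = 1 ℕ.+ v ℕ.+ v ℕ.* b , ≡.trans (≡.cong (suc b ℕ.*_) eq) (arithmetic b v)
  where
  arithmetic : ∀ b v → (1 ℕ.+ b) ℕ.* (1 ℕ.+ v ℕ.* b) ≡ 1 ℕ.+ (1 ℕ.+ v ℕ.+ v ℕ.* b) ℕ.* b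
  arithmetic = ℕ-solve-∀

coprime⇒inverse : ∀ {e N} → 1 < N → Coprime e N → ∃[ u ] ∃[ v ] e ℕ.* u ≡ 1 ℕ.+ v ℕ.* N
coprime⇒inverse {N = suc zero} (s≤s ())
coprime⇒inverse {e} {suc (suc N)} _ coprime with coprime-Bézout coprime
... | Bézout.+- x y eq       = x , y , ≡.trans (ℕ.*-comm e x) (≡.sym eq)
-- Here x e ≡ -1 for the modulus `2 + N`; the factor `1 + N` ≡ -1 corrects the sign.
... | Bézout.-+ x (suc y) eq = x ℕ.* (1 ℕ.+ N) , N ℕ.+ y ℕ.* (1 ℕ.+ N) , (begin
  e ℕ.* (x ℕ.* (1 ℕ.+ N))                                    ≡⟨ regroup e x N ⟩
  (x ℕ.* e) ℕ.* (1 ℕ.+ N)                                    ≡⟨ ≡.cong (ℕ._* (1 ℕ.+ N)) (ℕ.suc-injective eq) ⟩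
  (1 ℕ.+ N ℕ.+ y ℕ.* (2 ℕ.+ N)) ℕ.* (1 ℕ.+ N)                ≡⟨ arithmetic N y ⟩
  1 ℕ.+ (N ℕ.+ y ℕ.* (1 ℕ.+ N)) ℕ.* (2 ℕ.+ N)                ∎)
  where
  open ≡.≡-Reasoning
  regroup : ∀ e x N → e ℕ.* (x ℕ.* (1 ℕ.+ N)) ≡ (x ℕ.* e) ℕ.* (1 ℕ.+ N)
  regroup = ℕ-solve-∀
  arithmetic : ∀ N y → (1 ℕ.+ N ℕ.+ y ℕ.* (2 ℕ.+ N)) ℕ.* (1 ℕ.+ N) ≡ 1 ℕ.+ (N ℕ.+ y ℕ.* (1 ℕ.+ N)) ℕ.* (2 ℕ.+ N)
  arithmetic = ℕ-solve-∀

inverse-* : ∀ {e f N} → ∃[ u ] ∃[ v ] e ℕ.* u ≡ 1 ℕ.+ v ℕ.* N → ∃[ u ] ∃[ v ] f ℕ.* u ≡ 1 ℕ.+ v ℕ.* N →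
            ∃[ u ] ∃[ v ] (e ℕ.* f) ℕ.* u ≡ 1 ℕ.+ v ℕ.* N
inverse-* {e} {f} {N} (u , v , eq) (w , x , eq′) = u ℕ.* w , v ℕ.+ x ℕ.+ v ℕ.* x ℕ.* N ,
  ≡.trans (regroup e f u w) (≡.trans (≡.cong₂ ℕ._*_ eq eq′) (arithmetic v x N))
  where
  regroup : ∀ e f u w → (e ℕ.* f) ℕ.* (u ℕ.* w) ≡ (e ℕ.* u) ℕ.* (f ℕ.* w)
  regroup = ℕ-solve-∀
  arithmetic : ∀ v x N → (1 ℕ.+ v ℕ.* N) ℕ.* (1 ℕ.+ x ℕ.* N) ≡ 1 ℕ.+ (v ℕ.+ x ℕ.+ v ℕ.* x ℕ.* N) ℕ.* N
  arithmetic = ℕ-solve-∀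

≡1-mod : ∀ {m a} k → a ≡ 1 ℕ.+ k ℕ.* m → + m ℤ.∣ + a ℤ.- + 1
≡1-mod {m} k ≡.refl = ℤ.divides (+ k) (≡.trans (cancel (+ (k ℕ.* m))) (ℤ.pos-* k m))
  where
  cancel : ∀ x → (+ 1 ℤ.+ x) ℤ.- + 1 ≡ x
  cancel = ℤ-solve-∀

-- As `a` is nonzero, `+ a - + 1` computes to a natural number, so the quotient is a natural number
-- too.
≡1-mod⁻ : ∀ {m a} → .{{NonZero a}} → + m ℤ.∣ + a ℤ.- + 1 → ∃[ k ] a ≡ 1 ℕ.+ k ℕ.* m
≡1-mod⁻ {m} {suc a} m∣ with ℤ.∣⇒∣ᵤ m∣
... | ℕ.divides k eq = k , ≡.cong suc eq

-- Since p^m ≡ 1 mod p^m - 1, the power p^J with J = m j - j inverts pʲ for j ≥ 0.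
frobenius-normalise : ∀ {p m s d} → .{{NonZero p}} → .{{NonZero m}} → s ≡ p ℕ.^ m → ∃[ j ] (d ≡ p ^ j mod (s ℕ.∸ 1)) →
                      ∃[ J ] + (s ℕ.∸ 1) ℤ.∣ d ℤ.* + (p ℕ.^ J) ℤ.- + 1
frobenius-normalise _ (-[1+ k ] , d≡) = suc k , ℤ.∣ᵤ⇒∣ d≡
frobenius-normalise {p} {m} {s} {d} s≡ (+ k , d≡) = J , ≡.subst (+ (s ℕ.∸ 1) ℤ.∣_) (split d (+ (p ℕ.^ k)) (+ (p ℕ.^ J)))
  (ℤ.∣m∣n⇒∣m+n (ℤ.∣m⇒∣m*n (+ (p ℕ.^ J)) (ℤ.∣ᵤ⇒∣ {i = d ℤ.- + (p ℕ.^ k)} d≡)) (≡.subst (λ x → + (s ℕ.∸ 1) ℤ.∣ x ℤ.- + 1) p^kJ (≡1-mod (proj₁ sᵏ≡1) (proj₂ sᵏ≡1))))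
  where
  J : ℕ
  J = m ℕ.* k ℕ.∸ k
  split : ∀ d x y → (d ℤ.- x) ℤ.* y ℤ.+ (x ℤ.* y ℤ.- + 1) ≡ d ℤ.* y ℤ.- + 1
  split = ℤ-solve-∀
  instance
    s-nonZero : NonZero s
    s-nonZero = ≡.subst NonZero (≡.sym s≡) (ℕ.m^n≢0 p m)
  sᵏ≡1 : ∃[ v ] s ℕ.^ k ≡ 1 ℕ.+ v ℕ.* (s ℕ.∸ 1)
  sᵏ≡1 = ≡.subst (λ t → ∃[ v ] t ℕ.^ k ≡ 1 ℕ.+ v ℕ.* (s ℕ.∸ 1)) (ℕ.suc-pred s) (^-mod-pred (s ℕ.∸ 1) k)
  p^kJ : + (s ℕ.^ k) ≡ + (p ℕ.^ k) ℤ.* + (p ℕ.^ J)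
  p^kJ = ≡.trans (≡.cong +_ (begin
    s ℕ.^ k                    ≡⟨ ≡.cong (ℕ._^ k) s≡ ⟩
    (p ℕ.^ m) ℕ.^ k            ≡⟨ ℕ.^-*-assoc p m k ⟩
    p ℕ.^ (m ℕ.* k)            ≡⟨ ≡.cong (p ℕ.^_) (ℕ.m+[n∸m]≡n (ℕ.m≤n*m k m)) ⟨
    p ℕ.^ (k ℕ.+ J)            ≡⟨ ℕ.^-distribˡ-+-* p k J ⟩
    p ℕ.^ k ℕ.* p ℕ.^ J        ∎)) (ℤ.pos-* (p ℕ.^ k) _)
    where open ≡.≡-Reasoning

-- Since p^n = |K| is 1 modulo |K| - 1, the complementary power of p inverts `p ^ J`. This keeps the
-- twisted exponent invertible modulo |K| - 1, so that raising to it still permutes K.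
frobenius-inverse : ∀ {p n N} → .{{NonZero n}} → p ℕ.^ n ≡ suc N → ∀ J → ∃[ w ] ∃[ x ] p ℕ.^ J ℕ.* w ≡ 1 ℕ.+ x ℕ.* N
frobenius-inverse {p} {n} {N} eq J = p ℕ.^ (n ℕ.* J ℕ.∸ J) , proj₁ (^-mod-pred N J) , (begin
  p ℕ.^ J ℕ.* p ℕ.^ (n ℕ.* J ℕ.∸ J)    ≡⟨ ℕ.^-distribˡ-+-* p J _ ⟨
  p ℕ.^ (J ℕ.+ (n ℕ.* J ℕ.∸ J))        ≡⟨ ≡.cong (p ℕ.^_) (ℕ.m+[n∸m]≡n (ℕ.m≤n*m J n)) ⟩
  p ℕ.^ (n ℕ.* J)                      ≡⟨ ℕ.^-*-assoc p n J ⟨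
  (p ℕ.^ n) ℕ.^ J                      ≡⟨ ≡.cong (ℕ._^ J) eq ⟩
  suc N ℕ.^ J                          ≡⟨ proj₂ (^-mod-pred N J) ⟩
  1 ℕ.+ proj₁ (^-mod-pred N J) ℕ.* N   ∎)
  where open ≡.≡-Reasoning

-- The exponent -1 acts on K as |K| - 2, which also sends 0 to 0.
naturalExponent : (N : ℕ) → ℤ → ℕ
naturalExponent N (+ m)    = m
naturalExponent N -[1+ m ] = (N ℕ.∸ 1) ℕ.* suc m

naturalExponent-≡ : ∀ N d → .{{NonZero N}} → + N ℤ.∣ + naturalExponent N d ℤ.- d
naturalExponent-≡ N (+ m) = ≡.subst (+ N ℤ.∣_) (≡.sym (ℤ.+-inverseʳ (+ m))) (ℤ.divides (+ 0) ≡.refl)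
naturalExponent-≡ (suc N) -[1+ m ] = ℤ.divides (+ suc m) (begin
  + (N ℕ.* suc m) ℤ.+ + suc m   ≡⟨ ≡.cong +_ (ℕ.+-comm (N ℕ.* suc m) _) ⟩
  + (suc N ℕ.* suc m)           ≡⟨ ≡.cong +_ (ℕ.*-comm (suc N) (suc m)) ⟩
  + (suc m ℕ.* suc N)           ≡⟨ ℤ.pos-* (suc m) (suc N) ⟩
  + suc m ℤ.* + suc N           ∎)
  where open ≡.≡-Reasoning

-- For a negative d, the exponent plus |d| is a multiple of the modulus. A common divisor of
-- exponent and modulus therefore divides |d|, and the integer gcd depends on |d| only.
naturalExponent-coprime : ∀ N d → .{{NonZero N}} → gcd d (+ N) ≡ + 1 → Coprime (naturalExponent N d) N
naturalExponent-coprime N (+ m) gcd≡1 = gcd≡1⇒coprime (ℤ.+-injective gcd≡1)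
naturalExponent-coprime (suc N) -[1+ m ] gcd≡1 {g} (g∣e , g∣N) = gcd≡1⇒coprime (ℤ.+-injective gcd≡1)
  (ℕ.∣m+n∣m⇒∣n (≡.subst (g ℕ.∣_) (ℕ.+-comm (suc m) (N ℕ.* suc m)) (ℕ.∣m⇒∣m*n (suc m) g∣N)) g∣e , g∣N)

-- Sums over finite setoids

module FiniteSum {S : Setoid c ℓ} {n : ℕ} (enum : Inverse (≡.setoid (Fin n)) S)
                 (M : CommutativeMonoid r ℓr) where
  private
    module S = Setoid S
    module I = Inverse enum
  open CommutativeMonoid M
  open CMSum M using (sum; sum-cong-≋; sum-replicate; sum-remove; sum-replicate-zero; ∑-distrib-+; ∑-comm;
    sum-permute)
  open CMMult M using (_×_)

  -- Opaque, so that the summand can be inferred from a sum.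
  opaque
    ∑ : (S.Carrier → Carrier) → Carrier
    ∑ f = sum (λ j → f (I.to j))

    ∑-unfold : ∀ f → ∑ f ≡ sum (λ j → f (I.to j))
    ∑-unfold f = ≡.refl

    ∑-cong : ∀ {f g} → (∀ x → f x ≈ g x) → ∑ f ≈ ∑ g
    ∑-cong f≈g = sum-cong-≋ (λ j → f≈g (I.to j))

    ∑-const : ∀ x → ∑ (λ _ → x) ≈ n × x
    ∑-const x = sum-replicate n

    ∑-ε : ∀ {f} → (∀ x → f x ≈ ε) → ∑ f ≈ ε
    ∑-ε f≈ε = trans (∑-cong f≈ε) (sum-replicate-zero n)

    ∑-distrib : ∀ f g → ∑ (λ x → f x ∙ g x) ≈ ∑ f ∙ ∑ g
    ∑-distrib f g = ∑-distrib-+ (f ∘ I.to) (g ∘ I.to)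

    ∑-swap : ∀ (f : S.Carrier → S.Carrier → Carrier) →
             ∑ (λ x → ∑ (λ y → f x y)) ≈ ∑ (λ y → ∑ (λ x → f x y))
    ∑-swap f = ∑-comm (λ i j → f (I.to i) (I.to j))

    ∑-permute : ∀ f (π π⁻¹ : S.Carrier → S.Carrier) →
                (∀ {x y} → x S.≈ y → f x ≈ f y) →
                (∀ {x y} → x S.≈ y → π x S.≈ π y) →
                (∀ {x y} → x S.≈ y → π⁻¹ x S.≈ π⁻¹ y) →
                (∀ x → π (π⁻¹ x) S.≈ x) → (∀ x → π⁻¹ (π x) S.≈ x) →
                ∑ (λ x → f (π x)) ≈ ∑ f
    ∑-permute f π π⁻¹ f-cong π-cong π⁻¹-cong invˡ invʳ = sym (begin
      ∑ f                                       ≈⟨ sum-permute (f ∘ I.to) perm ⟩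
      sum (λ j → f (I.to (I.from (π (I.to j))))) ≈⟨ sum-cong-≋ (λ j → f-cong (I.strictlyInverseˡ (π (I.to j)))) ⟩
      ∑ (λ x → f (π x))                         ∎)
      where
      open ≈-Reasoning setoid
      cancel : ∀ (g h : S.Carrier → S.Carrier) →
               (∀ {x y} → x S.≈ y → g x S.≈ g y) → (∀ x → g (h x) S.≈ x) →
               ∀ j → I.from (g (I.to (I.from (h (I.to j))))) ≡ j
      cancel g h g-cong gh j = ≡.trans
        (I.from-cong (S.trans (g-cong (I.strictlyInverseˡ _)) (gh (I.to j))))
        (I.strictlyInverseʳ j)
      perm : Permutation n n
      perm = permutation (λ j → I.from (π (I.to j))) (λ j → I.from (π⁻¹ (I.to j)))
               (cancel π π⁻¹ π-cong invˡ)
               (cancel π⁻¹ π π⁻¹-cong invʳ)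

  infixr 8 _when_
  _when_ : Carrier → Dec P → Carrier
  x when yes _ = x
  x when no  _ = ε

  when-yes : ∀ {x} (d : Dec P) → P → x when d ≈ x
  when-yes (yes _) _ = refl
  when-yes (no ¬p) p = contradiction p ¬p

  when-no : ∀ {x} (d : Dec P) → ¬ P → x when d ≈ ε
  when-no (yes p) ¬p = contradiction p ¬p
  when-no (no _)  _  = refl

  -- The two decisions may come from different procedures for equivalent conditions, and the values
  -- need to agree only where the condition holds. Changes of variable and of summation range go
  -- through this.
  when-cong : ∀ {x y} (d : Dec P) (e : Dec Q) → (P → Q) → (Q → P) → (P → x ≈ y) → x when d ≈ y when e
  when-cong (yes p) e to from x≈y = trans (x≈y p) (sym (when-yes e (to p)))
  when-cong (no ¬p) e to from x≈y = sym (when-no e (λ q → ¬p (from q)))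

  opaque
    unfolding ∑
    ∑-single : ∀ f c → (∀ {x y} → x S.≈ y → f x ≈ f y) →
               (∀ x → ¬ (x S.≈ c) → f x ≈ ε) → ∑ f ≈ f c
    ∑-single f c f-cong f-off = go n I.to (I.from c) (I.strictlyInverseˡ c)
        (λ {i} {j} eq → ≡.trans (≡.sym (I.strictlyInverseʳ i)) (≡.trans (I.from-cong eq) (I.strictlyInverseʳ j)))
      where
      -- The enumeration is generalised to an injective family of variable length, since
      -- `sum-remove` requires a length of the form `suc m`.
      go : ∀ m (e : Fin m → S.Carrier) (k : Fin m) → e k S.≈ c →
           (∀ {i j} → e i S.≈ e j → i ≡ j) → sum (λ j → f (e j)) ≈ f c
      go (suc m) e k ek≈c e-inj = trans (sum-remove {i = k} (f ∘ e)) (trans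
        (∙-cong (f-cong ek≈c) (trans (sum-cong-≋ off) (sum-replicate-zero m))) (identityʳ _))
        where
        off : ∀ j → f (e (punchIn k j)) ≈ ε
        off j = f-off _ (λ eq → Fin.punchInᵢ≢i k j (e-inj (S.trans eq (S.sym ek≈c))))

  ∑-when-≈ : (_≟_ : Decidable S._≈_) → ∀ (f : S.Carrier → Carrier) c → (∀ {x y} → x S.≈ y → f x ≈ f y) →
             ∑ (λ x → f x when (x ≟ c)) ≈ f c
  ∑-when-≈ _≟_ f c f-cong = trans
    (∑-single (λ x → f x when (x ≟ c)) c term-cong (λ x x≉c → when-no (x ≟ c) x≉c))
    (when-yes (c ≟ c) S.refl)
    where
    term-cong : ∀ {x y} → x S.≈ y → f x when (x ≟ c) ≈ f y when (y ≟ c)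
    term-cong {x} {y} x≈y = when-cong (x ≟ c) (y ≟ c) (S.trans (S.sym x≈y)) (S.trans x≈y) (λ _ → f-cong x≈y)

module FiniteSemiringSum {S : Setoid c ℓ} {n : ℕ} (enum : Inverse (≡.setoid (Fin n)) S)
                         (R : CommutativeSemiring r ℓr) where
  private
    module S = Setoid S
  open CommutativeSemiring R hiding (zero)
  open FiniteSum enum +-commutativeMonoid public
  open SRSum semiring using (*-distribˡ-sum; *-distribʳ-sum)

  opaque
    unfolding ∑

    *-distribˡ-∑ : ∀ x (f : S.Carrier → Carrier) → x * ∑ f ≈ ∑ (λ y → x * f y)
    *-distribˡ-∑ x f = *-distribˡ-sum x (λ j → f (Inverse.to enum j))

    *-distribʳ-∑ : ∀ x (f : S.Carrier → Carrier) → ∑ f * x ≈ ∑ (λ y → f y * x)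
    *-distribʳ-∑ x f = *-distribʳ-sum x (λ j → f (Inverse.to enum j))

  ∑-*-∑ : ∀ (f g : S.Carrier → Carrier) → ∑ f * ∑ g ≈ ∑ (λ x → ∑ (λ y → f x * g y))
  ∑-*-∑ f g = trans (*-distribʳ-∑ _ f) (∑-cong (λ x → *-distribˡ-∑ (f x) g))

  *-when : ∀ x {y} (d : Dec P) → x * (y when d) ≈ (x * y) when d
  *-when x (yes _) = refl
  *-when x (no  _) = zeroʳ x

  when-* : ∀ {x} y (d : Dec P) → (x when d) * y ≈ (x * y) when d
  when-* y (yes _) = refl
  when-* y (no  _) = zeroˡ y

  module Subset {G : S.Carrier → Set p} (G? : ∀ x → Dec (G x)) where

    ∑∈ : (S.Carrier → Carrier) → Carrier
    ∑∈ f = ∑ (λ x → f x when G? x)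

    ∑∈-cong : ∀ {f g} → (∀ x → G x → f x ≈ g x) → ∑∈ f ≈ ∑∈ g
    ∑∈-cong f≈g = ∑-cong (λ x → when-cong (G? x) (G? x) (λ h → h) (λ h → h) (f≈g x))

    ∑∈-distrib : ∀ f g → ∑∈ (λ x → f x + g x) ≈ ∑∈ f + ∑∈ g
    ∑∈-distrib f g = trans (∑-cong (λ x → when-+ (G? x))) (∑-distrib _ _)
      where
      when-+ : ∀ {x y} (d : Dec P) → (x + y) when d ≈ x when d + y when d
      when-+ (yes _) = refl
      when-+ (no  _) = sym (+-identityˡ 0#)

    *-distribˡ-∑∈ : ∀ x (f : S.Carrier → Carrier) → x * ∑∈ f ≈ ∑∈ (λ y → x * f y)
    *-distribˡ-∑∈ x f = trans (*-distribˡ-∑ x _) (∑-cong (λ y → *-when x (G? y)))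

    *-distribʳ-∑∈ : ∀ x (f : S.Carrier → Carrier) → ∑∈ f * x ≈ ∑∈ (λ y → f y * x)
    *-distribʳ-∑∈ x f = trans (*-distribʳ-∑ x _) (∑-cong (λ y → when-* x (G? y)))

    ∑∈-∑-swap : ∀ (f : S.Carrier → S.Carrier → Carrier) → ∑∈ (λ x → ∑ (f x)) ≈ ∑ (λ y → ∑∈ (λ x → f x y))
    ∑∈-∑-swap f = trans (∑-cong (λ x → ∑-when-swap x (G? x))) (∑-swap _)
      where
      ∑-when-swap : ∀ x (d : Dec P) → ∑ (f x) when d ≈ ∑ (λ y → f x y when d)
      ∑-when-swap x (yes _) = refl
      ∑-when-swap x (no  _) = sym (∑-ε (λ _ → refl))

module Counting {S : Setoid c ℓ} {n : ℕ} (enum : Inverse (≡.setoid (Fin n)) S) where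
  private
    module S = Setoid S
    module I = Inverse enum
  open FiniteSemiringSum enum ℕ.+-*-commutativeSemiring public

  count : {P : S.Carrier → Set p} → (∀ x → Dec (P x)) → ℕ
  count P? = ∑ (λ x → 1 when P? x)

  private
    open CMSum ℕ.+-0-commutativeMonoid using (sum)

    sum-mono-≤ : ∀ {m} {f g : Fin m → ℕ} → (∀ j → f j ≤ g j) → sum f ≤ sum g
    sum-mono-≤ {zero}  f≤g = z≤n
    sum-mono-≤ {suc m} f≤g = ℕ.+-mono-≤ (f≤g zero) (sum-mono-≤ (f≤g ∘ suc))

  opaque
    unfolding ∑

    ∑-mono-≤ : ∀ {f g} → (∀ x → f x ≤ g x) → ∑ f ≤ ∑ g
    ∑-mono-≤ f≤g = sum-mono-≤ (λ j → f≤g (I.to j))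

    ∑-mono-< : ∀ {f g} → (∀ {x y} → x S.≈ y → f x ≡ f y) → (∀ {x y} → x S.≈ y → g x ≡ g y) →
               (∀ x → f x ≤ g x) → ∀ x → f x < g x → ∑ f < ∑ g
    ∑-mono-< {f} {g} f-cong g-cong f≤g x fx<gx = go (λ j → f≤g (I.to j)) (I.from x)
      (≡.subst₂ _<_ (f-cong (S.sym to-from)) (g-cong (S.sym to-from)) fx<gx)
      where
      to-from : I.to (I.from x) S.≈ x
      to-from = I.strictlyInverseˡ x
      go : ∀ {m} {f g : Fin m → ℕ} → (∀ j → f j ≤ g j) → ∀ j → f j < g j → sum f < sum g
      go f≤g zero    lt = ℕ.+-mono-<-≤ lt (sum-mono-≤ (f≤g ∘ suc))
      go f≤g (suc j) lt = ℕ.+-mono-≤-< (f≤g zero) (go (f≤g ∘ suc) j lt)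

    ∣-∑ : ∀ {d f} → (∀ x → d ℕ.∣ f x) → d ℕ.∣ ∑ f
    ∣-∑ {d} {f} d∣f = go (λ j → d∣f (I.to j))
      where
      go : ∀ {m} {f : Fin m → ℕ} → (∀ j → d ℕ.∣ f j) → d ℕ.∣ sum f
      go {zero}  d∣f = d ℕ.∣0
      go {suc m} d∣f = ℕ.∣m∣n⇒∣m+n (d∣f zero) (go (d∣f ∘ suc))

  ∑-constant : ∀ k → ∑ (λ _ → k) ≡ n ℕ.* k
  ∑-constant k = ≡.trans (∑-const k) (×≡* n)
    where
    ×≡* : ∀ m → CMMult._×_ ℕ.+-0-commutativeMonoid m k ≡ m ℕ.* k
    ×≡* zero    = ≡.refl
    ×≡* (suc m) = ≡.cong (k ℕ.+_) (×≡* m)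

  count-true : ∀ {P : S.Carrier → Set p} (P? : ∀ x → Dec (P x)) → (∀ x → P x) → count P? ≡ n
  count-true P? all = ≡.trans (∑-cong (λ x → when-yes (P? x) (all x))) (≡.trans (∑-constant 1) (ℕ.*-identityʳ n))

  count-cong : ∀ {P : S.Carrier → Set p} {Q : S.Carrier → Set p′}
               (P? : ∀ x → Dec (P x)) (Q? : ∀ x → Dec (Q x)) →
               (∀ x → P x → Q x) → (∀ x → Q x → P x) → count P? ≡ count Q?
  count-cong P? Q? to from = ∑-cong (λ x → when-cong (P? x) (Q? x) (to x) (from x) (λ _ → ≡.refl))

-- The bridge between counting and character sums: a count is evaluated in the field and then
-- recovered, since the cast is injective in characteristic zero.
module FiniteSumCast {S : Setoid c ℓ} {n : ℕ} (enum : Inverse (≡.setoid (Fin n)) S)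
                     (R : CommutativeSemiring r ℓr) where
  private
    module S = Setoid S
  open CommutativeSemiring R hiding (zero)
  open FiniteSemiringSum enum R
  open SRMult semiring using (_×_; ×-homo-+)
  private module # = Counting enum
  open # using (count)

  opaque
    unfolding ∑

    ∑-×1 : ∀ f → #.∑ f × 1# ≈ ∑ (λ x → f x × 1#)
    ∑-×1 f = go (λ j → f (Inverse.to enum j))
      where
      open CMSum ℕ.+-0-commutativeMonoid using () renaming (sum to sumℕ)
      open CMSum +-commutativeMonoid using (sum)
      go : ∀ {m} (f : Fin m → ℕ) → sumℕ f × 1# ≈ sum (λ j → f j × 1#)
      go {zero}  f = refl
      go {suc m} f = trans (×-homo-+ 1# (f zero) _) (+-congˡ (go (f ∘ suc)))

  ∑∈-×1 : ∀ {G : S.Carrier → Set p} (G? : ∀ x → Dec (G x)) f →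
          #.Subset.∑∈ G? f × 1# ≈ Subset.∑∈ G? (λ x → f x × 1#)
  ∑∈-×1 G? f = trans (∑-×1 _) (∑-cong (λ x → when-×1 (G? x)))
    where
    when-×1 : ∀ {m} (d : Dec P) → (m #.when d) × 1# ≈ (m × 1#) when d
    when-×1 (yes _) = refl
    when-×1 (no  _) = refl

  ∑-when : ∀ {P : S.Carrier → Set p} (P? : ∀ x → Dec (P x)) y → ∑ (λ x → y when P? x) ≈ (count P? × 1#) * y
  ∑-when P? y = sym (trans (*-congʳ (∑-×1 _)) (trans (*-distribʳ-∑ y _) (∑-cong term)))
    where
    term : ∀ x → ((1 #.when P? x) × 1#) * y ≈ y when P? x
    term x with P? x
    ... | yes _ = trans (*-congʳ (+-identityʳ 1#)) (*-identityˡ y)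
    ... | no  _ = zeroˡ y

-- Fields and finite fields

module HeytingFieldProperties (F : HeytingField c ℓ ℓ′) where
  open Field F hiding (zero)
  open CommutativeRing commutativeRing using (ring)
  open RingProperties ring
  open ≈-Reasoning setoid

  -- Tightness makes equality the negation of apartness, and negations are stable. Vanishing can
  -- therefore be proved by contradiction although equality in a Heyting field need not be
  -- decidable.
  ≈-stable : ∀ {x y} → ¬ ¬ (x ≈ y) → x ≈ y
  ≈-stable {x} {y} ¬¬x≈y = proj₁ (tight x y) (λ x#y → ¬¬x≈y (λ x≈y → proj₂ (tight x y) x≈y x#y))

  #⇒≉ : ∀ {x y} → x # y → ¬ (x ≈ y)
  #⇒≉ {x} {y} x#y x≈y = proj₂ (tight x y) x≈y x#y

  x-0≈x : ∀ x → x - 0# ≈ x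
  x-0≈x x = trans (+-congˡ -0#≈0#) (+-identityʳ x)

  x-y+y≈x : ∀ x y → x - y + y ≈ x
  x-y+y≈x x y = trans (+-assoc x _ y) (trans (+-congˡ (-‿inverseˡ y)) (+-identityʳ x))

  #0⇒inverse : ∀ {x} → x # 0# → ∃[ y ] x * y ≈ 1#
  #0⇒inverse x#0 with #⇒invertible x#0
  ... | y , _ , xy≈1 = y , trans (*-congʳ (sym (x-0≈x _))) xy≈1

  inverse⇒#0 : ∀ {x y} → x * y ≈ 1# → x # 0#
  inverse⇒#0 {x} {y} xy≈1 = invertible⇒# (y , trans (*-comm _ _) xy , xy)
    where xy = trans (*-congʳ (x-0≈x x)) xy≈1

  ≉0⇒¬¬inverse : ∀ {x} → ¬ (x ≈ 0#) → ¬ ¬ (∃[ y ] x * y ≈ 1#)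
  ≉0⇒¬¬inverse x≉0 ¬inv = x≉0 (proj₁ (tight _ _) (λ x#0 → ¬inv (#0⇒inverse x#0)))

  -- A factor that is merely unequal to 0 has an inverse only up to double negation; stability of
  -- the conclusion absorbs this.
  *-integral : ∀ {x y} → x * y ≈ 0# → ¬ (x ≈ 0#) → y ≈ 0#
  *-integral {x} {y} xy≈0 x≉0 = ≈-stable λ y≉0 → ≉0⇒¬¬inverse x≉0 λ (z , xz≈1) → y≉0 (begin
    y           ≈⟨ *-identityˡ y ⟨
    1# * y      ≈⟨ *-congʳ xz≈1 ⟨
    x * z * y   ≈⟨ *-congʳ (*-comm x z) ⟩
    z * x * y   ≈⟨ *-assoc z x y ⟩
    z * (x * y) ≈⟨ *-congˡ xy≈0 ⟩
    z * 0#      ≈⟨ zeroʳ z ⟩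
    0#          ∎)

  *-≉0 : ∀ {x y} → ¬ (x ≈ 0#) → ¬ (y ≈ 0#) → ¬ (x * y ≈ 0#)
  *-≉0 x≉0 y≉0 xy≈0 = y≉0 (*-integral xy≈0 x≉0)

  1≉0 : ¬ (1# ≈ 0#)
  1≉0 = #⇒≉ (inverse⇒#0 (*-identityˡ 1#))

  inverse⇒≉0 : ∀ {x y} → x * y ≈ 1# → ¬ (x ≈ 0#)
  inverse⇒≉0 xy≈1 x≈0 = 1≉0 (trans (sym xy≈1) (trans (*-congʳ x≈0) (zeroˡ _)))

  -≈0⇒≈ : ∀ {x y} → x - y ≈ 0# → x ≈ y
  -≈0⇒≈ = x∙y⁻¹≈ε⇒x≈y _ _

  ≈⇒-≈0 : ∀ {x y} → x ≈ y → x - y ≈ 0#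
  ≈⇒-≈0 = x≈y⇒x∙y⁻¹≈ε

  *-distribʳ-- : ∀ x y z → (x - y) * z ≈ x * z - y * z
  *-distribʳ-- x y z = trans (distribʳ z x (- y)) (+-congˡ (sym (-‿distribˡ-* y z)))

  *-distribˡ-- : ∀ x y z → x * (y - z) ≈ x * y - x * z
  *-distribˡ-- x y z = trans (distribˡ x y (- z)) (+-congˡ (sym (-‿distribʳ-* x z)))

  *-cancelˡ : ∀ {x y z} → ¬ (x ≈ 0#) → x * y ≈ x * z → y ≈ z
  *-cancelˡ x≉0 eq = -≈0⇒≈ (*-integral (trans (*-distribˡ-- _ _ _) (≈⇒-≈0 eq)) x≉0)

  ^≉0 : ∀ {x} n → ¬ (x ≈ 0#) → ¬ (x ^ n ≈ 0#)
  ^≉0 zero    x≉0 = 1≉0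
  ^≉0 (suc n) x≉0 = *-≉0 x≉0 (^≉0 n x≉0)

  0^ : ∀ n → .{{NonZero n}} → 0# ^ n ≈ 0#
  0^ (suc n) = zeroˡ _

  1^ : ∀ n → 1# ^ n ≈ 1#
  1^ zero    = refl
  1^ (suc n) = trans (*-identityˡ _) (1^ n)

module FiniteFieldProperties (K : FiniteField c ℓ ℓ′) where
  open FiniteField K hiding (zero)
  open CommutativeRing commutativeRing using (ring; commutativeSemiring; *-commutativeMonoid; +-commutativeSemigroup)
  open RingProperties ring
  open import Algebra.Properties.CommutativeSemigroup +-commutativeSemigroup using (interchange)
  open HeytingFieldProperties heytingField
  open CSExp commutativeSemiring using (^-congˡ)
  open ≈-Reasoning setoid
  private
    module # = Counting enumeration
    module Π = FiniteSum enumeration *-commutativeMonoid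

  ⁻¹-inverseʳ : ∀ {x} → ¬ (x ≈ 0#) → x * x ⁻¹ ≈ 1#
  ⁻¹-inverseʳ {x} x≉0 with Fin.any? (λ j → (x * element j) ≟ 1#)
  ... | yes (j , xy≈1) = xy≈1
  ... | no  ¬inv       = ⊥-elim (≉0⇒¬¬inverse x≉0 λ (y , xy≈1) →
    ¬inv (index y , trans (*-congˡ (Inverse.strictlyInverseˡ enumeration y)) xy≈1))

  ⁻¹-zero : ∀ {x} → x ≈ 0# → x ⁻¹ ≈ 0#
  ⁻¹-zero {x} x≈0 with Fin.any? (λ j → (x * element j) ≟ 1#)
  ... | yes (j , xy≈1) = contradiction x≈0 (inverse⇒≉0 xy≈1)
  ... | no  _          = refl

  ≉0⇒#0 : ∀ {x} → ¬ (x ≈ 0#) → x # 0#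
  ≉0⇒#0 x≉0 = inverse⇒#0 (⁻¹-inverseʳ x≉0)

  ∀-element : ∀ {P : Carrier → Set p} → (∀ {x y} → x ≈ y → P x → P y) →
              (∀ j → P (element j)) → ∀ x → P x
  ∀-element resp all x = resp (Inverse.strictlyInverseˡ enumeration x) (all (index x))

  all? : ∀ {P : Carrier → Set p} → (∀ {x y} → x ≈ y → P x → P y) → (∀ x → Dec (P x)) → Dec (∀ x → P x)
  all? resp P? = map′ (∀-element resp) (λ all j → all (element j)) (Fin.all? (λ j → P? (element j)))

  any? : ∀ {P : Carrier → Set p} → (∀ {x y} → x ≈ y → P x → P y) → (∀ x → Dec (P x)) → Dec (∃[ x ] P x)
  any? resp P? = map′ (λ (j , p) → element j , p)
    (λ (x , p) → index x , resp (sym (Inverse.strictlyInverseˡ enumeration x)) p)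
    (Fin.any? (λ j → P? (element j)))

  count-≈ : ∀ x → #.count (_≟ x) ≡ 1
  count-≈ x = #.∑-when-≈ _≟_ (λ _ → 1) x (λ _ → ≡.refl)

  order>1 : 1 < order
  order>1 = distinct (index 1#) (index 0#) (λ eq → 1≉0 (begin
    1#                  ≈⟨ Inverse.strictlyInverseˡ enumeration 1# ⟨
    element (index 1#)  ≡⟨ ≡.cong element eq ⟩
    element (index 0#)  ≈⟨ Inverse.strictlyInverseˡ enumeration 0# ⟩
    0#                  ∎))
    where
    distinct : ∀ {n} (i j : Fin n) → i ≢ j → 1 < n
    distinct {suc zero}    zero zero i≢j = contradiction ≡.refl i≢j
    distinct {suc (suc n)} _    _    _   = s≤s (s≤s z≤n)

  opaque
    unfolding FiniteSum.∑

    ∏-≉0 : ∀ {f} → (∀ x → ¬ (f x ≈ 0#)) → ¬ (Π.∑ f ≈ 0#)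
    ∏-≉0 f≉0 = go (λ j → f≉0 (element j))
      where
      open CMSum *-commutativeMonoid using () renaming (sum to product)
      go : ∀ {m} {f : Fin m → Carrier} → (∀ j → ¬ (f j ≈ 0#)) → ¬ (product f ≈ 0#)
      go {zero}  _   = 1≉0
      go {suc m} f≉0 = *-≉0 (f≉0 zero) (go (f≉0 ∘ suc))

  -- Multiplying the product of the nonzero elements by x in each of the |K| factors.
  fermat : ∀ x → x ^ order ≈ x
  fermat x with x ≟ 0#
  ... | yes x≈0 = trans (^-congˡ order x≈0) (trans (0^ order {{ℕ.>-nonZero (ℕ.<-trans ℕ.z<s order>1)}}) (sym x≈0))
  ... | no  x≉0 = *-cancelˡ (∏-≉0 g≉0) (begin
    ∏g * x ^ order                 ≈⟨ *-comm _ _ ⟩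
    x ^ order * ∏g                 ≈⟨ *-congʳ (Π.∑-const x) ⟨
    Π.∑ (λ _ → x) * ∏g             ≈⟨ Π.∑-distrib (λ _ → x) g ⟨
    Π.∑ (λ y → x * g y)            ≈⟨ Π.∑-cong factor ⟩
    Π.∑ (λ y → δ y * g (x * y))    ≈⟨ Π.∑-distrib δ (λ y → g (x * y)) ⟩
    Π.∑ δ * Π.∑ (λ y → g (x * y))  ≈⟨ *-cong (Π.∑-when-≈ _≟_ (λ _ → x) 0# (λ _ → refl))
                                         (Π.∑-permute g (x *_) (x ⁻¹ *_) g-cong *-congˡ *-congˡ
                                           (λ y → trans (sym (*-assoc x _ y)) (trans (*-congʳ xx⁻¹) (*-identityˡ y)))
                                           (λ y → trans (sym (*-assoc _ x y)) (trans (*-congʳ x⁻¹x) (*-identityˡ y)))) ⟩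
    x * ∏g                         ≈⟨ *-comm _ _ ⟩
    ∏g * x                         ∎)
    where
    xx⁻¹ : x * x ⁻¹ ≈ 1#
    xx⁻¹ = ⁻¹-inverseʳ x≉0
    x⁻¹x : x ⁻¹ * x ≈ 1#
    x⁻¹x = trans (*-comm _ _) xx⁻¹
    -- In the multiplicative monoid `when` falls back to 1, so `g` replaces 0 by 1 and `δ` is 1 away
    -- from 0. The factor x at the index 0 is not absorbed by the permutation y ↦ x y; it is the x
    -- that remains at the end.
    g δ : Carrier → Carrier
    g y = y Π.when ¬? (y ≟ 0#)
    δ y = x Π.when (y ≟ 0#)
    ∏g = Π.∑ g
    g-cong : ∀ {y z} → y ≈ z → g y ≈ g z
    g-cong y≈z = Π.when-cong (¬? (_ ≟ 0#)) (¬? (_ ≟ 0#)) (λ y≉0 z≈0 → y≉0 (trans y≈z z≈0))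
      (λ z≉0 y≈0 → z≉0 (trans (sym y≈z) y≈0)) (λ _ → y≈z)
    g≉0 : ∀ y → ¬ (g y ≈ 0#)
    g≉0 y with y ≟ 0#
    ... | yes _   = 1≉0
    ... | no  y≉0 = y≉0
    factor : ∀ y → x * g y ≈ δ y * g (x * y)
    factor y with y ≟ 0#
    ... | yes y≈0 = *-congˡ (sym (Π.when-no (¬? ((x * y) ≟ 0#)) (λ ¬p → ¬p (trans (*-congˡ y≈0) (zeroʳ x)))))
    ... | no  y≉0 = sym (trans (*-identityˡ _) (Π.when-yes (¬? ((x * y) ≟ 0#)) (*-≉0 x≉0 y≉0)))

  ^-pred : ∀ {x} m → ¬ (x ≈ 0#) → x ^ suc m ≈ x → x ^ m ≈ 1#
  ^-pred m x≉0 eq = *-cancelˡ x≉0 (trans eq (sym (*-identityʳ _)))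

  -- Poly l d f: f is a polynomial function of degree at most d with coefficient l at xᵈ,
  -- written in Horner form.
  data Poly (l : Carrier) : ℕ → (Carrier → Carrier) → Set (c ⊔ ℓ) where
    leading : ∀ {f} → (∀ x → f x ≈ l) → Poly l 0 f
    horner  : ∀ {d f g} k → Poly l d g → (∀ x → f x ≈ x * g x + k) → Poly l (suc d) f

  Poly-resp : ∀ {l d f g} → (∀ x → g x ≈ f x) → Poly l d f → Poly l d g
  Poly-resp g≈f (leading f≈l)    = leading (λ x → trans (g≈f x) (f≈l x))
  Poly-resp g≈f (horner k P f≈) = horner k P (λ x → trans (g≈f x) (f≈ x))

  Poly-lead : ∀ {l m d f} → l ≈ m → Poly l d f → Poly m d f
  Poly-lead l≈m (leading f≈l)   = leading (λ x → trans (f≈l x) l≈m)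
  Poly-lead l≈m (horner k P f≈) = horner k (Poly-lead l≈m P) f≈

  Poly-cong : ∀ {l d f} → Poly l d f → ∀ {x y} → x ≈ y → f x ≈ f y
  Poly-cong (leading f≈l)   _   = trans (f≈l _) (sym (f≈l _))
  Poly-cong (horner k P f≈) x≈y =
    trans (f≈ _) (trans (+-congʳ (*-cong x≈y (Poly-cong P x≈y))) (sym (f≈ _)))

  Poly-+ : ∀ {l m d f g} → Poly l d f → Poly m d g → Poly (l + m) d (λ x → f x + g x)
  Poly-+ (leading f≈l)   (leading g≈m)   = leading (λ x → +-cong (f≈l x) (g≈m x))
  Poly-+ (horner k P f≈) (horner j Q g≈) = horner (k + j) (Poly-+ P Q) (λ x →
    trans (+-cong (f≈ x) (g≈ x)) (trans (interchange _ _ _ _) (+-congʳ (sym (distribˡ x _ _)))))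

  Poly-^ : ∀ m → Poly 1# m (_^ m)
  Poly-^ zero    = leading (λ _ → refl)
  Poly-^ (suc m) = horner 0# (Poly-^ m) (λ x → sym (+-identityʳ _))

  Poly-raise : ∀ {l d f} → Poly l d f → Poly 0# (suc d) f
  Poly-raise {l} (leading f≈l) = horner l (leading {f = λ _ → 0#} (λ _ → refl)) (λ x →
    trans (f≈l x) (sym (trans (+-congʳ (zeroʳ x)) (+-identityˡ l))))
  Poly-raise (horner k P f≈) = horner k (Poly-raise P) f≈

  Poly-< : ∀ {l m d f} → m < d → Poly l m f → Poly 0# d f
  Poly-< m<d = go (ℕ.≤⇒≤′ m<d)
    where
    go : ∀ {l m d f} → suc m ℕ.≤′ d → Poly l m f → Poly 0# d f
    go ℕ.≤′-refl       P = Poly-raise P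
    go (ℕ.≤′-step m<d) P = Poly-raise (go m<d P)

  Poly-+-< : ∀ {l m d f g} → Poly 1# d f → m < d → Poly l m g → Poly 1# d (λ x → f x + g x)
  Poly-+-< P m<d Q = Poly-lead (+-identityʳ 1#) (Poly-+ P (Poly-< m<d Q))

  -- Synthetic division in Horner form: if h is the quotient of g by x - a, then x h + g(a) is the
  -- quotient of x g + k. The leading coefficient is inherited, so monic stays monic.
  Poly-factor : ∀ {l d f} → Poly l (suc d) f → ∀ a →
                ∃[ h ] (Poly l d h ∧ (∀ x → f x ≈ (x - a) * h x + f a))
  Poly-factor {l} {zero} {f} (horner {g = g} k (leading g≈l) f≈) a = (λ _ → l) , leading (λ _ → refl) , λ x → begin
    f x                           ≈⟨ f≈ x ⟩
    x * g x + k                   ≈⟨ +-congʳ (*-cong (sym (x-y+y≈x x a)) (g≈l x)) ⟩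
    (x - a + a) * l + k           ≈⟨ +-congʳ (distribʳ l _ _) ⟩
    (x - a) * l + a * l + k       ≈⟨ +-assoc _ _ _ ⟩
    (x - a) * l + (a * l + k)     ≈⟨ +-congˡ (+-congʳ (*-congˡ (g≈l a))) ⟨
    (x - a) * l + (a * g a + k)   ≈⟨ +-congˡ (f≈ a) ⟨
    (x - a) * l + f a             ∎
  Poly-factor {l} {suc d} {f} (horner {g = g} k P f≈) a with Poly-factor P a
  ... | h , Q , g≈ = (λ x → x * h x + g a) , horner (g a) Q (λ _ → refl) , λ x → begin
    f x                                             ≈⟨ f≈ x ⟩
    x * g x + k                                     ≈⟨ +-congʳ (*-congˡ (g≈ x)) ⟩
    x * ((x - a) * h x + g a) + k                   ≈⟨ +-congʳ (distribˡ x _ _) ⟩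
    x * ((x - a) * h x) + x * g a + k               ≈⟨ +-congʳ (+-cong (x∙yz (x - a) x (h x)) (*-congʳ (x-y+y≈x x a))) ⟨
    (x - a) * (x * h x) + (x - a + a) * g a + k     ≈⟨ +-congʳ (+-congˡ (distribʳ (g a) _ _)) ⟩
    (x - a) * (x * h x) + ((x - a) * g a + a * g a) + k ≈⟨ +-congʳ (+-assoc _ _ _) ⟨
    (x - a) * (x * h x) + (x - a) * g a + a * g a + k ≈⟨ +-assoc _ _ _ ⟩
    (x - a) * (x * h x) + (x - a) * g a + (a * g a + k) ≈⟨ +-cong (distribˡ _ _ _) (f≈ a) ⟨
    (x - a) * (x * h x + g a) + f a                 ∎
    where
    open import Algebra.Properties.CommutativeSemigroup (CommutativeMonoid.commutativeSemigroup *-commutativeMonoid)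
      using () renaming (x∙yz≈y∙xz to x∙yz)

  -- Dividing by x - a at a root a, every root of f is a or a root of the quotient; the induction on
  -- the degree adds one for a.
  count-roots : ∀ {d f} → Poly 1# d f → #.count (λ x → f x ≟ 0#) ≤ d
  count-roots {zero} {f} (leading f≈1) =
    ℕ.≤-reflexive (#.∑-ε (λ x → #.when-no (f x ≟ 0#) (λ fx≈0 → 1≉0 (trans (sym (f≈1 x)) fx≈0))))
  count-roots {suc d} {f} P with any? (λ x≈y → trans (Poly-cong P (sym x≈y))) (λ x → f x ≟ 0#)
  ... | no  ¬root = ℕ.≤-trans (ℕ.≤-reflexive
    (#.∑-ε (λ x → #.when-no (f x ≟ 0#) (λ fx≈0 → ¬root (x , fx≈0))))) z≤n
  ... | yes (a , fa≈0) with Poly-factor P a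
  ... | h , Q , f≈ = ℕ.≤-trans (#.∑-mono-≤ term)
    (ℕ.≤-trans (ℕ.≤-reflexive (#.∑-distrib _ _)) (ℕ.+-mono-≤ (ℕ.≤-reflexive (count-≈ a)) (count-roots Q)))
    where
    term : ∀ x → 1 #.when (f x ≟ 0#) ≤ 1 #.when (x ≟ a) ℕ.+ 1 #.when (h x ≟ 0#)
    term x with f x ≟ 0# | x ≟ a
    ... | no  _    | _       = z≤n
    ... | yes _    | yes _   = s≤s z≤n
    ... | yes fx≈0 | no  x≉a = ℕ.≤-reflexive (≡.sym (#.when-yes (h x ≟ 0#)
      (*-integral (trans (sym (trans (+-congˡ fa≈0) (+-identityʳ _))) (trans (sym (f≈ x)) fx≈0))
        (λ x-a≈0 → x≉a (-≈0⇒≈ x-a≈0)))))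

  -- The same bound for a given injective family, the shape in which `prime-subfield` meets p + 1
  -- roots.
  distinct-roots : ∀ {d f} → Poly 1# d f → (r : Fin (suc d) → Carrier) →
                   (∀ {i j} → r i ≈ r j → i ≡ j) → ¬ (∀ i → f (r i) ≈ 0#)
  distinct-roots {zero} (leading f≈1) r _ root = 1≉0 (trans (sym (f≈1 _)) (root zero))
  distinct-roots {suc d} P r r-inj root with Poly-factor P (r zero)
  ... | h , Q , f≈ = distinct-roots Q (r ∘ suc) (λ eq → Fin.suc-injective (r-inj eq)) (λ i →
    *-integral
      (trans (sym (trans (+-congˡ (root zero)) (+-identityʳ _))) (trans (sym (f≈ _)) (root (suc i))))
      (λ eq → Fin.0≢1+n (r-inj (sym (-≈0⇒≈ eq)))))

-- Binomial coefficients modulo a prime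

p∣k!⇒p≤k : ∀ {p} → Prime p → ∀ k → p ℕ.∣ k ! → p ≤ k
p∣k!⇒p≤k {p} pr zero    p∣1 = contradiction (≡.subst Prime (ℕ.∣1⇒≡1 p∣1) pr) Primality.¬prime[1]
p∣k!⇒p≤k {p} pr (suc k) p∣k! with euclidsLemma (suc k) (k !) pr p∣k!
... | inj₁ p∣1+k = ℕ.∣⇒≤ p∣1+k
... | inj₂ p∣k!  = ℕ.≤-trans (p∣k!⇒p≤k pr k p∣k!) (ℕ.n≤1+n k)

-- The prime p divides p! = (p C k) k! (p - k)!, but neither of the two factorials, because all
-- their factors are smaller than p.
p∣pCk : ∀ {p} → Prime p → ∀ k → 0 < k → k < p → p ℕ.∣ p C k
p∣pCk {p} pr k 0<k k<p with euclidsLemma (p C k) (k ! ℕ.* (p ℕ.∸ k) !) pr p∣product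
  where
  instance
    _ = k !* (p ℕ.∸ k) !≢0
  k≤p : k ≤ p
  k≤p = ℕ.<⇒≤ k<p
  p!≡ : (p C k) ℕ.* (k ! ℕ.* (p ℕ.∸ k) !) ≡ p !
  p!≡ = ≡.trans (≡.cong (ℕ._* (k ! ℕ.* (p ℕ.∸ k) !)) (nCk≡n!/k![n-k]! k≤p)) (m/n*n≡m (k![n∸k]!∣n! k≤p))
  p∣p! : ∀ {p} → .{{NonZero p}} → p ℕ.∣ p !
  p∣p! {suc p} = ℕ.m∣m*n (p !)
  p∣product : p ℕ.∣ (p C k) ℕ.* (k ! ℕ.* (p ℕ.∸ k) !)
  p∣product = ≡.subst (p ℕ.∣_) (≡.sym p!≡) (p∣p! {{Primality.prime⇒nonZero pr}})
... | inj₁ p∣pCk = p∣pCk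
... | inj₂ p∣k![p-k]! with euclidsLemma (k !) ((p ℕ.∸ k) !) pr p∣k![p-k]!
... | inj₁ p∣k!     = contradiction (p∣k!⇒p≤k pr k p∣k!) (ℕ.<⇒≱ k<p)
... | inj₂ p∣[p-k]! = contradiction (p∣k!⇒p≤k pr (p ℕ.∸ k) p∣[p-k]!) (ℕ.<⇒≱ (ℕ.∸-monoʳ-< 0<k (ℕ.<⇒≤ k<p)))

-- Frobenius, prime subfield and trace in characteristic p

module CharacteristicProperties (K : FiniteField c ℓ ℓ′) {p : ℕ} (p-prime : Prime p)
  (char : FiniteField.HasCharacteristic K p) {n : ℕ} (degree : FiniteField.HasPrimeDegree K p n) where
  open FiniteField K hiding (zero)
  open CommutativeRing commutativeRing using (ring; semiring; commutativeSemiring; +-commutativeMonoid)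
  open RingProperties ring
  open HeytingFieldProperties heytingField
  open FiniteFieldProperties K
  open CSExp commutativeSemiring using (^-congˡ; ^-congʳ; ^-assocʳ)
  open SRMult semiring using (×-homo-+; ×-congʳ; ×-assoc-*; ×-homo-1)
  open CMSum +-commutativeMonoid using (sum-cong-≋; sum-init-last; sum-replicate-zero; ∑-distrib-+)
  open ≈-Reasoning setoid
  private
    module # = Counting enumeration
    instance
      p-nonZero : NonZero p
      p-nonZero = Primality.prime⇒nonZero p-prime

  ×1≈0 : ∀ {m} → p ℕ.∣ m → m × 1# ≈ 0#
  ×1≈0 = Equivalence.from (char _)

  ×1≈0⇒∣ : ∀ {m} → m × 1# ≈ 0# → p ℕ.∣ m
  ×1≈0⇒∣ = Equivalence.to (char _)

  ×≈0 : ∀ {m} → p ℕ.∣ m → ∀ x → m × x ≈ 0#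
  ×≈0 {m} p∣m x = begin
    m × x         ≈⟨ ×-congʳ m (*-identityˡ x) ⟨
    m × (1# * x)  ≈⟨ ×-assoc-* m 1# x ⟨
    m × 1# * x    ≈⟨ *-congʳ (×1≈0 p∣m) ⟩
    0# * x        ≈⟨ zeroˡ x ⟩
    0#            ∎

  +-^p : ∀ x y → (x + y) ^ p ≈ x ^ p + y ^ p
  +-^p x y = go p ≡.refl
    where
    -- Generalising p to m exposes the exponent as `suc m`, so that the first and the last binomial
    -- term can be split off; the others vanish in characteristic p.
    go : ∀ m → m ≡ p → (x + y) ^ m ≈ x ^ m + y ^ m
    go zero    0≡p = ⊥-elim (ℕ.≢-nonZero⁻¹ p (≡.sym 0≡p))
    go (suc m) refl′ = begin
      (x + y) ^ suc m                        ≈⟨ Binomial.theorem commutativeSemiring (suc m) x y ⟩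
      term zero + sum (λ i → term (suc i))   ≈⟨ +-cong first (sum-init-last (λ i → term (suc i))) ⟩
      y ^ suc m + (sum (λ i → term (suc (inject₁ i))) + term (suc (fromℕ m)))
        ≈⟨ +-congˡ (+-cong (trans (sum-cong-≋ middle) (sum-replicate-zero m)) last) ⟩
      y ^ suc m + (0# + x ^ suc m)           ≈⟨ +-congˡ (+-identityˡ _) ⟩
      y ^ suc m + x ^ suc m                  ≈⟨ +-comm _ _ ⟩
      x ^ suc m + y ^ suc m                  ∎
      where
      term = Binomial.binomialTerm commutativeSemiring x y (suc m)
      first : term zero ≈ y ^ suc m
      first = trans (×-homo-1 _) (*-identityˡ _)
      middle : ∀ i → term (suc (inject₁ i)) ≈ 0#
      middle i = ×≈0 (≡.subst (ℕ._∣ (suc m C k)) refl′ (p∣pCk (≡.subst Prime (≡.sym refl′) p-prime) k (s≤s z≤n)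
        (s≤s (≡.subst (_< m) (≡.sym (Fin.toℕ-inject₁ i)) (Fin.toℕ<n i))))) _
        where k = suc (toℕ (inject₁ i))
      last : term (suc (fromℕ m)) ≈ x ^ suc m
      last rewrite Fin.toℕ-fromℕ m | nCn≡1 (suc m) | ℕ.n∸n≡0 m = trans (×-homo-1 _) (*-identityʳ _)

  +-^pⁱ : ∀ i x y → (x + y) ^ (p ℕ.^ i) ≈ x ^ (p ℕ.^ i) + y ^ (p ℕ.^ i)
  +-^pⁱ zero    x y = trans (*-identityʳ _) (+-cong (sym (*-identityʳ x)) (sym (*-identityʳ y)))
  +-^pⁱ (suc i) x y = begin
    (x + y) ^ (p ℕ.^ suc i)                      ≈⟨ ^-assocʳ (x + y) p (p ℕ.^ i) ⟨
    ((x + y) ^ p) ^ (p ℕ.^ i)                    ≈⟨ ^-congˡ (p ℕ.^ i) (+-^p x y) ⟩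
    (x ^ p + y ^ p) ^ (p ℕ.^ i)                  ≈⟨ +-^pⁱ i _ _ ⟩
    (x ^ p) ^ (p ℕ.^ i) + (y ^ p) ^ (p ℕ.^ i)    ≈⟨ +-cong (^-assocʳ x p (p ℕ.^ i)) (^-assocʳ y p (p ℕ.^ i)) ⟩
    x ^ (p ℕ.^ suc i) + y ^ (p ℕ.^ suc i)        ∎

  -- Coordinates inject K into the vectors over `Fin p`, and linear combinations inject these back,
  -- by uniqueness. Vectors are coded as elements of `Fin (p ^ n)` because they are compared only
  -- pointwise.
  order≡pⁿ : order ≡ p ℕ.^ n
  order≡pⁿ = Fin.cantor-schröder-bernstein {f = λ j → funToFin (coords (element j))}
    {g = λ k → index (combination (finToFun k))} f-inj g-inj
    where
    combination : Vector (Fin p) n → Carrier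
    combination k = sum (λ i → (toℕ (k i) × 1#) * proj₁ degree i)
    coords : Carrier → Vector (Fin p) n
    coords x = proj₁ (proj₂ degree x)
    coords-spec : ∀ x → x ≈ combination (coords x)
    coords-spec x = proj₁ (proj₂ (proj₂ degree x))
    coords-unique : ∀ {x} k → x ≈ combination k → ∀ i → coords x i ≡ k i
    coords-unique {x} _ = proj₂ (proj₂ (proj₂ degree x))
    combination-cong : ∀ {k l} → (∀ i → k i ≡ l i) → combination k ≈ combination l
    combination-cong k≗l = sum-cong-≋ (λ i → *-congʳ (reflexive (≡.cong (λ j → toℕ j × 1#) (k≗l i))))
    funToFin-cong : ∀ {m} {k l : Fin m → Fin p} → (∀ i → k i ≡ l i) → funToFin k ≡ funToFin l
    funToFin-cong {zero}  _   = ≡.refl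
    funToFin-cong {suc m} k≗l = ≡.cong₂ combine (k≗l zero) (funToFin-cong (k≗l ∘ suc))
    f-inj : ∀ {i j} → funToFin (coords (element i)) ≡ funToFin (coords (element j)) → i ≡ j
    f-inj {i} {j} eq = ≡.trans (≡.sym (Inverse.strictlyInverseʳ enumeration i)) (≡.trans
      (Inverse.from-cong enumeration (trans (coords-spec _) (trans (combination-cong (λ k →
        ≡.trans (≡.sym (Fin.finToFun-funToFin _ k)) (≡.trans (≡.cong (λ f → finToFun f k) eq) (Fin.finToFun-funToFin _ k))))
        (sym (coords-spec _)))))
      (Inverse.strictlyInverseʳ enumeration j))
    g-inj : ∀ {k l} → index (combination (finToFun k)) ≡ index (combination (finToFun l)) → k ≡ l
    g-inj {k} {l} eq = ≡.trans (≡.sym (Fin.funToFin-finToFin {n} {p} k)) (≡.trans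
      (funToFin-cong (λ i → ≡.trans (≡.sym (coords-unique (finToFun k) refl i)) (coords-unique (finToFun l) combinations≈ i)))
      (Fin.funToFin-finToFin {n} {p} l))
      where
      combinations≈ : combination (finToFun k) ≈ combination (finToFun l)
      combinations≈ = trans (sym (Inverse.strictlyInverseˡ enumeration _)) (trans
        (reflexive (≡.cong element eq)) (Inverse.strictlyInverseˡ enumeration _))

  ^pⁿ : ∀ x → x ^ (p ℕ.^ n) ≈ x
  ^pⁿ x = ≡.subst (λ m → x ^ m ≈ x) order≡pⁿ (fermat x)

  ×1-^p : ∀ m → (m × 1#) ^ p ≈ m × 1#
  ×1-^p zero    = 0^ p
  ×1-^p (suc m) = trans (+-^p 1# (m × 1#)) (+-cong (1^ p) (×1-^p m))

  ×1-∣∸ : ∀ {k l} → k ≤ l → k × 1# ≈ l × 1# → p ℕ.∣ l ℕ.∸ k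
  ×1-∣∸ {k} {l} k≤l eq = ×1≈0⇒∣ (begin
    (l ℕ.∸ k) × 1#                       ≈⟨ +-identityʳ _ ⟨
    (l ℕ.∸ k) × 1# + 0#                  ≈⟨ +-congˡ (-‿inverseʳ (k × 1#)) ⟨
    (l ℕ.∸ k) × 1# + (k × 1# - k × 1#)   ≈⟨ +-assoc _ _ _ ⟨
    (l ℕ.∸ k) × 1# + k × 1# - k × 1#     ≈⟨ +-congʳ (×-homo-+ 1# (l ℕ.∸ k) k) ⟨
    (l ℕ.∸ k ℕ.+ k) × 1# - k × 1#        ≡⟨ ≡.cong (λ m → m × 1# - k × 1#) (ℕ.m∸n+n≡m k≤l) ⟩
    l × 1# - k × 1#                      ≈⟨ ≈⇒-≈0 (sym eq) ⟩
    0#                                   ∎)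

  ×1-injective-≤ : ∀ {k l} → l < p → k ≤ l → k × 1# ≈ l × 1# → k ≡ l
  ×1-injective-≤ {k} {l} l<p k≤l eq =
    ℕ.≤-antisym k≤l (ℕ.m∸n≡0⇒m≤n (∣∧<⇒≡0 (×1-∣∸ k≤l eq) (ℕ.≤-<-trans (ℕ.m∸n≤m l k) l<p)))
    where
    ∣∧<⇒≡0 : ∀ {m} → p ℕ.∣ m → m < p → m ≡ 0
    ∣∧<⇒≡0 {zero}  _   _   = ≡.refl
    ∣∧<⇒≡0 {suc m} p∣m m<p = contradiction p∣m (ℕ.>⇒∤ m<p)

  ×1-injective : ∀ {k l} → k < p → l < p → k × 1# ≈ l × 1# → k ≡ l
  ×1-injective {k} {l} k<p l<p eq with ℕ.≤-total k l
  ... | inj₁ k≤l = ×1-injective-≤ l<p k≤l eq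
  ... | inj₂ l≤k = ≡.sym (×1-injective-≤ k<p l≤k (sym eq))

  1<p : 1 < p
  1<p = ℕ.nonTrivial⇒n>1 p {{Primality.prime⇒nonTrivial p-prime}}

  -- Otherwise y and the p multiples of 1 would be p + 1 distinct roots of x^p - x.
  prime-subfield : ∀ {y} → y ^ p ≈ y → ∃[ k ] (toℕ {p} k × 1# ≈ y)
  prime-subfield {y} yᵖ≈y with Fin.any? (λ k → (toℕ {p} k × 1#) ≟ y)
  ... | yes found = found
  ... | no  ¬found = ⊥-elim (distinct-roots
    (Poly-+-< (Poly-^ p) 1<p (horner 0# (leading {l = - 1#} {f = λ _ → - 1#} (λ _ → refl)) (λ _ → refl)))
    ρ ρ-inj ρ-root)
    where
    ρ : Fin (suc p) → Carrier
    ρ zero    = y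
    ρ (suc k) = toℕ k × 1#
    ρ-inj : ∀ {i j} → ρ i ≈ ρ j → i ≡ j
    ρ-inj {zero}  {zero}  _  = ≡.refl
    ρ-inj {zero}  {suc k} eq = ⊥-elim (¬found (k , sym eq))
    ρ-inj {suc k} {zero}  eq = ⊥-elim (¬found (k , eq))
    ρ-inj {suc k} {suc l} eq = ≡.cong suc (Fin.toℕ-injective (×1-injective (Fin.toℕ<n k) (Fin.toℕ<n l) eq))
    root : ∀ {x} → x ^ p ≈ x → x ^ p + (x * - 1# + 0#) ≈ 0#
    root {x} eq = trans (+-cong eq (trans (+-identityʳ _) (trans (*-comm _ _) (-1*x≈-x x)))) (-‿inverseʳ x)
    ρ-root : ∀ i → ρ i ^ p + (ρ i * - 1# + 0#) ≈ 0#
    ρ-root zero    = root yᵖ≈y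
    ρ-root (suc k) = root (×1-^p (toℕ k))

  residue-spec : ∀ {y} → y ^ p ≈ y → residue p y × 1# ≈ y
  residue-spec {y} yᵖ≈y with Fin.any? {p} (λ k → (toℕ k × 1#) ≟ y)
  ... | yes (k , eq) = eq
  ... | no  ¬found   = ⊥-elim (¬found (prime-subfield yᵖ≈y))

  trace-suc-first : ∀ m x → trace p (suc m) x ≈ x + trace p m (x ^ p)
  trace-suc-first m x = +-cong (*-identityʳ x) (sum-cong-≋ {m} (λ i → sym (^-assocʳ x p (p ℕ.^ toℕ i))))

  trace-suc-last : ∀ m x → trace p (suc m) x ≈ trace p m x + x ^ (p ℕ.^ m)
  trace-suc-last m x = trans (sum-init-last {m} (λ i → x ^ (p ℕ.^ toℕ i))) (+-cong
    (sum-cong-≋ {m} (λ i → reflexive (≡.cong (λ j → x ^ (p ℕ.^ j)) (Fin.toℕ-inject₁ i))))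
    (reflexive (≡.cong (λ j → x ^ (p ℕ.^ j)) (Fin.toℕ-fromℕ m))))

  trace-+ : ∀ m x y → trace p m (x + y) ≈ trace p m x + trace p m y
  trace-+ m x y = trans (sum-cong-≋ {m} (λ i → +-^pⁱ (toℕ i) x y))
    (∑-distrib-+ {m} (λ i → x ^ (p ℕ.^ toℕ i)) (λ i → y ^ (p ℕ.^ toℕ i)))

  trace-cong : ∀ m {x y} → x ≈ y → trace p m x ≈ trace p m y
  trace-cong m x≈y = sum-cong-≋ {m} (λ i → ^-congˡ (p ℕ.^ toℕ i) x≈y)

  trace-0 : ∀ m → trace p m 0# ≈ 0#
  trace-0 m = +-cancelˡ (trace p m 0#) _ _ (begin
    trace p m 0# + trace p m 0#   ≈⟨ trace-+ m 0# 0# ⟨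
    trace p m (0# + 0#)           ≈⟨ trace-cong m (+-identityʳ 0#) ⟩
    trace p m 0#                  ≈⟨ +-identityʳ _ ⟨
    trace p m 0# + 0#             ∎)

  -- The sum of length n + 1 can lose its first or its last term: x + Tr(x^p) = Tr(x) + x^(p^n),
  -- where x^(p^n) = x.
  trace-frobenius : ∀ x → trace p n (x ^ p) ≈ trace p n x
  trace-frobenius x = +-cancelˡ x _ _ (begin
    x + trace p n (x ^ p)        ≈⟨ trace-suc-first n x ⟨
    trace p (suc n) x            ≈⟨ trace-suc-last n x ⟩
    trace p n x + x ^ (p ℕ.^ n)  ≈⟨ +-comm _ _ ⟩
    x ^ (p ℕ.^ n) + trace p n x  ≈⟨ +-congʳ (^pⁿ x) ⟩
    x + trace p n x              ∎)

  sum-^p : ∀ {m} (f : Fin m → Carrier) → sum f ^ p ≈ sum (λ i → f i ^ p)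
  sum-^p {zero}  f = 0^ p
  sum-^p {suc m} f = trans (+-^p (f zero) _) (+-congˡ (sum-^p (f ∘ suc)))

  trace-^p : ∀ x → trace p n x ^ p ≈ trace p n x
  trace-^p x = trans (sum-^p {n} (λ i → x ^ (p ℕ.^ toℕ i))) (trans
    (sum-cong-≋ {n} (λ i → trans (^-assocʳ x (p ℕ.^ toℕ i) p)
      (trans (^-congʳ x (ℕ.*-comm (p ℕ.^ toℕ i) p)) (sym (^-assocʳ x p (p ℕ.^ toℕ i))))))
    (trace-frobenius x))

  trace-poly : ∀ m → Poly 1# (p ℕ.^ m) (trace p (suc m))
  trace-poly zero    = Poly-resp (λ x → +-identityʳ _) (Poly-^ 1)
  trace-poly (suc m) = Poly-resp (λ x → trans (trace-suc-last (suc m) x) (+-comm _ _))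
    (Poly-+-< (Poly-^ (p ℕ.^ suc m)) (ℕ.^-monoʳ-< p 1<p (ℕ.n<1+n m)) (trace-poly m))

  -- As a polynomial function the trace is monic of degree p^(n-1), which is less than |K| = p^n, so
  -- it has too few roots to vanish everywhere.
  trace-nonzero : ¬ (∀ x → trace p n x ≈ 0#)
  trace-nonzero zeros = go n order≡pⁿ zeros
    where
    go : ∀ m → order ≡ p ℕ.^ m → ¬ (∀ x → trace p m x ≈ 0#)
    go zero    order≡1 _ = ℕ.<⇒≢ order>1 (≡.sym order≡1)
    go (suc m) order≡ zs = ℕ.<⇒≱ (ℕ.^-monoʳ-< p 1<p (ℕ.n<1+n m))
      (ℕ.≤-trans (ℕ.≤-reflexive (≡.trans (≡.sym order≡) (≡.sym (#.count-true (λ x → trace p (suc m) x ≟ 0#) zs))))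
        (count-roots (trace-poly m)))

  traceᵣ : Carrier → ℕ
  traceᵣ x = residue p (trace p n x)

  traceᵣ-spec : ∀ x → traceᵣ x × 1# ≈ trace p n x
  traceᵣ-spec x = residue-spec (trace-^p x)

-- The canonical additive character

HasCharacteristicZero : HeytingField c ℓ ℓ′ → Set ℓ′
HasCharacteristicZero F = ∀ n → .{{NonZero n}} → (n × 1#) # 0#
  where open Field F

module CharacteristicZero (F : HeytingField c ℓ ℓ′) (char-0 : HasCharacteristicZero F) where
  open Field F hiding (zero)
  open CommutativeRing commutativeRing using (ring; semiring)
  open RingProperties ring
  open HeytingFieldProperties F
  open ≈-Reasoning setoid

  ×1≈0⇒≡0 : ∀ {n} → n × 1# ≈ 0# → n ≡ 0
  ×1≈0⇒≡0 {zero}  _  = ≡.refl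
  ×1≈0⇒≡0 {suc n} eq = contradiction eq (#⇒≉ (char-0 (suc n)))

  ×1-injective : ∀ {m n} → m × 1# ≈ n × 1# → m ≡ n
  ×1-injective {zero}  {n}     eq = ≡.sym (×1≈0⇒≡0 (sym eq))
  ×1-injective {suc m} {zero}  eq = ×1≈0⇒≡0 eq
  ×1-injective {suc m} {suc n} eq = ≡.cong suc (×1-injective (+-cancelˡ 1# _ _ eq))

module Exponential (ℂ : ComplexNumbers c ℓ ℓ′) (p : ℕ) .{{_ : NonZero p}} where
  open ComplexNumbers ℂ hiding (zero)
  open CommutativeRing commutativeRing using (ring; semiring)
  open RingProperties ring
  open HeytingFieldProperties heytingField
  open CharacteristicZero heytingField char-0
  open SRMult semiring using (×-homo-+; ×1-homo-*; ×-assoc-*; ×-congʳ)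
  open ≈-Reasoning setoid

  e : ℕ → Carrier
  e k = exp ((k × 2πi) / p)

  private
    1/p : Carrier
    1/p = proj₁ (#⇒invertible (char-0 p))

    p*1/p : (p × 1#) * 1/p ≈ 1#
    p*1/p = trans (*-congʳ (sym (x-0≈x (p × 1#)))) (proj₂ (proj₂ (#⇒invertible (char-0 p))))

    ×≈×1* : ∀ k z → k × z ≈ (k × 1#) * z
    ×≈×1* k z = sym (trans (×-assoc-* k 1# z) (×-congʳ k (*-identityˡ z)))

    [kp]/p : ∀ k z → ((k ℕ.* p) × z) / p ≈ k × z
    [kp]/p k z = begin
      ((k ℕ.* p) × z) * 1/p                ≈⟨ *-congʳ (×≈×1* (k ℕ.* p) z) ⟩
      ((k ℕ.* p) × 1#) * z * 1/p           ≈⟨ *-congʳ (*-congʳ (×1-homo-* k p)) ⟩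
      (k × 1#) * (p × 1#) * z * 1/p        ≈⟨ *-assoc _ _ _ ⟩
      (k × 1#) * (p × 1#) * (z * 1/p)      ≈⟨ *-assoc _ _ _ ⟩
      (k × 1#) * ((p × 1#) * (z * 1/p))    ≈⟨ *-congˡ (*-congˡ (*-comm z 1/p)) ⟩
      (k × 1#) * ((p × 1#) * (1/p * z))    ≈⟨ *-congˡ (*-assoc _ _ _) ⟨
      (k × 1#) * ((p × 1#) * 1/p * z)      ≈⟨ *-congˡ (trans (*-congʳ p*1/p) (*-identityˡ z)) ⟩
      (k × 1#) * z                         ≈⟨ ×≈×1* k z ⟨
      k × z                                ∎

    /-injective : ∀ {x y} → x / p ≈ y / p → x ≈ y
    /-injective {x} {y} eq = *-cancelˡ (inverse⇒≉0 (trans (*-comm _ _) p*1/p)) (trans (*-comm _ x) (trans eq (*-comm y _)))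

  2πi≉0 : ¬ (2πi ≈ 0#)
  2πi≉0 eq = *-≉0 (#⇒≉ (char-0 2)) (*-≉0 (#⇒≉ π#0) i≉0) (trans (sym (×≈×1* 2 (π * i))) eq)
    where
    i≉0 : ¬ (i ≈ 0#)
    i≉0 i≈0 = 1≉0 (begin
      1#         ≈⟨ -‿involutive 1# ⟨
      - (- 1#)   ≈⟨ -‿cong i²≈-1 ⟨
      - (i * i)  ≈⟨ -‿cong (trans (*-congʳ i≈0) (zeroˡ i)) ⟩
      - 0#       ≈⟨ -0#≈0# ⟩
      0#         ∎)

  e-+ : ∀ k l → e (k ℕ.+ l) ≈ e k * e l
  e-+ k l = trans (exp-cong (trans (*-congʳ (×-homo-+ 2πi k l)) (distribʳ _ _ _))) (exp-+ _ _)

  e-∣ : ∀ {k} → p ℕ.∣ k → e k ≈ 1#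
  e-∣ (ℕ.divides m ≡.refl) = trans (exp-cong ([kp]/p m 2πi)) (Equivalence.from (exp-kernel _) (m , inj₁ refl))

  e≈1⇒∣ : ∀ {k} → e k ≈ 1# → p ℕ.∣ k
  e≈1⇒∣ {k} ek≈1 with Equivalence.to (exp-kernel _) ek≈1
  ... | m , inj₁ eq = ℕ.divides m (×1-injective (cancel {k} {m ℕ.* p} (/-injective (trans eq (sym ([kp]/p m 2πi))))))
    where
    cancel : ∀ {k l} → k × 2πi ≈ l × 2πi → k × 1# ≈ l × 1#
    cancel {k} {l} eq = *-cancelˡ 2πi≉0 (trans (*-comm _ _) (trans (sym (×≈×1* k 2πi))
      (trans eq (trans (×≈×1* l 2πi) (*-comm _ _)))))
  -- Here k 2πi / p = - m 2πi, so the natural number k + m p is 0 in characteristic zero, and k = 0.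
  ... | m , inj₂ eq = ≡.subst (p ℕ.∣_) (≡.sym (ℕ.m+n≡0⇒m≡0 k (×1≈0⇒≡0
      (*-integral (trans (*-comm _ _) (trans (sym (×≈×1* (k ℕ.+ m ℕ.* p) 2πi)) k+mp)) 2πi≉0)))) (p ℕ.∣0)
    where
    k+mp : (k ℕ.+ m ℕ.* p) × 2πi ≈ 0#
    k+mp = /-injective (begin
      (k ℕ.+ m ℕ.* p) × 2πi / p                ≈⟨ *-congʳ (×-homo-+ 2πi k (m ℕ.* p)) ⟩
      (k × 2πi + (m ℕ.* p) × 2πi) / p          ≈⟨ distribʳ _ _ _ ⟩
      k × 2πi / p + (m ℕ.* p) × 2πi / p        ≈⟨ +-cong eq ([kp]/p m 2πi) ⟩
      - (m × 2πi) + m × 2πi                    ≈⟨ -‿inverseˡ _ ⟩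
      0#                                       ≈⟨ zeroˡ _ ⟨
      0# / p                                   ∎)

module CanonicalCharacter {c₁ ℓ₁ m₁ c₂ ℓ₂ m₂} (ℂ : ComplexNumbers c₁ ℓ₁ m₁) (K : FiniteField c₂ ℓ₂ m₂)
  {p : ℕ} .{{_ : NonZero p}} (p-prime : Prime p) (char : FiniteField.HasCharacteristic K p)
  {n : ℕ} (degree : FiniteField.HasPrimeDegree K p n) where
  private
    module ℂ = ComplexNumbers ℂ
    module K = FiniteField K
  open Exponential ℂ p
  open CharacteristicProperties K p-prime char degree
  open SRMult (CommutativeRing.semiring K.commutativeRing) using (×-homo-+)
  open CSExp (CommutativeRing.commutativeSemiring K.commutativeRing) using (^-assocʳ)
  open WeilSum ℂ K p n public using (ψ)

  private
    e-cong-≤ : ∀ {k l} → k ≤ l → k K.× K.1# K.≈ l K.× K.1# → e l ℂ.≈ e k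
    e-cong-≤ {k} {l} k≤l eq = ℂ.trans (ℂ.reflexive (≡.cong e (≡.sym (ℕ.m∸n+n≡m k≤l)))) (ℂ.trans (e-+ (l ℕ.∸ k) k)
      (ℂ.trans (ℂ.*-congʳ (e-∣ (×1-∣∸ k≤l eq))) (ℂ.*-identityˡ _)))

  -- Residues are compared through their images in K, so identities between traces turn into
  -- identities between character values.
  e-cong : ∀ k l → k K.× K.1# K.≈ l K.× K.1# → e k ℂ.≈ e l
  e-cong k l eq with ℕ.≤-total k l
  ... | inj₁ k≤l = ℂ.sym (e-cong-≤ k≤l eq)
  ... | inj₂ l≤k = e-cong-≤ l≤k (K.sym eq)

  ψ-trace : ∀ {x y} → K.trace p n x K.≈ K.trace p n y → ψ x ℂ.≈ ψ y
  ψ-trace {x} {y} eq = e-cong (traceᵣ x) (traceᵣ y) (K.trans (traceᵣ-spec _) (K.trans eq (K.sym (traceᵣ-spec _))))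

  ψ-cong : ∀ {x y} → x K.≈ y → ψ x ℂ.≈ ψ y
  ψ-cong x≈y = ψ-trace (trace-cong n x≈y)

  ψ-^p : ∀ x → ψ (x K.^ p) ℂ.≈ ψ x
  ψ-^p x = ψ-trace (trace-frobenius x)

  ψ-^pⁱ : ∀ i x → ψ (x K.^ (p ℕ.^ i)) ℂ.≈ ψ x
  ψ-^pⁱ zero    x = ψ-cong (K.*-identityʳ x)
  ψ-^pⁱ (suc i) x = ℂ.trans (ψ-cong (K.sym (^-assocʳ x p (p ℕ.^ i)))) (ℂ.trans (ψ-^pⁱ i (x K.^ p)) (ψ-^p x))

  ψ-+ : ∀ x y → ψ (x K.+ y) ℂ.≈ ψ x ℂ.* ψ y
  ψ-+ x y = ℂ.trans (e-cong (traceᵣ (x K.+ y)) (traceᵣ x ℕ.+ traceᵣ y) (K.trans (traceᵣ-spec _) (K.trans (trace-+ n x y)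
    (K.trans (K.+-cong (K.sym (traceᵣ-spec x)) (K.sym (traceᵣ-spec y))) (K.sym (×-homo-+ K.1# (traceᵣ x) (traceᵣ y)))))))
    (e-+ (traceᵣ x) (traceᵣ y))

  ψ-0 : ψ K.0# ℂ.≈ ℂ.1#
  ψ-0 = e-∣ {traceᵣ K.0#} (×1≈0⇒∣ (K.trans (traceᵣ-spec K.0#) (trace-0 n)))

  -- The value is exp(2πi k/p) for the residue k of the trace, so being 1 amounts to p dividing k;
  -- equality in `ℂ` itself is not assumed decidable.
  ψ≈1? : ∀ x → Dec (ψ x ℂ.≈ ℂ.1#)
  ψ≈1? x = map′ e-∣ (e≈1⇒∣ {traceᵣ x}) (p ℕ.∣? traceᵣ x)

  ψ-nontrivial : ¬ (∀ x → ψ x ℂ.≈ ℂ.1#)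
  ψ-nontrivial ψ≈1 = trace-nonzero (λ x → K.trans (K.sym (traceᵣ-spec x)) (×1≈0 (e≈1⇒∣ {traceᵣ x} (ψ≈1 x))))

-- Weil sums of Niho exponents

-- Opaque, so that the decision procedure is not unfolded.
opaque
  third-index : ∀ (i j : Fin 3) → i ≢ j → ∃[ k ] (k ≢ i ∧ k ≢ j ∧ (∀ l → l ≡ i ⊎ l ≡ j ⊎ l ≡ k))
  third-index = toWitness {a? = Fin.all? λ i → Fin.all? λ j → ¬? (i Fin.≟ j) →-dec Fin.any? λ k →
    ¬? (k Fin.≟ i) ×-dec ¬? (k Fin.≟ j) ×-dec Fin.all? λ l → (l Fin.≟ i) ⊎-dec (l Fin.≟ j) ⊎-dec (l Fin.≟ k)} tt

¬two-valued : ∀ (n : Fin 3 → ℕ) → (∀ {i j} → n i ≡ n j → i ≡ j) → ∀ {s t} → ¬ (∀ i → n i ≡ s ⊎ n i ≡ t)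
¬two-valued n n-inj two with two zero | two (suc zero) | two (suc (suc zero))
... | inj₁ p | inj₁ q | _      = Fin.0≢1+n (n-inj (≡.trans p (≡.sym q)))
... | inj₂ p | inj₂ q | _      = Fin.0≢1+n (n-inj (≡.trans p (≡.sym q)))
... | inj₁ p | inj₂ _ | inj₁ q = Fin.0≢1+n (n-inj (≡.trans p (≡.sym q)))
... | inj₂ p | inj₁ _ | inj₂ q = Fin.0≢1+n (n-inj (≡.trans p (≡.sym q)))
... | inj₁ _ | inj₂ p | inj₂ q = Fin.0≢1+n (Fin.suc-injective (n-inj (≡.trans p (≡.sym q))))
... | inj₂ _ | inj₁ p | inj₁ q = Fin.0≢1+n (Fin.suc-injective (n-inj (≡.trans p (≡.sym q))))

-- The case analysis uses no field structure, so it is stated for abstract data: `f` is N, `Z a`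
-- means a = 0, and `x` picks one argument for each of the three values. The hypotheses on `f` are
-- supplied by the moments and by the pencil of forms.
three-values-impossible :
  {A : Set c} {Z : A → Set ℓ} (Z? : ∀ a → Dec (Z a)) (f : A → ℕ) (q : ℕ) →
  (∀ a → f a ≤ 1 ℕ.+ q) → (∀ {a} → Z a → f a ≡ 1) → Dec (∃[ a ] f a ≡ 0) →
  ((∀ a → ¬ (f a ≡ 0)) → ∀ a → f a ≡ 1 ⊎ f a ≡ 1 ℕ.+ q) →
  ((∀ a → f a ≡ 0 ⊎ f a ≡ 1 ⊎ f a ≡ 1 ℕ.+ q) → ∀ a → ¬ (f a ≡ 0)) →
  ((∀ a → ¬ Z a → ¬ (f a ≡ 1)) → ∀ a → ¬ (3 ≤ f a)) →
  (∀ a → f a ≡ 1 ⊎ f a ≡ 1 ℕ.+ q) ⊎ (∀ m → (∀ a → ¬ Z a → 2 ≤ f a → f a ≡ suc m) → q ℕ.∣ m) →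
  (x : Fin 3 → A) → (∀ {i j} → f (x i) ≡ f (x j) → i ≡ j) → (∀ a → ¬ Z a → ∃[ i ] f a ≡ f (x i)) → ⊥
three-values-impossible {A = A} {Z} Z? f q f≤1+q f-Z 0? no-0⇒two-valued 0-not-value 1-is-value unique-value x n-inj value =
  three-values 0? (Fin.any? (λ i → n i ℕ.≟ 1))
  where
  n : Fin 3 → ℕ
  n i = f (x i)

  three-values : Dec (∃[ a ] f a ≡ 0) → Dec (∃[ i ] n i ≡ 1) → ⊥
  three-values (no ¬zero) _ = ¬two-valued n n-inj (λ i → no-0⇒two-valued (λ a f≡0 → ¬zero (a , f≡0)) (x i))
  -- Without the value 1, no value reaches 3, so only 0 and 2 remain for three distinct values.
  three-values (yes _) (no ¬one) with Fin.any? (λ i → 3 ℕ.≤? n i)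
  ... | yes (i , 3≤n) = 1-is-value (λ a ¬Za f≡1 → let i , f≡n = value a ¬Za in ¬one (i , ≡.trans (≡.sym f≡n) f≡1)) _ 3≤n
  ... | no  n<3       = ¬two-valued n n-inj {0} {2} (λ i → small (n i) (λ n≡1 → ¬one (i , n≡1)) (λ 3≤n → n<3 (i , 3≤n)))
    where
    small : ∀ m → ¬ (m ≡ 1) → ¬ (3 ≤ m) → m ≡ 0 ⊎ m ≡ 2
    small 0 _ _ = inj₁ ≡.refl
    small 1 m≢1 _ = contradiction ≡.refl m≢1
    small 2 _ _ = inj₂ ≡.refl
    small (suc (suc (suc m))) _ m≱3 = contradiction (s≤s (s≤s (s≤s z≤n))) m≱3
  three-values (yes (a₀ , fa₀≡0)) (yes (i₁ , n≡1)) = 0-not-value values a₀ fa₀≡0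
    where
    i₀,f≡n : ∃[ i ] f a₀ ≡ n i
    i₀,f≡n = value a₀ (λ Za₀ → ℕ.0≢1+n (≡.trans (≡.sym fa₀≡0) (f-Z Za₀)))
    i₀ : Fin 3
    i₀ = proj₁ i₀,f≡n
    n≡0 : n i₀ ≡ 0
    n≡0 = ≡.trans (≡.sym (proj₂ i₀,f≡n)) fa₀≡0
    other : ∃[ k ] (k ≢ i₀ ∧ k ≢ i₁ ∧ (∀ l → l ≡ i₀ ⊎ l ≡ i₁ ⊎ l ≡ k))
    other = third-index i₀ i₁ (λ eq → ℕ.0≢1+n (≡.trans (≡.sym n≡0) (≡.trans (≡.cong n eq) n≡1)))
    k₂ : Fin 3
    k₂ = proj₁ other
    n≢0 : ¬ (n k₂ ≡ 0)
    n≢0 eq = proj₁ (proj₂ other) (n-inj (≡.trans eq (≡.sym n≡0)))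
    n≢1 : ¬ (n k₂ ≡ 1)
    n≢1 eq = proj₁ (proj₂ (proj₂ other)) (n-inj (≡.trans eq (≡.sym n≡1)))
    nonzero-values : ∀ a → ¬ Z a → f a ≡ 0 ⊎ f a ≡ 1 ⊎ f a ≡ n k₂
    nonzero-values a ¬Za with value a ¬Za
    ... | l , f≡n with proj₂ (proj₂ (proj₂ other)) l
    ... | inj₁ eq        = inj₁ (≡.trans f≡n (≡.trans (≡.cong n eq) n≡0))
    ... | inj₂ (inj₁ eq) = inj₂ (inj₁ (≡.trans f≡n (≡.trans (≡.cong n eq) n≡1)))
    ... | inj₂ (inj₂ eq) = inj₂ (inj₂ (≡.trans f≡n (≡.cong n eq)))
    unique : ∀ a → ¬ Z a → 2 ≤ f a → f a ≡ n k₂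
    unique a ¬Za = from (nonzero-values a ¬Za)
      where
      from : ∀ {m} → m ≡ 0 ⊎ m ≡ 1 ⊎ m ≡ n k₂ → 2 ≤ m → m ≡ n k₂
      from (inj₁ ≡.refl)        ()
      from (inj₂ (inj₁ ≡.refl)) (s≤s ())
      from (inj₂ (inj₂ eq))     _ = eq
    -- Write m + 1 for the third value. Then m is positive, at most q and divisible by q, so m = q.
    top : n k₂ ≡ 1 ℕ.+ q
    top = [ (λ two → ⊥-elim (¬two-valued n n-inj (λ i → two (x i))))
          , (λ q∣ → go (n k₂) n≢0 n≢1 (f≤1+q _) (λ m eq → q∣ m (λ a ¬Za 2≤f → ≡.trans (unique a ¬Za 2≤f) eq)))
          ]′ unique-value
      where
      go : ∀ m → ¬ (m ≡ 0) → ¬ (m ≡ 1) → m ≤ 1 ℕ.+ q → (∀ m′ → m ≡ suc m′ → q ℕ.∣ m′) → m ≡ 1 ℕ.+ q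
      go zero          m≢0 _   _  _  = contradiction ≡.refl m≢0
      go (suc zero)    _   m≢1 _  _  = contradiction ≡.refl m≢1
      go (suc (suc m)) _   _   m≤ q∣ = ℕ.≤-antisym m≤ (s≤s (ℕ.∣⇒≤ (q∣ (suc m) ≡.refl)))
    values : ∀ a → f a ≡ 0 ⊎ f a ≡ 1 ⊎ f a ≡ 1 ℕ.+ q
    values a with Z? a
    ... | yes Za = inj₂ (inj₁ (f-Z Za))
    ... | no ¬Za = ≡.subst (λ m → f a ≡ 0 ⊎ f a ≡ 1 ⊎ f a ≡ m) top (nonzero-values a ¬Za)

-- What the Niho sums use of the canonical character. `ψ≈1?` is a field because equality in `F` is
-- not assumed decidable.
record AdditiveCharacter {c₁ ℓ₁ m₁ c₂ ℓ₂ m₂} (F : HeytingField c₁ ℓ₁ m₁) (K : FiniteField c₂ ℓ₂ m₂) :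
                         Set (c₁ ⊔ ℓ₁ ⊔ c₂ ⊔ ℓ₂) where
  private
    module F = Field F
    module K = FiniteField K
  field
    ψ            : K.Carrier → F.Carrier
    ψ-cong       : ∀ {x y} → x K.≈ y → ψ x F.≈ ψ y
    ψ-0          : ψ K.0# F.≈ F.1#
    ψ-+          : ∀ x y → ψ (x K.+ y) F.≈ ψ x F.* ψ y
    ψ≈1?         : ∀ x → Dec (ψ x F.≈ F.1#)
    ψ-nontrivial : ¬ (∀ x → ψ x F.≈ F.1#)

^-Additive : FiniteField c ℓ ℓ′ → ℕ → Set (c ⊔ ℓ)
^-Additive K q = ∀ x y → (x + y) ^ q ≈ x ^ q + y ^ q
  where open FiniteField K

module NihoSums {c₁ ℓ₁ m₁ c₂ ℓ₂ m₂} {F : HeytingField c₁ ℓ₁ m₁} {K : FiniteField c₂ ℓ₂ m₂}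
  (char-0 : HasCharacteristicZero F) (character : AdditiveCharacter F K)
  (q : ℕ) (q*q≡order : q ℕ.* q ≡ FiniteField.order K) (+-^q : ^-Additive K q) where

  private
    module F = Field F
    module K = FiniteField K
  open AdditiveCharacter character
  open K using (_≈_; _+_; _*_; _-_; -_; _^_; _⁻¹; 0#; 1#; _≟_; order; enumeration; refl; sym; trans; setoid;
    +-cong; +-congˡ; +-congʳ; *-cong; *-congˡ; *-congʳ; +-assoc; +-comm; *-assoc; *-comm;
    +-identityˡ; +-identityʳ; *-identityˡ; *-identityʳ; zeroˡ; zeroʳ; distribˡ; distribʳ;
    -‿inverseˡ; -‿inverseʳ; -‿cong; reflexive)
  open RingProperties (CommutativeRing.ring K.commutativeRing)
  open HeytingFieldProperties K.heytingField
  open FiniteFieldProperties K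
  open CSExp (CommutativeRing.commutativeSemiring K.commutativeRing) using (^-congˡ; ^-congʳ; ^-assocʳ; ^-distrib-*)
  private
    module FP = HeytingFieldProperties F
    module FR = RingProperties (CommutativeRing.ring F.commutativeRing)
    module # = Counting enumeration
    module Cast = FiniteSumCast enumeration (CommutativeRing.commutativeSemiring F.commutativeRing)
  open CharacteristicZero F char-0
  open FiniteSemiringSum enumeration (CommutativeRing.commutativeSemiring F.commutativeRing)
  open SRMult (CommutativeRing.semiring F.commutativeRing) using (×-homo-+; ×1-homo-*)

  ι : ℕ → F.Carrier
  ι m = m F.× F.1#

  1<q : 1 < q
  1<q = go q q*q≡order
    where
    go : ∀ q → q ℕ.* q ≡ order → 1 < q
    go zero          eq = contradiction (≡.subst (1 <_) (≡.sym eq) order>1) λ ()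
    go (suc zero)    eq = contradiction (≡.subst (1 <_) (≡.sym eq) order>1) λ { (s≤s ()) }
    go (suc (suc q)) _  = s≤s (s≤s z≤n)

  private
    instance
      q-nonZero : NonZero q
      q-nonZero = ℕ.>-nonZero (ℕ.<-trans ℕ.z<s 1<q)

      q-1-nonZero : NonZero (q ℕ.∸ 1)
      q-1-nonZero = ℕ.>-nonZero (ℕ.m<n⇒0<n∸m 1<q)

  1+[q-1]≡q : 1 ℕ.+ (q ℕ.∸ 1) ≡ q
  1+[q-1]≡q = ℕ.m+[n∸m]≡n (ℕ.<⇒≤ 1<q)

  q*q≡1+[1+q][q-1] : q ℕ.* q ≡ 1 ℕ.+ (1 ℕ.+ q) ℕ.* (q ℕ.∸ 1)
  q*q≡1+[1+q][q-1] = ≡.subst (λ m → m ℕ.* m ≡ 1 ℕ.+ (1 ℕ.+ m) ℕ.* (q ℕ.∸ 1)) 1+[q-1]≡q (arithmetic (q ℕ.∸ 1))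
    where
    arithmetic : ∀ m → (1 ℕ.+ m) ℕ.* (1 ℕ.+ m) ≡ 1 ℕ.+ (2 ℕ.+ m) ℕ.* m
    arithmetic = ℕ-solve-∀

  -- The subfield L of order q

  ^qq : ∀ x → (x ^ q) ^ q ≈ x
  ^qq x = trans (^-assocʳ x q q) (trans (^-congʳ x q*q≡order) (fermat x))

  -- The field of order q is encoded as the fixed points of x ↦ x^q. Closure under addition comes
  -- from `+-^q`; that there are q fixed points is `|L|≡q`.
  L : K.Carrier → Set ℓ₂
  L x = x ^ q ≈ x

  opaque
    L? : ∀ x → Dec (L x)
    L? x = (x ^ q) ≟ x

  L-resp : ∀ {x y} → x ≈ y → L x → L y
  L-resp x≈y Lx = trans (^-congˡ q (sym x≈y)) (trans Lx x≈y)

  L-0 : L 0#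
  L-0 = 0^ q

  L-1 : L 1#
  L-1 = 1^ q

  L-+ : ∀ {x y} → L x → L y → L (x + y)
  L-+ Lx Ly = trans (+-^q _ _) (+-cong Lx Ly)

  L-* : ∀ {x y} → L x → L y → L (x * y)
  L-* Lx Ly = trans (^-distrib-* _ _ q) (*-cong Lx Ly)

  L-neg : ∀ {x} → L x → L (- x)
  L-neg {x} Lx = +-cancelˡ x _ _ (begin
    x + (- x) ^ q        ≈⟨ +-congʳ Lx ⟨
    x ^ q + (- x) ^ q    ≈⟨ +-^q x (- x) ⟨
    (x - x) ^ q          ≈⟨ ^-congˡ q (-‿inverseʳ x) ⟩
    0# ^ q               ≈⟨ 0^ q ⟩
    0#                   ≈⟨ -‿inverseʳ x ⟨
    x - x                ∎)
    where open ≈-Reasoning setoid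

  L*⇒^≈1 : ∀ {x} → L x → ¬ (x ≈ 0#) → x ^ (q ℕ.∸ 1) ≈ 1#
  L*⇒^≈1 {x} Lx x≉0 = ^-pred (q ℕ.∸ 1) x≉0 (trans (^-congʳ x 1+[q-1]≡q) Lx)

  ^≈1⇒L : ∀ {x} → x ^ (q ℕ.∸ 1) ≈ 1# → L x
  ^≈1⇒L {x} eq = trans (^-congʳ x (≡.sym 1+[q-1]≡q)) (trans (*-congˡ eq) (*-identityʳ x))

  private
    Poly-linear : ∀ k l → Poly k 1 (λ x → x * k + l)
    Poly-linear k l = horner l (leading {f = λ _ → k} (λ _ → refl)) (λ _ → refl)

  -- L is the set of roots of x^q - x, which is monic of degree q.
  |L|≤q : #.count L? ≤ q
  |L|≤q = ℕ.≤-trans (ℕ.≤-reflexive (#.count-cong L? (λ x → (x ^ q + (x * - 1# + 0#)) ≟ 0#)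
      (λ x Lx → trans (+-cong Lx (≈-x x)) (-‿inverseʳ x))
      (λ x eq → -≈0⇒≈ (trans (+-congˡ (sym (≈-x x))) eq))))
    (count-roots (Poly-+-< (Poly-^ q) 1<q (Poly-linear (- 1#) 0#)))
    where
    ≈-x : ∀ x → x * - 1# + 0# ≈ - x
    ≈-x x = trans (+-identityʳ _) (trans (*-comm _ _) (-1*x≈-x x))

  -- Over each value in L, the map x ↦ x^q + x takes K to L with at most q preimages.
  q≤|L| : q ≤ #.count L?
  q≤|L| = ℕ.*-cancelʳ-≤ q (#.count L?) q (begin
    q ℕ.* q                                               ≡⟨ q*q≡order ⟩
    order                                                 ≡⟨ #.count-true (λ _ → yes tt) (λ _ → tt) ⟨
    #.∑ (λ x → 1)                                         ≡⟨ #.∑-cong (λ x → ≡.trans (#.count-cong (T x ≟_) (_≟ T x) (λ _ → sym) (λ _ → sym)) (count-≈ (T x))) ⟨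
    #.∑ (λ x → #.∑ (λ y → 1 #.when (T x ≟ y)))            ≡⟨ #.∑-swap _ ⟩
    #.∑ (λ y → #.∑ (λ x → 1 #.when (T x ≟ y)))            ≤⟨ #.∑-mono-≤ fibre ⟩
    #.∑ (λ y → 1 #.when L? y ℕ.* q)                       ≡⟨ #.*-distribʳ-∑ q _ ⟨
    #.count L? ℕ.* q                                      ∎)
    where
    open ℕ.≤-Reasoning
    T : K.Carrier → K.Carrier
    T x = x ^ q + x
    L-T : ∀ x → L (T x)
    L-T x = trans (+-^q _ _) (trans (+-congʳ (^qq x)) (+-comm _ _))
    fibre : ∀ y → #.count (λ x → T x ≟ y) ≤ 1 #.when L? y ℕ.* q
    fibre y with L? y
    ... | no  ¬Ly = ℕ.≤-reflexive (#.∑-ε (λ x → #.when-no (T x ≟ y) (λ eq → ¬Ly (L-resp eq (L-T x)))))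
    ... | yes _   = ℕ.≤-trans (ℕ.≤-reflexive (#.count-cong (λ x → T x ≟ y) (λ x → (x ^ q + (x * 1# + - y)) ≟ 0#)
        (λ x eq → trans (expand x) (≈⇒-≈0 eq))
        (λ x eq → -≈0⇒≈ (trans (sym (expand x)) eq))))
      (ℕ.≤-trans (count-roots (Poly-+-< (Poly-^ q) 1<q (Poly-linear 1# (- y)))) (ℕ.≤-reflexive (≡.sym (ℕ.*-identityˡ q))))
      where
      expand : ∀ x → x ^ q + (x * 1# + - y) ≈ T x - y
      expand x = trans (sym (+-assoc _ _ _)) (+-congʳ (+-congˡ (*-identityʳ x)))

  |L|≡q : #.count L? ≡ q
  |L|≡q = ℕ.≤-antisym |L|≤q q≤|L|

  L*? : ∀ x → Dec (L x ∧ ¬ (x ≈ 0#))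
  L*? x = L? x ×-dec ¬? (x ≟ 0#)

  |L*|≡q-1 : #.count L*? ≡ q ℕ.∸ 1
  |L*|≡q-1 = ℕ.suc-injective (begin
    1 ℕ.+ #.count L*?                                        ≡⟨ ≡.cong (ℕ._+ #.count L*?) (count-≈ 0#) ⟨
    #.count (_≟ 0#) ℕ.+ #.count L*?                          ≡⟨ #.∑-distrib _ _ ⟨
    #.∑ (λ x → 1 #.when (x ≟ 0#) ℕ.+ 1 #.when L*? x)         ≡⟨ #.∑-cong term ⟩
    #.count L?                                               ≡⟨ |L|≡q ⟩
    q                                                        ≡⟨ 1+[q-1]≡q ⟨
    1 ℕ.+ (q ℕ.∸ 1)                                          ∎)
    where
    open ≡.≡-Reasoning
    term : ∀ x → 1 #.when (x ≟ 0#) ℕ.+ 1 #.when L*? x ≡ 1 #.when L? x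
    term x with x ≟ 0# | L? x
    ... | yes x≈0 | yes _  = ≡.refl
    ... | yes x≈0 | no ¬Lx = contradiction (L-resp (sym x≈0) L-0) ¬Lx
    ... | no  _   | yes _  = ≡.refl
    ... | no  _   | no _   = ≡.refl

  -- Orthogonality relations and the complement H

  private
    ∑-translate : ∀ f g → (∀ {x y} → x ≈ y → f x F.≈ f y) → ∑ (λ x → f (g + x)) F.≈ ∑ f
    ∑-translate f g f-cong = ∑-permute f (λ x → g + x) (λ x → - g + x) f-cong +-congˡ +-congˡ
      (λ x → trans (sym (+-assoc g _ x)) (trans (+-congʳ (-‿inverseʳ g)) (+-identityˡ x)))
      (λ x → trans (sym (+-assoc _ g x)) (trans (+-congʳ (-‿inverseˡ g)) (+-identityˡ x)))

  module Orthogonality {G : K.Carrier → Set p} (G? : ∀ x → Dec (G x)) (G-resp : ∀ {x y} → x ≈ y → G x → G y)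
    (G-+ : ∀ {x y} → G x → G y → G (x + y)) (G-neg : ∀ {x} → G x → G (- x)) where

    -- Translation by g multiplies the sum S by ψ(g z), so S ≉ 0 would force ψ(g z) = 1 for every g
    -- in G. As equality is stable, no g with ψ(g z) ≠ 1 has to be exhibited.
    ψ-sum : ∀ z → (t? : Dec (∀ g → G g → ψ (g * z) F.≈ F.1#)) →
            ∑ (λ x → ψ (x * z) when G? x) F.≈ ι (#.count G?) when t?
    ψ-sum z (yes trivial) = F.trans (∑-cong (λ x → when-cong (G? x) (G? x) (λ g → g) (λ g → g) (trivial x)))
      (F.trans (Cast.∑-when G? F.1#) (F.*-identityʳ _))
    ψ-sum z (no nontrivial) = FP.≈-stable λ S≉0 → nontrivial λ g Gg → FP.-≈0⇒≈ (FP.*-integral (begin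
        S F.* (ψ (g * z) F.- F.1#)              ≈⟨ F.*-comm _ _ ⟩
        (ψ (g * z) F.- F.1#) F.* S              ≈⟨ FP.*-distribʳ-- _ _ _ ⟩
        ψ (g * z) F.* S F.- F.1# F.* S          ≈⟨ FP.≈⇒-≈0 (F.trans (shift g Gg) (F.sym (F.*-identityˡ S))) ⟩
        F.0#                                    ∎) S≉0)
      where
      open ≈-Reasoning F.setoid
      f : K.Carrier → F.Carrier
      f x = ψ (x * z) when G? x
      S = ∑ f
      shift : ∀ g → G g → ψ (g * z) F.* S F.≈ S
      shift g Gg = begin
        ψ (g * z) F.* S                   ≈⟨ *-distribˡ-∑ _ f ⟩
        ∑ (λ x → ψ (g * z) F.* f x)       ≈⟨ ∑-cong term ⟩
        ∑ (λ x → f (g + x))               ≈⟨ ∑-translate f g (λ x≈y → when-cong (G? _) (G? _) (G-resp x≈y) (G-resp (sym x≈y)) (λ _ → ψ-cong (*-congʳ x≈y))) ⟩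
        S                                 ∎
        where
        term : ∀ x → ψ (g * z) F.* f x F.≈ f (g + x)
        term x = F.trans (*-when _ (G? x)) (when-cong (G? x) (G? (g + x)) (G-+ Gg)
          (λ Ggx → G-resp (trans (sym (+-assoc _ g x)) (trans (+-congʳ (-‿inverseˡ g)) (+-identityˡ x))) (G-+ (G-neg Gg) Ggx))
          (λ _ → F.trans (F.sym (ψ-+ _ _)) (ψ-cong (sym (distribʳ z g x)))))

  ∑ψ : ∀ z → ∑ (λ x → ψ (x * z)) F.≈ ι order when (z ≟ 0#)
  ∑ψ z = F.trans (ψ-sum z (map′ 0⇒trivial trivial⇒0 (z ≟ 0#)))
    (when-cong (map′ 0⇒trivial trivial⇒0 (z ≟ 0#)) (z ≟ 0#) trivial⇒0 0⇒trivial
      (λ _ → F.reflexive (≡.cong ι (#.count-true (λ _ → yes tt) (λ _ → tt)))))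
    where
    open Orthogonality {G = λ _ → ⊤} (λ _ → yes tt) (λ _ _ → tt) (λ _ _ → tt) (λ _ → tt)
    0⇒trivial : z ≈ 0# → ∀ g → ⊤ → ψ (g * z) F.≈ F.1#
    0⇒trivial z≈0 g _ = F.trans (ψ-cong (trans (*-congˡ z≈0) (zeroʳ g))) ψ-0
    trivial⇒0 : (∀ g → ⊤ → ψ (g * z) F.≈ F.1#) → z ≈ 0#
    trivial⇒0 trivial with z ≟ 0#
    ... | yes z≈0 = z≈0
    -- The multiples of a nonzero z exhaust K, so ψ would be trivial on K.
    ... | no  z≉0 = ⊥-elim (ψ-nontrivial (λ x → F.trans (ψ-cong (begin
      x                  ≈⟨ *-identityʳ x ⟨
      x * 1#             ≈⟨ *-congˡ (trans (*-comm _ _) (⁻¹-inverseʳ z≉0)) ⟨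
      x * (z ⁻¹ * z)     ≈⟨ *-assoc _ _ _ ⟨
      x * z ⁻¹ * z       ∎)) (trivial (x * z ⁻¹) tt)))
      where open ≈-Reasoning setoid

  -- The orthogonal complement of L: the z with Tr(z) = 0 for the trace of K over L.
  H : K.Carrier → Set _
  H z = ∀ r → L r → ψ (r * z) F.≈ F.1#

  opaque
    H? : ∀ z → Dec (H z)
    H? z = all? (λ r≈s ψr Ls → F.trans (ψ-cong (*-congʳ (sym r≈s))) (ψr (L-resp (sym r≈s) Ls)))
                (λ r → L? r →-dec ψ≈1? (r * z))

  H-resp : ∀ {y z} → y ≈ z → H y → H z
  H-resp y≈z Hy r Lr = F.trans (ψ-cong (*-congˡ (sym y≈z))) (Hy r Lr)

  H-0 : H 0#
  H-0 r _ = F.trans (ψ-cong (zeroʳ r)) ψ-0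

  H-+ : ∀ {y z} → H y → H z → H (y + z)
  H-+ Hy Hz r Lr = F.trans (ψ-cong (distribˡ r _ _)) (F.trans (ψ-+ _ _)
    (F.trans (F.*-cong (Hy r Lr) (Hz r Lr)) (F.*-identityˡ F.1#)))

  H-*L : ∀ {r z} → L r → H z → H (r * z)
  H-*L Lr Hz s Ls = F.trans (ψ-cong (sym (*-assoc s _ _))) (Hz _ (L-* Ls Lr))

  H-neg : ∀ {z} → H z → H (- z)
  H-neg Hz = H-resp (-1*x≈-x _) (H-*L (L-neg L-1) Hz)

  ∑ψL : ∀ z → ∑ (λ r → ψ (r * z) when L? r) F.≈ ι q when H? z
  ∑ψL z = F.trans (Orthogonality.ψ-sum L? L-resp L-+ L-neg z (H? z))
    (when-cong (H? z) (H? z) (λ h → h) (λ h → h) (λ _ → F.reflexive (≡.cong ι |L|≡q)))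

  -- Double count of ψ(r z) over r in L and z in K: summing over r first gives q for each z in H,
  -- summing over z first leaves only r = 0, with total q².
  |H|≡q : #.count H? ≡ q
  |H|≡q = ℕ.*-cancelʳ-≡ _ q q (×1-injective (begin
    ι (#.count H? ℕ.* q)                                ≈⟨ ×1-homo-* (#.count H?) q ⟩
    ι (#.count H?) F.* ι q                              ≈⟨ Cast.∑-when H? (ι q) ⟨
    ∑ (λ z → ι q when H? z)                             ≈⟨ ∑-cong ∑ψL ⟨
    ∑ (λ z → ∑ (λ r → ψ (r * z) when L? r))             ≈⟨ ∑-swap _ ⟩
    ∑ (λ r → ∑ (λ z → ψ (r * z) when L? r))             ≈⟨ ∑-single _ 0# inner-cong inner-off ⟩
    ∑ (λ z → ψ (0# * z) when L? 0#)                     ≈⟨ inner-on ⟩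
    ι order                                             ≡⟨ ≡.cong ι q*q≡order ⟨
    ι (q ℕ.* q)                                         ∎))
    where
    open ≈-Reasoning F.setoid
    inner-cong : ∀ {r s} → r ≈ s → ∑ (λ z → ψ (r * z) when L? r) F.≈ ∑ (λ z → ψ (s * z) when L? s)
    inner-cong r≈s = ∑-cong (λ z → when-cong (L? _) (L? _) (L-resp r≈s) (L-resp (sym r≈s)) (λ _ → ψ-cong (*-congʳ r≈s)))
    inner-off : ∀ r → ¬ (r ≈ 0#) → ∑ (λ z → ψ (r * z) when L? r) F.≈ F.0#
    inner-off r r≉0 with L? r
    ... | no  _ = ∑-ε (λ _ → F.refl)
    ... | yes _ = F.trans (∑-cong (λ z → ψ-cong (*-comm r z))) (F.trans (∑ψ r) (when-no (r ≟ 0#) r≉0))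
    inner-on : ∑ (λ z → ψ (0# * z) when L? 0#) F.≈ ι order
    inner-on = F.trans (∑-cong (λ z → when-yes (L? 0#) L-0)) (F.trans (∑-cong (λ z → ψ-cong (*-comm 0# z)))
      (F.trans (∑ψ 0#) (when-yes (0# ≟ 0#) refl)))

  ∑-ι : ∀ m → ∑ (λ _ → ι m) F.≈ ι (order ℕ.* m)
  ∑-ι m = F.trans (F.sym (Cast.∑-×1 (λ _ → m))) (F.reflexive (≡.cong ι (#.∑-constant m)))

  -- The forms b φ(x) + a x, their sums W and their line counts N

  module NihoExponent (E k : ℕ) (E≡ : E ≡ 1 ℕ.+ k ℕ.* (q ℕ.∸ 1))
                      (u v : ℕ) (E*u≡ : E ℕ.* u ≡ 1 ℕ.+ v ℕ.* (order ℕ.∸ 1)) where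

    -- Reduces exponents modulo q - 1 on L and modulo |K| - 1 on K. The summand 1 in the exponent
    -- covers x = 0.
    ^-≡1 : ∀ {x m} j → (¬ (x ≈ 0#) → x ^ m ≈ 1#) → x ^ (1 ℕ.+ j ℕ.* m) ≈ x
    ^-≡1 {x} {m} j eq with x ≟ 0#
    ... | yes x≈0 = trans (*-congʳ x≈0) (trans (zeroˡ _) (sym x≈0))
    ... | no  x≉0 = trans (*-congˡ (begin
      x ^ (j ℕ.* m)   ≈⟨ ^-congʳ x (ℕ.*-comm j m) ⟩
      x ^ (m ℕ.* j)   ≈⟨ ^-assocʳ x m j ⟨
      (x ^ m) ^ j     ≈⟨ ^-congˡ j (eq x≉0) ⟩
      1# ^ j          ≈⟨ 1^ j ⟩
      1#              ∎)) (*-identityʳ x)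
      where open ≈-Reasoning setoid

    φ φ⁻¹ : K.Carrier → K.Carrier
    φ x   = x ^ E
    φ⁻¹ x = x ^ u

    φ-cong : ∀ {x y} → x ≈ y → φ x ≈ φ y
    φ-cong = ^-congˡ E

    φ-* : ∀ x y → φ (x * y) ≈ φ x * φ y
    φ-* x y = ^-distrib-* x y E

    φ-L : ∀ {r} → L r → φ r ≈ r
    φ-L {r} Lr = trans (^-congʳ r E≡) (^-≡1 k (L*⇒^≈1 Lr))

    φ-0 : φ 0# ≈ 0#
    φ-0 = φ-L L-0

    φ-neg : ∀ x → φ (- x) ≈ - φ x
    φ-neg x = begin
      φ (- x)            ≈⟨ φ-cong (-1*x≈-x x) ⟨
      φ (- 1# * x)       ≈⟨ φ-* _ x ⟩
      φ (- 1#) * φ x     ≈⟨ *-congʳ (φ-L (L-neg L-1)) ⟩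
      - 1# * φ x         ≈⟨ -1*x≈-x _ ⟩
      - φ x              ∎
      where open ≈-Reasoning setoid

    φ⁻¹φ : ∀ x → φ⁻¹ (φ x) ≈ x
    φ⁻¹φ x = trans (^-assocʳ x E u) (trans (^-congʳ x E*u≡) (^-≡1 v (λ x≉0 →
      ^-pred (order ℕ.∸ 1) x≉0 (trans (^-congʳ x (ℕ.m+[n∸m]≡n (ℕ.<⇒≤ order>1))) (fermat x)))))

    φφ⁻¹ : ∀ x → φ (φ⁻¹ x) ≈ x
    φφ⁻¹ x = trans (^-assocʳ x u E) (trans (^-congʳ x (ℕ.*-comm u E)) (trans (sym (^-assocʳ x E u)) (φ⁻¹φ x)))

    -- The coefficient b is carried along because the pencil through 1 and t contains forms with b
    -- other than 1; `N-normalise` returns to b = 1.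
    form : K.Carrier → K.Carrier → K.Carrier → K.Carrier
    form b a x = b * φ x + a * x

    form-cong : ∀ {b b′ a a′ x x′} → b ≈ b′ → a ≈ a′ → x ≈ x′ → form b a x ≈ form b′ a′ x′
    form-cong b≈ a≈ x≈ = +-cong (*-cong b≈ (φ-cong x≈)) (*-cong a≈ x≈)

    form-scale : ∀ b a c x → form b a (c * x) ≈ form (b * φ c) (a * c) x
    form-scale b a c x = +-cong (trans (*-congˡ (φ-* c x)) (sym (*-assoc b _ _))) (sym (*-assoc a c x))

    form-L : ∀ b a {r} x → L r → form b a (r * x) ≈ r * form b a x
    form-L b a {r} x Lr = trans (+-cong (trans (*-congˡ (trans (φ-* r x) (*-congʳ (φ-L Lr)))) (x∙yz≈y∙xz b r (φ x)))
                                        (x∙yz≈y∙xz a r x))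
                                (sym (distribˡ r _ _))
      where open import Algebra.Properties.CommutativeSemigroup
                   (CommutativeMonoid.commutativeSemigroup (CommutativeRing.*-commutativeMonoid K.commutativeRing)) using (x∙yz≈y∙xz)

    form-+ˡ : ∀ b b′ a a′ x → form (b + b′) (a + a′) x ≈ form b a x + form b′ a′ x
    form-+ˡ b b′ a a′ x = trans (+-cong (distribʳ (φ x) b b′) (distribʳ x a a′)) (interchange _ _ _ _)
      where open import Algebra.Properties.CommutativeSemigroup
                   (CommutativeMonoid.commutativeSemigroup (CommutativeRing.+-commutativeMonoid K.commutativeRing)) using (interchange)

    form-0 : ∀ b a → form b a 0# ≈ 0#
    form-0 b a = trans (+-cong (trans (*-congˡ φ-0) (zeroʳ b)) (zeroʳ a)) (+-identityʳ 0#)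

    W : K.Carrier → K.Carrier → F.Carrier
    W b a = ∑ (λ x → ψ (form b a x))

    H-form? : ∀ b a x → Dec (H (form b a x))
    H-form? b a x = H? (form b a x)

    M : K.Carrier → K.Carrier → ℕ
    M b a = #.count (H-form? b a)

    M-cong : ∀ {b b′ a a′} → b ≈ b′ → a ≈ a′ → M b a ≡ M b′ a′
    M-cong {b} {b′} {a} {a′} b≈ a≈ = #.count-cong (H-form? b a) (H-form? b′ a′) (λ x → H-resp (form-cong b≈ a≈ refl)) (λ x → H-resp (sym (form-cong b≈ a≈ refl)))

    ∑-dilate : ∀ f c → ¬ (c ≈ 0#) → (∀ {x y} → x ≈ y → f x F.≈ f y) → ∑ (λ x → f (c * x)) F.≈ ∑ f
    ∑-dilate f c c≉0 f-cong = ∑-permute f (c *_) (c ⁻¹ *_) f-cong *-congˡ *-congˡ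
      (λ x → trans (sym (*-assoc c _ x)) (trans (*-congʳ (⁻¹-inverseʳ c≉0)) (*-identityˡ x)))
      (λ x → trans (sym (*-assoc _ c x)) (trans (*-congʳ (trans (*-comm _ _) (⁻¹-inverseʳ c≉0))) (*-identityˡ x)))

    count-dilate : ∀ {Q : K.Carrier → Set p} (Q? : ∀ x → Dec (Q x)) → (∀ {x y} → x ≈ y → Q x → Q y) →
                   ∀ c → ¬ (c ≈ 0#) → #.count (λ x → Q? (c * x)) ≡ #.count Q?
    count-dilate Q? Q-resp c c≉0 = #.∑-permute (λ x → 1 #.when Q? x) (c *_) (c ⁻¹ *_)
      (λ x≈y → #.when-cong (Q? _) (Q? _) (Q-resp x≈y) (Q-resp (sym x≈y)) (λ _ → ≡.refl)) *-congˡ *-congˡ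
      (λ x → trans (sym (*-assoc c _ x)) (trans (*-congʳ (⁻¹-inverseʳ c≉0)) (*-identityˡ x)))
      (λ x → trans (sym (*-assoc _ c x)) (trans (*-congʳ (trans (*-comm _ _) (⁻¹-inverseʳ c≉0))) (*-identityˡ x)))

    -- Replacing x by r x with r in L* does not change W, so (q - 1) W is a sum over L* × K.
    W-M : ∀ b a → ι (q ℕ.∸ 1) F.* W b a F.+ ι order F.≈ ι (M b a) F.* ι q
    W-M b a = begin
      ι (q ℕ.∸ 1) F.* W b a F.+ ι order              ≈⟨ F.+-comm _ _ ⟩
      ι order F.+ ι (q ℕ.∸ 1) F.* W b a
        ≈⟨ F.+-cong (∑-when-≈ _≟_ (λ _ → ι order) 0# (λ _ → F.refl))
             (F.trans (Cast.∑-when L*? (W b a)) (F.*-congʳ (F.reflexive (≡.cong ι |L*|≡q-1)))) ⟨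
      ∑ (λ r → ι order when (r ≟ 0#)) F.+ ∑ (λ r → W b a when L*? r)  ≈⟨ ∑-distrib _ _ ⟨
      ∑ (λ r → ι order when (r ≟ 0#) F.+ W b a when L*? r)            ≈⟨ ∑-cong term ⟨
      ∑ (λ r → ∑ (λ x → ψ (r * form b a x) when L? r)) ≈⟨ ∑-swap _ ⟩
      ∑ (λ x → ∑ (λ r → ψ (r * form b a x) when L? r)) ≈⟨ ∑-cong (λ x → ∑ψL (form b a x)) ⟩
      ∑ (λ x → ι q when H-form? b a x)                ≈⟨ Cast.∑-when (H-form? b a) (ι q) ⟩
      ι (M b a) F.* ι q                              ∎
      where
      open ≈-Reasoning F.setoid
      term : ∀ r → ∑ (λ x → ψ (r * form b a x) when L? r) F.≈ ι order when (r ≟ 0#) F.+ W b a when L*? r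
      term r with r ≟ 0# | L? r
      ... | yes r≈0 | no ¬Lr = contradiction (L-resp (sym r≈0) L-0) ¬Lr
      ... | yes r≈0 | yes _  = F.trans (∑-cong (λ x → ψ-cong (trans (*-congʳ r≈0) (trans (zeroˡ _) (sym (zeroʳ x))))))
        (F.trans (∑ψ 0#) (F.trans (when-yes (0# ≟ 0#) refl) (F.sym (F.+-identityʳ _))))
      ... | no  _   | no _   = F.trans (∑-ε (λ _ → F.refl)) (F.sym (F.+-identityʳ _))
      ... | no  r≉0 | yes Lr = F.trans (∑-cong (λ x → ψ-cong (sym (form-L b a x Lr))))
        (F.trans (∑-dilate (λ x → ψ (form b a x)) r r≉0 (λ x≈y → ψ-cong (form-cong refl refl x≈y))) (F.sym (F.+-identityˡ _)))

    private
      H*? : ∀ b a x → Dec (H (form b a x) ∧ ¬ (x ≈ 0#))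
      H*? b a x = H-form? b a x ×-dec ¬? (x ≟ 0#)

      M≡1+M* : ∀ b a → M b a ≡ 1 ℕ.+ #.count (H*? b a)
      M≡1+M* b a = ≡.sym (begin
        1 ℕ.+ #.count (H*? b a)                               ≡⟨ ≡.cong (ℕ._+ #.count (H*? b a)) (count-≈ 0#) ⟨
        #.count (_≟ 0#) ℕ.+ #.count (H*? b a)                 ≡⟨ #.∑-distrib _ _ ⟨
        #.∑ (λ x → 1 #.when (x ≟ 0#) ℕ.+ 1 #.when H*? b a x)  ≡⟨ #.∑-cong term ⟩
        M b a                                                 ∎)
        where
        open ≡.≡-Reasoning
        term : ∀ x → 1 #.when (x ≟ 0#) ℕ.+ 1 #.when H*? b a x ≡ 1 #.when H-form? b a x
        term x with x ≟ 0# | H-form? b a x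
        ... | yes x≈0 | yes _  = ≡.refl
        ... | yes x≈0 | no ¬Hx = contradiction (H-resp (sym (trans (form-cong refl refl x≈0) (form-0 b a))) H-0) ¬Hx
        ... | no  _   | yes _  = ≡.refl
        ... | no  _   | no _   = ≡.refl

      -- The fibres of x ↦ x^(q-1) on K* are the cosets of L*.
      q-1∣M* : ∀ b a → (q ℕ.∸ 1) ℕ.∣ #.count (H*? b a)
      q-1∣M* b a = ≡.subst ((q ℕ.∸ 1) ℕ.∣_) total (#.∣-∑ fibre)
        where
        open ≡.≡-Reasoning
        Fibre : K.Carrier → K.Carrier → Set _
        Fibre w x = (H (form b a x) ∧ ¬ (x ≈ 0#)) ∧ x ^ (q ℕ.∸ 1) ≈ w
        Fibre? : ∀ w x → Dec (Fibre w x)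
        Fibre? w x = H*? b a x ×-dec ((x ^ (q ℕ.∸ 1)) ≟ w)
        Fibre-resp : ∀ {w x y} → x ≈ y → Fibre w x → Fibre w y
        Fibre-resp x≈y ((Hx , x≉0) , xw) = (H-resp (form-cong refl refl x≈y) Hx , λ y≈0 → x≉0 (trans x≈y y≈0)) ,
          trans (^-congˡ (q ℕ.∸ 1) (sym x≈y)) xw
        split : ∀ x → #.∑ (λ w → 1 #.when Fibre? w x) ≡ 1 #.when H*? b a x
        split x with H*? b a x
        ... | no  _ = #.∑-ε (λ _ → ≡.refl)
        ... | yes h = ≡.trans (#.count-cong (λ w → yes h ×-dec ((x ^ (q ℕ.∸ 1)) ≟ w)) (_≟ (x ^ (q ℕ.∸ 1)))
          (λ w h → sym (proj₂ h)) (λ w eq → h , sym eq)) (count-≈ (x ^ (q ℕ.∸ 1)))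
        total : #.∑ (λ w → #.∑ (λ x → 1 #.when Fibre? w x)) ≡ #.count (H*? b a)
        total = ≡.trans (#.∑-swap _) (#.∑-cong split)
        fibre : ∀ w → (q ℕ.∸ 1) ℕ.∣ #.count (Fibre? w)
        fibre w with any? Fibre-resp (Fibre? w)
        ... | no ¬any = ≡.subst ((q ℕ.∸ 1) ℕ.∣_) (≡.sym (#.∑-ε (λ x → #.when-no (Fibre? w x) (λ h → ¬any (x , h))))) ((q ℕ.∸ 1) ℕ.∣0)
        ... | yes (x₀ , (Hx₀ , x₀≉0) , x₀w) = ℕ.∣-reflexive (begin
          q ℕ.∸ 1                                ≡⟨ |L*|≡q-1 ⟨
          #.count L*?                            ≡⟨ #.count-cong L*? (λ r → Fibre? w (x₀ * r)) to from ⟩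
          #.count (λ r → Fibre? w (x₀ * r))      ≡⟨ count-dilate (Fibre? w) Fibre-resp x₀ x₀≉0 ⟩
          #.count (Fibre? w)                     ∎)
          where
          to : ∀ r → L r ∧ ¬ (r ≈ 0#) → Fibre w (x₀ * r)
          to r (Lr , r≉0) = (H-resp (trans (sym (form-L b a x₀ Lr)) (form-cong refl refl (*-comm r x₀))) (H-*L Lr Hx₀) , *-≉0 x₀≉0 r≉0) ,
            trans (^-distrib-* x₀ r (q ℕ.∸ 1)) (trans (*-cong x₀w (L*⇒^≈1 Lr r≉0)) (*-identityʳ w))
          from : ∀ r → Fibre w (x₀ * r) → L r ∧ ¬ (r ≈ 0#)
          from r ((_ , x₀r≉0) , eq) = ^≈1⇒L (*-cancelˡ (^≉0 (q ℕ.∸ 1) x₀≉0)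
              (trans (sym (^-distrib-* x₀ r (q ℕ.∸ 1))) (trans eq (trans (sym x₀w) (sym (*-identityʳ _)))))) ,
            λ r≈0 → x₀r≉0 (trans (*-congˡ r≈0) (zeroʳ x₀))

    opaque
      -- The number of one-dimensional L-subspaces of K on which form b a takes values in H.
      N : K.Carrier → K.Carrier → ℕ
      N b a = ℕ.quotient (q-1∣M* b a)

      M≡ : ∀ b a → M b a ≡ 1 ℕ.+ N b a ℕ.* (q ℕ.∸ 1)
      M≡ b a = ≡.trans (M≡1+M* b a) (≡.cong suc (ℕ._∣_.equality (q-1∣M* b a)))

    N-from-M : ∀ {b a n} → M b a ≡ 1 ℕ.+ n ℕ.* (q ℕ.∸ 1) → N b a ≡ n
    N-from-M {b} {a} {n} eq = ℕ.*-cancelʳ-≡ _ n (q ℕ.∸ 1) (ℕ.suc-injective (≡.trans (≡.sym (M≡ b a)) eq))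

    N-cong : ∀ {b b′ a a′} → b ≈ b′ → a ≈ a′ → N b a ≡ N b′ a′
    N-cong b≈ a≈ = N-from-M (≡.trans (M-cong b≈ a≈) (M≡ _ _))

    -- Substituting M = 1 + N (q - 1) in `W-M` and cancelling q - 1, nonzero in characteristic zero,
    -- gives W = q (N - 1). The subtraction is moved so that the right-hand side is the cast of a
    -- natural number.
    W-N : ∀ b a → W b a F.+ ι q F.≈ ι (q ℕ.* N b a)
    W-N b a = FP.*-cancelˡ (λ eq → ℕ.≢-nonZero⁻¹ (q ℕ.∸ 1) (×1≈0⇒≡0 eq)) (FR.+-cancelʳ (ι order) _ _ (begin
      ι[q-1] F.* (W b a F.+ ι q) F.+ ι order               ≈⟨ F.+-congʳ (F.distribˡ ι[q-1] _ _) ⟩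
      ι[q-1] F.* W b a F.+ ι[q-1] F.* ι q F.+ ι order           ≈⟨ xy∙z≈xz∙y _ _ _ ⟩
      ι[q-1] F.* W b a F.+ ι order F.+ ι[q-1] F.* ι q           ≈⟨ F.+-cong (W-M b a) (F.sym (×1-homo-* (q ℕ.∸ 1) q)) ⟩
      ι (M b a) F.* ι q F.+ ι ((q ℕ.∸ 1) ℕ.* q)       ≈⟨ F.+-congʳ (×1-homo-* (M b a) q) ⟨
      ι (M b a ℕ.* q) F.+ ι ((q ℕ.∸ 1) ℕ.* q)         ≈⟨ ×-homo-+ F.1# (M b a ℕ.* q) _ ⟨
      ι (M b a ℕ.* q ℕ.+ (q ℕ.∸ 1) ℕ.* q)             ≡⟨ ≡.cong ι identity ⟩
      ι ((q ℕ.∸ 1) ℕ.* (q ℕ.* N b a) ℕ.+ order)       ≈⟨ ×-homo-+ F.1# ((q ℕ.∸ 1) ℕ.* (q ℕ.* N b a)) order ⟩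
      ι ((q ℕ.∸ 1) ℕ.* (q ℕ.* N b a)) F.+ ι order     ≈⟨ F.+-congʳ (×1-homo-* (q ℕ.∸ 1) _) ⟩
      ι[q-1] F.* ι (q ℕ.* N b a) F.+ ι order               ∎))
      where
      open ≈-Reasoning F.setoid
      open import Algebra.Properties.CommutativeSemigroup
        (CommutativeMonoid.commutativeSemigroup (CommutativeRing.+-commutativeMonoid F.commutativeRing)) using (xy∙z≈xz∙y)
      ι[q-1] = ι (q ℕ.∸ 1)
      arithmetic : ∀ q′ N → (1 ℕ.+ N ℕ.* q′) ℕ.* (1 ℕ.+ q′) ℕ.+ q′ ℕ.* (1 ℕ.+ q′) ≡ q′ ℕ.* ((1 ℕ.+ q′) ℕ.* N) ℕ.+ (1 ℕ.+ q′) ℕ.* (1 ℕ.+ q′)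
      arithmetic = ℕ-solve-∀
      identity : M b a ℕ.* q ℕ.+ (q ℕ.∸ 1) ℕ.* q ≡ (q ℕ.∸ 1) ℕ.* (q ℕ.* N b a) ℕ.+ order
      identity = ≡.trans (≡.cong (λ m → m ℕ.* q ℕ.+ (q ℕ.∸ 1) ℕ.* q) (M≡ b a)) (≡.trans
        (≡.subst (λ m → (1 ℕ.+ N b a ℕ.* (q ℕ.∸ 1)) ℕ.* m ℕ.+ (q ℕ.∸ 1) ℕ.* m ≡ (q ℕ.∸ 1) ℕ.* (m ℕ.* N b a) ℕ.+ m ℕ.* m) 1+[q-1]≡q
          (arithmetic (q ℕ.∸ 1) (N b a)))
        (≡.cong ((q ℕ.∸ 1) ℕ.* (q ℕ.* N b a) ℕ.+_) q*q≡order))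

    W≈0⇒N≡1 : ∀ {b a} → W b a F.≈ F.0# → N b a ≡ 1
    W≈0⇒N≡1 {b} {a} W≈0 = ℕ.*-cancelˡ-≡ _ 1 q (×1-injective (F.trans (F.sym (W-N b a))
      (F.trans (F.+-congʳ W≈0) (F.trans (F.+-identityˡ _) (F.reflexive (≡.cong ι (≡.sym (ℕ.*-identityʳ q))))))))

    -- As φ permutes K, the sum is that of the nontrivial character x ↦ ψ(b x) over K and vanishes.
    N-b0 : ∀ {b a} → ¬ (b ≈ 0#) → a ≈ 0# → N b a ≡ 1
    N-b0 {b} {a} b≉0 a≈0 = W≈0⇒N≡1 {b} {a} (F.trans (∑-cong (λ x → ψ-cong
        (trans (+-congˡ (trans (*-congʳ a≈0) (zeroˡ x))) (trans (+-identityʳ _) (*-comm b _)))))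
      (F.trans (∑-permute (λ x → ψ (x * b)) φ φ⁻¹ (λ x≈y → ψ-cong (*-congʳ x≈y)) φ-cong (^-congˡ u) φφ⁻¹ φ⁻¹φ)
        (F.trans (∑ψ b) (when-no (b ≟ 0#) b≉0))))

    N-0a : ∀ {b a} → b ≈ 0# → ¬ (a ≈ 0#) → N b a ≡ 1
    N-0a {b} {a} b≈0 a≉0 = W≈0⇒N≡1 {b} {a} (F.trans (∑-cong (λ x → ψ-cong
        (trans (+-congʳ (trans (*-congʳ b≈0) (zeroˡ _))) (trans (+-identityˡ _) (*-comm a x)))))
      (F.trans (∑ψ a) (when-no (a ≟ 0#) a≉0)))

    -- With φ(γ) = b, putting γ x for x in φ(x) + a γ⁻¹ x gives b φ(x) + a x, and a dilation does
    -- not change the count.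
    N-normalise : ∀ b a → ¬ (b ≈ 0#) → N b a ≡ N 1# (a * φ⁻¹ b ⁻¹)
    N-normalise b a b≉0 = N-from-M (≡.trans (begin
      M b a                                            ≡⟨ #.count-cong (H-form? b a) (λ x → H-form? 1# a′ (γ * x))
                                                            (λ x → H-resp (eq x)) (λ x → H-resp (sym (eq x))) ⟩
      #.count (λ x → H-form? 1# a′ (γ * x))            ≡⟨ count-dilate (H-form? 1# a′) (λ x≈y → H-resp (form-cong refl refl x≈y)) γ γ≉0 ⟩
      M 1# a′                                          ∎) (M≡ 1# a′))
      where
      open ≡.≡-Reasoning
      γ = φ⁻¹ b
      a′ = a * γ ⁻¹
      γ≉0 : ¬ (γ ≈ 0#)
      γ≉0 γ≈0 = b≉0 (trans (sym (φφ⁻¹ b)) (trans (φ-cong γ≈0) φ-0))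
      eq : ∀ x → form b a x ≈ form 1# a′ (γ * x)
      eq x = sym (trans (form-scale 1# a′ γ x) (form-cong (trans (*-identityˡ _) (φφ⁻¹ b))
        (trans (*-assoc a _ γ) (trans (*-congˡ (trans (*-comm _ γ) (⁻¹-inverseʳ γ≉0))) (*-identityʳ a))) refl))

    -- K has only q + 1 lines, since its q² - 1 nonzero elements are shared out in sets of q - 1.
    N≤1+q : ∀ b a → N b a ≤ 1 ℕ.+ q
    N≤1+q b a = ℕ.*-cancelʳ-≤ _ _ (q ℕ.∸ 1) (ℕ.+-cancelˡ-≤ 1 _ _ (begin
      1 ℕ.+ N b a ℕ.* (q ℕ.∸ 1)      ≡⟨ M≡ b a ⟨
      M b a                          ≤⟨ #.∑-mono-≤ (λ x → indicator≤1 (H-form? b a x)) ⟩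
      #.∑ (λ _ → 1)                  ≡⟨ #.count-true (λ _ → yes tt) (λ _ → tt) ⟩
      order                          ≡⟨ q*q≡order ⟨
      q ℕ.* q                        ≡⟨ q*q≡1+[1+q][q-1] ⟩
      1 ℕ.+ (1 ℕ.+ q) ℕ.* (q ℕ.∸ 1)  ∎))
      where
      open ℕ.≤-Reasoning
      indicator≤1 : (d : Dec P) → 1 #.when d ≤ 1
      indicator≤1 (yes _) = s≤s z≤n
      indicator≤1 (no  _) = z≤n

    N-vanishing : ∀ {b a} → (∀ x → form b a x ≈ 0#) → N b a ≡ 1 ℕ.+ q
    N-vanishing {b} {a} form≈0 = N-from-M (begin
      M b a                          ≡⟨ #.count-true (H-form? b a) (λ x → H-resp (sym (form≈0 x)) H-0) ⟩
      order                          ≡⟨ q*q≡order ⟨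
      q ℕ.* q                        ≡⟨ q*q≡1+[1+q][q-1] ⟩
      1 ℕ.+ (1 ℕ.+ q) ℕ.* (q ℕ.∸ 1)  ∎)
      where
      open ≡.≡-Reasoning

    form-00 : ∀ {b a} x → b ≈ 0# → a ≈ 0# → form b a x ≈ 0#
    form-00 x b≈0 a≈0 = trans (+-cong (trans (*-congʳ b≈0) (zeroˡ _)) (trans (*-congʳ a≈0) (zeroˡ x))) (+-identityʳ 0#)

    -- First and second moments of W and N

    ∑ψ-form : ∀ b a x y → ψ (form b a x) F.* ψ (form b a y) F.≈ ψ (b * (φ x + φ y)) F.* ψ (a * (x + y))
    ∑ψ-form b a x y = F.trans (F.sym (ψ-+ _ _)) (F.trans (ψ-cong (trans (interchange _ _ _ _)
      (+-cong (sym (distribˡ b _ _)) (sym (distribˡ a x y))))) (ψ-+ _ _))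
      where open import Algebra.Properties.CommutativeSemigroup
                   (CommutativeMonoid.commutativeSemigroup (CommutativeRing.+-commutativeMonoid K.commutativeRing)) using (interchange)

    ∑W : ∑ (λ a → W 1# a) F.≈ ι order
    ∑W = begin
      ∑ (λ a → ∑ (λ x → ψ (form 1# a x)))                          ≈⟨ ∑-swap _ ⟩
      ∑ (λ x → ∑ (λ a → ψ (form 1# a x)))                          ≈⟨ ∑-cong (λ x → ∑-cong (λ a → ψ-+ _ _)) ⟩
      ∑ (λ x → ∑ (λ a → ψ (1# * φ x) F.* ψ (a * x)))               ≈⟨ ∑-cong (λ x → *-distribˡ-∑ _ _) ⟨
      ∑ (λ x → ψ (1# * φ x) F.* ∑ (λ a → ψ (a * x)))               ≈⟨ ∑-cong (λ x → F.trans (F.*-congˡ (∑ψ x)) (*-when _ (x ≟ 0#))) ⟩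
      ∑ (λ x → (ψ (1# * φ x) F.* ι order) when (x ≟ 0#))           ≈⟨ ∑-when-≈ _≟_ _ 0# (λ x≈y → F.*-congʳ (ψ-cong (*-congˡ (φ-cong x≈y)))) ⟩
      ψ (1# * φ 0#) F.* ι order                                    ≈⟨ F.*-congʳ (F.trans (ψ-cong (trans (*-congˡ φ-0) (zeroʳ 1#))) ψ-0) ⟩
      F.1# F.* ι order                                             ≈⟨ F.*-identityˡ _ ⟩
      ι order                                                      ∎
      where open ≈-Reasoning F.setoid

    -- Summing over a first leaves the |K| pairs with y = -x. Each contributes |K|, because -1 lies
    -- in L and hence φ is odd.
    ∑W² : ∑ (λ a → W 1# a F.* W 1# a) F.≈ ι (order ℕ.* order)
    ∑W² = begin
      ∑ (λ a → W 1# a F.* W 1# a)                                                ≈⟨ ∑-cong (λ a → ∑-*-∑ _ _) ⟩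
      ∑ (λ a → ∑ (λ x → ∑ (λ y → ψ (form 1# a x) F.* ψ (form 1# a y))))          ≈⟨ ∑-swap _ ⟩
      ∑ (λ x → ∑ (λ a → ∑ (λ y → ψ (form 1# a x) F.* ψ (form 1# a y))))          ≈⟨ ∑-cong (λ x → ∑-swap _) ⟩
      ∑ (λ x → ∑ (λ y → ∑ (λ a → ψ (form 1# a x) F.* ψ (form 1# a y))))          ≈⟨ ∑-cong (λ x → ∑-cong (inner x)) ⟩
      ∑ (λ x → ∑ (λ y → ψ (1# * (φ x + φ y)) F.* (ι order when ((x + y) ≟ 0#)))) ≈⟨ ∑-cong single ⟩
      ∑ (λ x → ι order)                                                          ≈⟨ ∑-cong (λ x → F.*-identityˡ _) ⟨
      ∑ (λ x → F.1# F.* ι order)                                                 ≈⟨ *-distribʳ-∑ _ _ ⟨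
      ∑ (λ x → F.1#) F.* ι order                                                 ≈⟨ F.*-congʳ (∑-const F.1#) ⟩
      ι order F.* ι order                                                        ≈⟨ ×1-homo-* order order ⟨
      ι (order ℕ.* order)                                                        ∎
      where
      open ≈-Reasoning F.setoid
      inner : ∀ x y → ∑ (λ a → ψ (form 1# a x) F.* ψ (form 1# a y)) F.≈ ψ (1# * (φ x + φ y)) F.* (ι order when ((x + y) ≟ 0#))
      inner x y = F.trans (∑-cong (λ a → ∑ψ-form 1# a x y)) (F.trans (F.sym (*-distribˡ-∑ _ _)) (F.*-congˡ (∑ψ (x + y))))
      ≉-x : ∀ {x y} → ¬ (y ≈ - x) → ¬ (x + y ≈ 0#)
      ≉-x {x} {y} y≉-x eq = y≉-x (+-cancelˡ x _ _ (trans eq (sym (-‿inverseʳ x))))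
      single : ∀ x → ∑ (λ y → ψ (1# * (φ x + φ y)) F.* (ι order when ((x + y) ≟ 0#))) F.≈ ι order
      single x = begin
        ∑ (λ y → ψ (1# * (φ x + φ y)) F.* (ι order when ((x + y) ≟ 0#)))
          ≈⟨ ∑-single _ (- x)
               (λ y≈z → F.*-cong (ψ-cong (*-congˡ (+-congˡ (φ-cong y≈z))))
                          (when-cong (_ ≟ 0#) (_ ≟ 0#) (trans (+-congˡ (sym y≈z))) (trans (+-congˡ y≈z)) (λ _ → F.refl)))
               (λ y y≉-x → F.trans (F.*-congˡ (when-no ((x + y) ≟ 0#) (≉-x y≉-x))) (F.zeroʳ _)) ⟩
        ψ (1# * (φ x + φ (- x))) F.* (ι order when ((x - x) ≟ 0#))
          ≈⟨ F.*-cong (F.trans (ψ-cong (trans (*-congˡ (trans (+-congˡ (φ-neg x)) (-‿inverseʳ _))) (zeroʳ 1#))) ψ-0)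
                      (when-yes ((x - x) ≟ 0#) (-‿inverseʳ x)) ⟩
        F.1# F.* ι order    ≈⟨ F.*-identityˡ _ ⟩
        ι order             ∎

    ∑N : #.∑ (λ a → N 1# a) ≡ q ℕ.+ q ℕ.* q
    ∑N = ℕ.*-cancelˡ-≡ _ _ q (≡.trans (×1-injective (begin
      ι (q ℕ.* #.∑ (λ a → N 1# a))           ≡⟨ ≡.cong ι (#.*-distribˡ-∑ q _) ⟩
      ι (#.∑ (λ a → q ℕ.* N 1# a))           ≈⟨ Cast.∑-×1 _ ⟩
      ∑ (λ a → ι (q ℕ.* N 1# a))             ≈⟨ ∑-cong (W-N 1#) ⟨
      ∑ (λ a → W 1# a F.+ ι q)               ≈⟨ ∑-distrib _ _ ⟩
      ∑ (λ a → W 1# a) F.+ ∑ (λ _ → ι q)     ≈⟨ F.+-cong ∑W (∑-ι q) ⟩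
      ι order F.+ ι (order ℕ.* q)            ≈⟨ ×-homo-+ F.1# order _ ⟨
      ι (order ℕ.+ order ℕ.* q)              ∎))
      (≡.subst (λ m → m ℕ.+ m ℕ.* q ≡ q ℕ.* (q ℕ.+ q ℕ.* q)) q*q≡order (arithmetic q)))
      where
      open ≈-Reasoning F.setoid
      arithmetic : ∀ q → q ℕ.* q ℕ.+ q ℕ.* q ℕ.* q ≡ q ℕ.* (q ℕ.+ q ℕ.* q)
      arithmetic = ℕ-solve-∀

    -- The square of `W-N` expresses q² N² through W², W and a constant, whose sums are known; the
    -- identity is read back in ℕ, where q² cancels.
    ∑N² : #.∑ (λ a → N 1# a ℕ.* N 1# a) ≡ 2 ℕ.* (q ℕ.+ q ℕ.* q)
    ∑N² = ℕ.*-cancelˡ-≡ _ _ (q ℕ.* q) {{ℕ.m*n≢0 q q}} (≡.trans (×1-injective (begin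
      ι (q ℕ.* q ℕ.* #.∑ (λ a → N 1# a ℕ.* N 1# a))          ≡⟨ ≡.cong ι (#.*-distribˡ-∑ (q ℕ.* q) _) ⟩
      ι (#.∑ (λ a → q ℕ.* q ℕ.* (N 1# a ℕ.* N 1# a)))        ≈⟨ Cast.∑-×1 _ ⟩
      ∑ (λ a → ι (q ℕ.* q ℕ.* (N 1# a ℕ.* N 1# a)))          ≈⟨ ∑-cong square ⟩
      ∑ (λ a → W 1# a F.* W 1# a F.+ (ι (2 ℕ.* q) F.* W 1# a F.+ ι (q ℕ.* q)))
        ≈⟨ F.trans (∑-distrib _ _) (F.+-congˡ (∑-distrib _ _)) ⟩
      ∑ (λ a → W 1# a F.* W 1# a) F.+ (∑ (λ a → ι (2 ℕ.* q) F.* W 1# a) F.+ ∑ (λ _ → ι (q ℕ.* q)))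
        ≈⟨ F.+-cong ∑W² (F.+-cong (F.trans (F.sym (*-distribˡ-∑ _ _)) (F.trans (F.*-congˡ ∑W) (F.sym (×1-homo-* (2 ℕ.* q) order)))) (∑-ι (q ℕ.* q))) ⟩
      ι (order ℕ.* order) F.+ (ι (2 ℕ.* q ℕ.* order) F.+ ι (order ℕ.* (q ℕ.* q)))
        ≈⟨ F.trans (×-homo-+ F.1# (order ℕ.* order) _) (F.+-congˡ (×-homo-+ F.1# (2 ℕ.* q ℕ.* order) _)) ⟨
      ι (order ℕ.* order ℕ.+ (2 ℕ.* q ℕ.* order ℕ.+ order ℕ.* (q ℕ.* q))) ∎))
      (≡.subst (λ m → m ℕ.* m ℕ.+ (2 ℕ.* q ℕ.* m ℕ.+ m ℕ.* (q ℕ.* q)) ≡ q ℕ.* q ℕ.* (2 ℕ.* (q ℕ.+ q ℕ.* q))) q*q≡order (arithmetic q)))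
      where
      open ≈-Reasoning F.setoid
      arithmetic : ∀ q → q ℕ.* q ℕ.* (q ℕ.* q) ℕ.+ (2 ℕ.* q ℕ.* (q ℕ.* q) ℕ.+ q ℕ.* q ℕ.* (q ℕ.* q)) ≡ q ℕ.* q ℕ.* (2 ℕ.* (q ℕ.+ q ℕ.* q))
      arithmetic = ℕ-solve-∀
      regroup : ∀ q n → q ℕ.* q ℕ.* (n ℕ.* n) ≡ q ℕ.* n ℕ.* (q ℕ.* n)
      regroup = ℕ-solve-∀
      expand : ∀ w z → (w F.+ z) F.* (w F.+ z) F.≈ w F.* w F.+ ((z F.+ z) F.* w F.+ z F.* z)
      expand w z = begin
        (w F.+ z) F.* (w F.+ z)                              ≈⟨ F.distribʳ _ w z ⟩
        w F.* (w F.+ z) F.+ z F.* (w F.+ z)                  ≈⟨ F.+-cong (F.distribˡ w w z) (F.distribˡ z w z) ⟩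
        w F.* w F.+ w F.* z F.+ (z F.* w F.+ z F.* z)        ≈⟨ F.+-assoc _ _ _ ⟩
        w F.* w F.+ (w F.* z F.+ (z F.* w F.+ z F.* z))      ≈⟨ F.+-congˡ (F.+-assoc _ _ _) ⟨
        w F.* w F.+ (w F.* z F.+ z F.* w F.+ z F.* z)        ≈⟨ F.+-congˡ (F.+-congʳ (F.+-congʳ (F.*-comm w z))) ⟩
        w F.* w F.+ (z F.* w F.+ z F.* w F.+ z F.* z)        ≈⟨ F.+-congˡ (F.+-congʳ (F.distribʳ w z z)) ⟨
        w F.* w F.+ ((z F.+ z) F.* w F.+ z F.* z)            ∎
      square : ∀ a → ι (q ℕ.* q ℕ.* (N 1# a ℕ.* N 1# a)) F.≈ W 1# a F.* W 1# a F.+ (ι (2 ℕ.* q) F.* W 1# a F.+ ι (q ℕ.* q))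
      square a = begin
        ι (q ℕ.* q ℕ.* (N 1# a ℕ.* N 1# a))           ≡⟨ ≡.cong ι (regroup q (N 1# a)) ⟩
        ι (q ℕ.* N 1# a ℕ.* (q ℕ.* N 1# a))           ≈⟨ ×1-homo-* (q ℕ.* N 1# a) _ ⟩
        ι (q ℕ.* N 1# a) F.* ι (q ℕ.* N 1# a)         ≈⟨ F.*-cong (W-N 1# a) (W-N 1# a) ⟨
        (W 1# a F.+ ι q) F.* (W 1# a F.+ ι q)         ≈⟨ expand (W 1# a) (ι q) ⟩
        W 1# a F.* W 1# a F.+ ((ι q F.+ ι q) F.* W 1# a F.+ ι q F.* ι q)
          ≈⟨ F.+-congˡ (F.+-cong (F.*-congʳ (F.trans (F.sym (×-homo-+ F.1# q q)) (F.reflexive (≡.cong (λ m → ι (q ℕ.+ m)) (≡.sym (ℕ.+-identityʳ q)))))) (F.sym (×1-homo-* q q))) ⟩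
        W 1# a F.* W 1# a F.+ (ι (2 ℕ.* q) F.* W 1# a F.+ ι (q ℕ.* q)) ∎

    -- For t with φ(t) ≠ t, the forms taking values in H at both 1 and t are the
    -- form β α, parametrised by their values h₁ at 1 and h₂ at t.
    module Pencil (t : K.Carrier) (φt≉t : ¬ (φ t ≈ t)) where
      private
        module HF = Subset H?
        module Hℕ = #.Subset H?

        -- `A` and `B` form the dual basis for evaluation at 1 and t: B(x) = (φ(x) - x) / (φ(t) - t)
        -- and A(x) = x - t B(x), so A(1) = B(t) = 1 and A(t) = B(1) = 0.
        δ β₁ α₁ β₂ α₂ : K.Carrier
        δ  = (φ t - t) ⁻¹
        β₂ = δ
        α₂ = - δ
        β₁ = - (t * δ)
        α₁ = 1# + t * δ

        δ-inverse : δ * (φ t - t) ≈ 1#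
        δ-inverse = trans (*-comm _ _) (⁻¹-inverseʳ (λ eq → φt≉t (-≈0⇒≈ eq)))

        A B : K.Carrier → K.Carrier
        A = form β₁ α₁
        B = form β₂ α₂

      β α : K.Carrier → K.Carrier → K.Carrier
      β h₁ h₂ = h₁ * β₁ + h₂ * β₂
      α h₁ h₂ = h₁ * α₁ + h₂ * α₂

      private
        form-*ˡ : ∀ h b a x → form (h * b) (h * a) x ≈ h * form b a x
        form-*ˡ h b a x = trans (+-cong (*-assoc h b _) (*-assoc h a x)) (sym (distribˡ h _ _))

        form-pencil : ∀ h₁ h₂ x → form (β h₁ h₂) (α h₁ h₂) x ≈ h₁ * A x + h₂ * B x
        form-pencil h₁ h₂ x = trans (form-+ˡ _ _ _ _ x) (+-cong (form-*ˡ h₁ β₁ α₁ x) (form-*ˡ h₂ β₂ α₂ x))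

        φ-1 : φ 1# ≈ 1#
        φ-1 = φ-L L-1

        B≈ : ∀ x → B x ≈ δ * (φ x - x)
        B≈ x = sym (trans (distribˡ δ _ _) (+-congˡ (trans (sym (-‿distribʳ-* δ x)) (-‿distribˡ-* δ x))))

        A≈ : ∀ x → A x ≈ x - t * B x
        A≈ x = begin
          - (t * δ) * φ x + (1# + t * δ) * x           ≈⟨ +-cong (sym (-‿distribˡ-* (t * δ) (φ x))) (distribʳ x _ _) ⟩
          - (t * δ * φ x) + (1# * x + t * δ * x)       ≈⟨ +-congˡ (+-congʳ (*-identityˡ x)) ⟩
          - (t * δ * φ x) + (x + t * δ * x)            ≈⟨ x∙yz≈y∙xz _ _ _ ⟩
          x + (- (t * δ * φ x) + t * δ * x)            ≈⟨ +-congˡ (+-cong (-‿cong (*-assoc t δ _)) (*-assoc t δ x)) ⟩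
          x + (- (t * (δ * φ x)) + t * (δ * x))        ≈⟨ +-congˡ (+-congˡ (-‿involutive _)) ⟨
          x + (- (t * (δ * φ x)) - - (t * (δ * x)))    ≈⟨ +-congˡ (-‿+-comm _ _) ⟩
          x - (t * (δ * φ x) - t * (δ * x))            ≈⟨ +-congˡ (-‿cong (trans (+-congˡ (trans (-‿distribʳ-* t _) (*-congˡ (-‿distribˡ-* δ x)))) (sym (distribˡ t _ _)))) ⟩
          x - t * B x                                  ∎
          where
          open ≈-Reasoning setoid
          open import Algebra.Properties.CommutativeSemigroup
            (CommutativeMonoid.commutativeSemigroup (CommutativeRing.+-commutativeMonoid K.commutativeRing)) using (x∙yz≈y∙xz)

        B-1 : B 1# ≈ 0#
        B-1 = trans (B≈ 1#) (trans (*-congˡ (≈⇒-≈0 φ-1)) (zeroʳ δ))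

        B-t : B t ≈ 1#
        B-t = trans (B≈ t) δ-inverse

        A-1 : A 1# ≈ 1#
        A-1 = trans (A≈ 1#) (trans (+-congˡ (trans (-‿cong (trans (*-congˡ B-1) (zeroʳ t))) -0#≈0#)) (+-identityʳ 1#))

        A-t : A t ≈ 0#
        A-t = trans (A≈ t) (≈⇒-≈0 (sym (trans (*-congˡ B-t) (*-identityʳ t))))

      pencil-1 : ∀ h₁ h₂ → form (β h₁ h₂) (α h₁ h₂) 1# ≈ h₁
      pencil-1 h₁ h₂ = trans (form-pencil h₁ h₂ 1#) (trans (+-cong (trans (*-congˡ A-1) (*-identityʳ h₁)) (trans (*-congˡ B-1) (zeroʳ h₂))) (+-identityʳ h₁))

      pencil-t : ∀ h₁ h₂ → form (β h₁ h₂) (α h₁ h₂) t ≈ h₂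
      pencil-t h₁ h₂ = trans (form-pencil h₁ h₂ t) (trans (+-cong (trans (*-congˡ A-t) (zeroʳ h₁)) (trans (*-congˡ B-t) (*-identityʳ h₂))) (+-identityˡ h₂))

      private
        H⊥? : ∀ z → Dec (∀ h → H h → ψ (h * z) F.≈ F.1#)
        H⊥? z = all? (λ h≈g ψh Hg → F.trans (ψ-cong (*-congʳ (sym h≈g))) (ψh (H-resp (sym h≈g) Hg)))
                     (λ h → H? h →-dec ψ≈1? (h * z))

        ∑ψH : ∀ z → HF.∑∈ (λ h → ψ (h * z)) F.≈ ι q when H⊥? z
        ∑ψH z = F.trans (Orthogonality.ψ-sum H? H-resp H-+ H-neg z (H⊥? z))
          (when-cong (H⊥? z) (H⊥? z) (λ h → h) (λ h → h) (λ _ → F.reflexive (≡.cong ι |H|≡q)))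

        H⊥×H⊥? : ∀ x → Dec ((∀ h → H h → ψ (h * A x) F.≈ F.1#) ∧ (∀ h → H h → ψ (h * B x) F.≈ F.1#))
        H⊥×H⊥? x = H⊥? (A x) ×-dec H⊥? (B x)

        J : ℕ
        J = #.count H⊥×H⊥?

        -- A form of the pencil is h₁ A + h₂ B, so for fixed x the sum over H × H factors into two
        -- character sums over H. Each is q or 0, and `J` counts the x for which neither vanishes.
        ∑W-pencil : HF.∑∈ (λ h₁ → HF.∑∈ (λ h₂ → W (β h₁ h₂) (α h₁ h₂))) F.≈ ι (J ℕ.* (q ℕ.* q))
        ∑W-pencil = begin
          HF.∑∈ (λ h₁ → HF.∑∈ (λ h₂ → W (β h₁ h₂) (α h₁ h₂)))
            ≈⟨ HF.∑∈-cong (λ h₁ _ → HF.∑∈-cong (λ h₂ _ → ∑-cong (λ x → F.trans (ψ-cong (form-pencil h₁ h₂ x)) (ψ-+ _ _)))) ⟩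
          HF.∑∈ (λ h₁ → HF.∑∈ (λ h₂ → ∑ (λ x → ψ (h₁ * A x) F.* ψ (h₂ * B x))))
            ≈⟨ HF.∑∈-cong (λ h₁ _ → HF.∑∈-∑-swap _) ⟩
          HF.∑∈ (λ h₁ → ∑ (λ x → HF.∑∈ (λ h₂ → ψ (h₁ * A x) F.* ψ (h₂ * B x))))
            ≈⟨ HF.∑∈-∑-swap _ ⟩
          ∑ (λ x → HF.∑∈ (λ h₁ → HF.∑∈ (λ h₂ → ψ (h₁ * A x) F.* ψ (h₂ * B x))))
            ≈⟨ ∑-cong (λ x → HF.∑∈-cong (λ h₁ _ → HF.*-distribˡ-∑∈ _ _)) ⟨
          ∑ (λ x → HF.∑∈ (λ h₁ → ψ (h₁ * A x) F.* HF.∑∈ (λ h₂ → ψ (h₂ * B x))))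
            ≈⟨ ∑-cong (λ x → HF.*-distribʳ-∑∈ _ _) ⟨
          ∑ (λ x → HF.∑∈ (λ h₁ → ψ (h₁ * A x)) F.* HF.∑∈ (λ h₂ → ψ (h₂ * B x)))
            ≈⟨ ∑-cong (λ x → F.trans (F.*-cong (∑ψH (A x)) (∑ψH (B x))) (when-*-when (H⊥? (A x)) (H⊥? (B x)))) ⟩
          ∑ (λ x → ι (q ℕ.* q) when H⊥×H⊥? x)
            ≈⟨ Cast.∑-when H⊥×H⊥? (ι (q ℕ.* q)) ⟩
          ι J F.* ι (q ℕ.* q)
            ≈⟨ ×1-homo-* J (q ℕ.* q) ⟨
          ι (J ℕ.* (q ℕ.* q))  ∎
          where
          open ≈-Reasoning F.setoid
          when-*-when : (d : Dec P) (e : Dec Q) → (ι q when d) F.* (ι q when e) F.≈ ι (q ℕ.* q) when (d ×-dec e)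
          when-*-when (yes _) (yes _) = F.sym (×1-homo-* q q)
          when-*-when (yes _) (no  _) = F.zeroʳ _
          when-*-when (no  _) _       = F.zeroˡ _

        ∑Nℕ : ℕ
        ∑Nℕ = Hℕ.∑∈ (λ h₁ → Hℕ.∑∈ (λ h₂ → N (β h₁ h₂) (α h₁ h₂)))

        ∑H-const : ∀ m → Hℕ.∑∈ (λ _ → m) ≡ q ℕ.* m
        ∑H-const m = ≡.trans (#.∑-cong (λ h → one-when (H? h))) (≡.trans (≡.sym (#.*-distribʳ-∑ m _)) (≡.cong (ℕ._* m) |H|≡q))
          where
          one-when : (d : Dec P) → m #.when d ≡ 1 #.when d ℕ.* m
          one-when (yes _) = ≡.sym (ℕ.*-identityˡ m)
          one-when (no  _) = ≡.refl

        -- By `W-N`, q times the sum of N is J q² + q³. After division by q a factor q is left,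
        -- which is the divisibility that the pencil is built for.
        ∑N-pencil : ∑Nℕ ≡ q ℕ.* (J ℕ.+ q)
        ∑N-pencil = ℕ.*-cancelˡ-≡ _ _ q (≡.trans (×1-injective (begin
          ι (q ℕ.* ∑Nℕ)
            ≡⟨ ≡.cong ι (≡.trans (Hℕ.*-distribˡ-∑∈ q _) (Hℕ.∑∈-cong (λ h₁ _ → Hℕ.*-distribˡ-∑∈ q _))) ⟩
          ι (Hℕ.∑∈ (λ h₁ → Hℕ.∑∈ (λ h₂ → q ℕ.* N (β h₁ h₂) (α h₁ h₂))))
            ≈⟨ cast² _ ⟩
          HF.∑∈ (λ h₁ → HF.∑∈ (λ h₂ → ι (q ℕ.* N (β h₁ h₂) (α h₁ h₂))))
            ≈⟨ HF.∑∈-cong (λ h₁ _ → HF.∑∈-cong (λ h₂ _ → W-N _ _)) ⟨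
          HF.∑∈ (λ h₁ → HF.∑∈ (λ h₂ → W (β h₁ h₂) (α h₁ h₂) F.+ ι q))
            ≈⟨ F.trans (HF.∑∈-cong (λ h₁ _ → HF.∑∈-distrib _ _)) (HF.∑∈-distrib _ _) ⟩
          HF.∑∈ (λ h₁ → HF.∑∈ (λ h₂ → W (β h₁ h₂) (α h₁ h₂))) F.+ HF.∑∈ (λ h₁ → HF.∑∈ (λ h₂ → ι q))
            ≈⟨ F.+-cong ∑W-pencil (F.sym (cast² _)) ⟩
          ι (J ℕ.* (q ℕ.* q)) F.+ ι (Hℕ.∑∈ (λ h₁ → Hℕ.∑∈ (λ h₂ → q)))
            ≈⟨ ×-homo-+ F.1# (J ℕ.* (q ℕ.* q)) _ ⟨
          ι (J ℕ.* (q ℕ.* q) ℕ.+ Hℕ.∑∈ (λ h₁ → Hℕ.∑∈ (λ h₂ → q)))  ∎))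
          (≡.trans (≡.cong (J ℕ.* (q ℕ.* q) ℕ.+_) (≡.trans (Hℕ.∑∈-cong (λ _ _ → ∑H-const q)) (∑H-const (q ℕ.* q)))) (arithmetic q J)))
          where
          open ≈-Reasoning F.setoid
          cast² : ∀ (f : K.Carrier → K.Carrier → ℕ) →
                  ι (Hℕ.∑∈ (λ h₁ → Hℕ.∑∈ (λ h₂ → f h₁ h₂))) F.≈ HF.∑∈ (λ h₁ → HF.∑∈ (λ h₂ → ι (f h₁ h₂)))
          cast² f = F.trans (Cast.∑∈-×1 H? _) (HF.∑∈-cong (λ h₁ _ → Cast.∑∈-×1 H? _))
          arithmetic : ∀ q J → J ℕ.* (q ℕ.* q) ℕ.+ q ℕ.* (q ℕ.* q) ≡ q ℕ.* (q ℕ.* (J ℕ.+ q))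
          arithmetic = ℕ-solve-∀

        ∑H-0 : ∀ m → Hℕ.∑∈ (λ h → m #.when (h ≟ 0#)) ≡ m
        ∑H-0 m = ≡.trans (#.∑-cong drop) (#.∑-when-≈ _≟_ (λ _ → m) 0# (λ _ → ≡.refl))
          where
          drop : ∀ h → (m #.when (h ≟ 0#)) #.when H? h ≡ m #.when (h ≟ 0#)
          drop h with h ≟ 0#
          ... | yes h≈0 = #.when-yes (H? h) (H-resp (sym h≈0) H-0)
          ... | no  _   with H? h
          ... | yes _ = ≡.refl
          ... | no  _ = ≡.refl

        ∑H-00 : ∀ m → Hℕ.∑∈ (λ h₁ → Hℕ.∑∈ (λ h₂ → (m #.when (h₂ ≟ 0#)) #.when (h₁ ≟ 0#))) ≡ m
        ∑H-00 m = ≡.trans (Hℕ.∑∈-cong (λ h₁ _ → inner (h₁ ≟ 0#))) (∑H-0 m)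
          where
          inner : (d : Dec P) → Hℕ.∑∈ (λ h₂ → (m #.when (h₂ ≟ 0#)) #.when d) ≡ m #.when d
          inner (yes _) = ∑H-0 m
          inner (no  _) = #.∑-ε (λ h → zero-when (H? h))
            where
            zero-when : (d : Dec Q) → 0 #.when d ≡ 0
            zero-when (yes _) = ≡.refl
            zero-when (no  _) = ≡.refl

      -- The zero form has N = q + 1 and the other q² - 1 forms have N = m + 1. Hence q (J + q) + (m
      -- + 1) = q² (m + 1) + (q + 1), and q divides m.
      pencil-const : ∀ m → (∀ {h₁ h₂} → H h₁ → H h₂ → ¬ (h₁ ≈ 0# ∧ h₂ ≈ 0#) → N (β h₁ h₂) (α h₁ h₂) ≡ suc m) → q ℕ.∣ m
      pencil-const m const = ℕ.∣m+n∣m⇒∣n (≡.subst (q ℕ.∣_) (≡.sym total)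
          (ℕ.∣m∣n⇒∣m+n (ℕ.m∣m*n (q ℕ.* suc m)) (ℕ.n∣n))) (ℕ.m∣m*n (J ℕ.+ q))
        where
        open ≡.≡-Reasoning
        -- A correction supported at h₁ = h₂ = 0. Adding one on each side avoids subtracting the
        -- exceptional term.
        Z : ℕ → K.Carrier → K.Carrier → ℕ
        Z v h₁ h₂ = (v #.when (h₂ ≟ 0#)) #.when (h₁ ≟ 0#)
        ∑∑ : (K.Carrier → K.Carrier → ℕ) → ℕ
        ∑∑ f = Hℕ.∑∈ (λ h₁ → Hℕ.∑∈ (λ h₂ → f h₁ h₂))
        ∑∑-distrib : ∀ f g → ∑∑ (λ h₁ h₂ → f h₁ h₂ ℕ.+ g h₁ h₂) ≡ ∑∑ f ℕ.+ ∑∑ g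
        ∑∑-distrib f g = ≡.trans (Hℕ.∑∈-cong (λ h₁ _ → Hℕ.∑∈-distrib (f h₁) (g h₁))) (Hℕ.∑∈-distrib _ _)
        term : ∀ h₁ → H h₁ → ∀ h₂ → H h₂ → N (β h₁ h₂) (α h₁ h₂) ℕ.+ Z (suc m) h₁ h₂ ≡ suc m ℕ.+ Z (1 ℕ.+ q) h₁ h₂
        term h₁ Hh₁ h₂ Hh₂ with h₁ ≟ 0# | h₂ ≟ 0#
        ... | no h₁≉0   | _         = ≡.cong (ℕ._+ 0) (const Hh₁ Hh₂ (λ (h₁≈0 , _) → h₁≉0 h₁≈0))
        ... | yes _     | no h₂≉0   = ≡.cong (ℕ._+ 0) (const Hh₁ Hh₂ (λ (_ , h₂≈0) → h₂≉0 h₂≈0))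
        ... | yes h₁≈0  | yes h₂≈0  = ≡.trans (≡.cong (ℕ._+ suc m) (N-vanishing (λ x → form-00 x (vanish β₁ β₂) (vanish α₁ α₂)))) (ℕ.+-comm (1 ℕ.+ q) (suc m))
          where
          vanish : ∀ x y → h₁ * x + h₂ * y ≈ 0#
          vanish x y = trans (+-cong (trans (*-congʳ h₁≈0) (zeroˡ x)) (trans (*-congʳ h₂≈0) (zeroˡ y))) (+-identityʳ 0#)
        total : q ℕ.* (J ℕ.+ q) ℕ.+ m ≡ q ℕ.* (q ℕ.* suc m) ℕ.+ q
        total = ℕ.suc-injective (begin
          suc (q ℕ.* (J ℕ.+ q) ℕ.+ m)                   ≡⟨ ℕ.+-suc _ m ⟨
          q ℕ.* (J ℕ.+ q) ℕ.+ suc m                     ≡⟨ ≡.cong₂ ℕ._+_ ∑N-pencil (∑H-00 (suc m)) ⟨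
          ∑Nℕ ℕ.+ ∑∑ (Z (suc m))                        ≡⟨ ∑∑-distrib _ _ ⟨
          ∑∑ (λ h₁ h₂ → N (β h₁ h₂) (α h₁ h₂) ℕ.+ Z (suc m) h₁ h₂) ≡⟨ Hℕ.∑∈-cong (λ h₁ Hh₁ → Hℕ.∑∈-cong (λ h₂ Hh₂ → term h₁ Hh₁ h₂ Hh₂)) ⟩
          ∑∑ (λ h₁ h₂ → suc m ℕ.+ Z (1 ℕ.+ q) h₁ h₂)    ≡⟨ ∑∑-distrib _ _ ⟩
          ∑∑ (λ _ _ → suc m) ℕ.+ ∑∑ (Z (1 ℕ.+ q))       ≡⟨ ≡.cong₂ ℕ._+_ (≡.trans (Hℕ.∑∈-cong (λ _ _ → ∑H-const (suc m))) (∑H-const (q ℕ.* suc m))) (∑H-00 (1 ℕ.+ q)) ⟩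
          q ℕ.* (q ℕ.* suc m) ℕ.+ suc q                 ≡⟨ ℕ.+-suc _ q ⟩
          suc (q ℕ.* (q ℕ.* suc m) ℕ.+ q)               ∎)

      -- φ fixes L, so t is not in L, and L with the point t already makes M at least q + 1; N ≤ 1
      -- would give M ≤ q.
      2≤N-pencil : ∀ {h₁ h₂} → H h₁ → H h₂ → 2 ≤ N (β h₁ h₂) (α h₁ h₂)
      2≤N-pencil {h₁} {h₂} Hh₁ Hh₂ = ℕ.≰⇒> (λ N≤1 → ℕ.<⇒≱ (ℕ.n<1+n q) (begin
        1 ℕ.+ q                                                 ≡⟨ ≡.cong₂ ℕ._+_ (count-≈ t) |L|≡q ⟨
        #.count (_≟ t) ℕ.+ #.count L?                           ≡⟨ #.∑-distrib _ _ ⟨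
        #.∑ (λ x → 1 #.when (x ≟ t) ℕ.+ 1 #.when L? x)          ≤⟨ #.∑-mono-≤ term ⟩
        M b a                                                   ≡⟨ M≡ b a ⟩
        1 ℕ.+ N b a ℕ.* (q ℕ.∸ 1)                               ≤⟨ s≤s (ℕ.*-monoˡ-≤ (q ℕ.∸ 1) N≤1) ⟩
        1 ℕ.+ 1 ℕ.* (q ℕ.∸ 1)                                   ≡⟨ ≡.cong suc (ℕ.*-identityˡ _) ⟩
        1 ℕ.+ (q ℕ.∸ 1)                                         ≡⟨ 1+[q-1]≡q ⟩
        q                                                       ∎))
        where
        open ℕ.≤-Reasoning
        b = β h₁ h₂
        a = α h₁ h₂
        H-t : ∀ {x} → x ≈ t → H (form b a x)
        H-t x≈t = H-resp (sym (trans (form-cong refl refl x≈t) (pencil-t h₁ h₂))) Hh₂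
        H-L : ∀ {x} → L x → H (form b a x)
        H-L {x} Lx = H-resp (trans (*-congˡ (sym (pencil-1 h₁ h₂))) (trans (sym (form-L b a 1# Lx)) (form-cong refl refl (*-identityʳ x)))) (H-*L Lx Hh₁)
        term : ∀ x → 1 #.when (x ≟ t) ℕ.+ 1 #.when L? x ≤ 1 #.when H-form? b a x
        term x with x ≟ t | L? x
        ... | yes x≈t | yes Lx = contradiction (φ-L (L-resp x≈t Lx)) φt≉t
        ... | yes x≈t | no  _  = ℕ.≤-reflexive (≡.sym (#.when-yes (H-form? b a x) (H-t x≈t)))
        ... | no  _   | yes Lx = ℕ.≤-reflexive (≡.sym (#.when-yes (H-form? b a x) (H-L Lx)))
        ... | no  _   | no  _  = z≤n

      -- If both coefficients vanish, so do h₁ and h₂; if exactly one does, then N = 1, contrary to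
      -- `2≤N-pencil`. Otherwise `N-normalise` applies and yields a nonzero a.
      pencil-N : ∀ {h₁ h₂} → H h₁ → H h₂ → ¬ (h₁ ≈ 0# ∧ h₂ ≈ 0#) →
                 ∃[ a ] (¬ (a ≈ 0#) ∧ N (β h₁ h₂) (α h₁ h₂) ≡ N 1# a)
      pencil-N {h₁} {h₂} Hh₁ Hh₂ h≉0 with β h₁ h₂ ≟ 0# | α h₁ h₂ ≟ 0#
      ... | yes β≈0 | yes α≈0 = contradiction (vanish 1# (pencil-1 h₁ h₂) , vanish t (pencil-t h₁ h₂)) h≉0
        where
        vanish : ∀ x {h} → form (β h₁ h₂) (α h₁ h₂) x ≈ h → h ≈ 0#
        vanish x eq = trans (sym eq) (form-00 x β≈0 α≈0)
      ... | yes β≈0 | no  α≉0 = contradiction (≡.subst (2 ≤_) (N-0a β≈0 α≉0) (2≤N-pencil Hh₁ Hh₂)) λ { (s≤s ()) }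
      ... | no  β≉0 | yes α≈0 = contradiction (≡.subst (2 ≤_) (N-b0 β≉0 α≈0) (2≤N-pencil Hh₁ Hh₂)) λ { (s≤s ()) }
      ... | no  β≉0 | no  α≉0 = _ , *-≉0 α≉0 (inverse⇒≉0 (trans (*-comm _ _) (⁻¹-inverseʳ φ⁻¹β≉0))) , N-normalise _ _ β≉0
        where
        φ⁻¹β≉0 : ¬ (φ⁻¹ (β h₁ h₂) ≈ 0#)
        φ⁻¹β≉0 eq = β≉0 (trans (sym (φφ⁻¹ _)) (trans (φ-cong eq) φ-0))

      unique-value : ∀ m → (∀ a → ¬ (a ≈ 0#) → 2 ≤ N 1# a → N 1# a ≡ suc m) → q ℕ.∣ m
      unique-value m unique = pencil-const m (λ {h₁} {h₂} Hh₁ Hh₂ h≉0 →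
        let a , a≉0 , N≡ = pencil-N Hh₁ Hh₂ h≉0 in
        ≡.trans N≡ (unique a a≉0 (≡.subst (2 ≤_) N≡ (2≤N-pencil Hh₁ Hh₂))))

    -- The values of N and the exclusion of three values

    private
      f : K.Carrier → ℕ
      f a = N 1# a

      f-cong : ∀ {a b} → a ≈ b → f a ≡ f b
      f-cong = N-cong refl

      f-0 : ∀ {a} → a ≈ 0# → f a ≡ 1
      f-0 = N-b0 1≉0

    -- ∑ (N - 1)(N - q - 1) = 0, with both sides moved so that no subtraction occurs.
    balance : #.∑ (λ a → f a ℕ.* f a ℕ.+ (1 ℕ.+ q)) ≡ #.∑ (λ a → (2 ℕ.+ q) ℕ.* f a)
    balance = begin
      #.∑ (λ a → f a ℕ.* f a ℕ.+ (1 ℕ.+ q))                 ≡⟨ #.∑-distrib _ _ ⟩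
      #.∑ (λ a → f a ℕ.* f a) ℕ.+ #.∑ (λ _ → 1 ℕ.+ q)       ≡⟨ ≡.cong₂ ℕ._+_ ∑N² (≡.trans (#.∑-constant _) (≡.cong (ℕ._* (1 ℕ.+ q)) (≡.sym q*q≡order))) ⟩
      2 ℕ.* (q ℕ.+ q ℕ.* q) ℕ.+ q ℕ.* q ℕ.* (1 ℕ.+ q)       ≡⟨ arithmetic q ⟩
      (2 ℕ.+ q) ℕ.* (q ℕ.+ q ℕ.* q)                         ≡⟨ ≡.cong ((2 ℕ.+ q) ℕ.*_) ∑N ⟨
      (2 ℕ.+ q) ℕ.* #.∑ f                                   ≡⟨ #.*-distribˡ-∑ (2 ℕ.+ q) f ⟩
      #.∑ (λ a → (2 ℕ.+ q) ℕ.* f a)                         ∎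
      where
      open ≡.≡-Reasoning
      arithmetic : ∀ q → 2 ℕ.* (q ℕ.+ q ℕ.* q) ℕ.+ q ℕ.* q ℕ.* (1 ℕ.+ q) ≡ (2 ℕ.+ q) ℕ.* (q ℕ.+ q ℕ.* q)
      arithmetic = ℕ-solve-∀

    private
      lhs-cong : ∀ {a b} → a ≈ b → f a ℕ.* f a ℕ.+ (1 ℕ.+ q) ≡ f b ℕ.* f b ℕ.+ (1 ℕ.+ q)
      lhs-cong a≈b = ≡.cong (λ m → m ℕ.* m ℕ.+ (1 ℕ.+ q)) (f-cong a≈b)

      rhs-cong : ∀ {a b} → a ≈ b → (2 ℕ.+ q) ℕ.* f a ≡ (2 ℕ.+ q) ℕ.* f b
      rhs-cong a≈b = ≡.cong ((2 ℕ.+ q) ℕ.*_) (f-cong a≈b)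

    -- For 1 ≤ N ≤ q + 1 each left term of `balance` falls short of the right one by (N - 1)(q + 1 -
    -- N), which is nonnegative. Equal sums make every such difference zero.
    N≢0⇒two-valued : (∀ a → ¬ (f a ≡ 0)) → ∀ a → f a ≡ 1 ⊎ f a ≡ 1 ℕ.+ q
    N≢0⇒two-valued f≢0 a with f a ℕ.≟ 1 | f a ℕ.≟ 1 ℕ.+ q
    ... | yes f≡1 | _         = inj₁ f≡1
    ... | no _    | yes f≡1+q = inj₂ f≡1+q
    ... | no f≢1  | no f≢1+q  = contradiction balance (ℕ.<⇒≢ (#.∑-mono-< lhs-cong rhs-cong (λ b → weak (f≢0 b) (N≤1+q 1# b)) a
                                  (strict (f≢0 a) (N≤1+q 1# a) f≢1 f≢1+q)))
      where
      product : ∀ g h → (1 ℕ.+ g) ℕ.* (1 ℕ.+ g) ℕ.+ (1 ℕ.+ (g ℕ.+ h)) ℕ.+ g ℕ.* h ≡ (2 ℕ.+ (g ℕ.+ h)) ℕ.* (1 ℕ.+ g)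
      product = ℕ-solve-∀
      factor : ∀ {m} → ¬ (m ≡ 0) → m ≤ 1 ℕ.+ q → m ℕ.* m ℕ.+ (1 ℕ.+ q) ℕ.+ (m ℕ.∸ 1) ℕ.* (1 ℕ.+ q ℕ.∸ m) ≡ (2 ℕ.+ q) ℕ.* m
      factor {zero}  m≢0 _         = contradiction ≡.refl m≢0
      factor {suc m} _   (s≤s m≤q) = ≡.subst (λ r → suc m ℕ.* suc m ℕ.+ (1 ℕ.+ r) ℕ.+ m ℕ.* (q ℕ.∸ m) ≡ (2 ℕ.+ r) ℕ.* suc m)
        (ℕ.m+[n∸m]≡n m≤q) (product m (q ℕ.∸ m))
      weak : ∀ {m} → ¬ (m ≡ 0) → m ≤ 1 ℕ.+ q → m ℕ.* m ℕ.+ (1 ℕ.+ q) ≤ (2 ℕ.+ q) ℕ.* m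
      weak m≢0 m≤ = ℕ.m+n≤o⇒m≤o _ (ℕ.≤-reflexive (factor m≢0 m≤))
      strict : ∀ {m} → ¬ (m ≡ 0) → m ≤ 1 ℕ.+ q → ¬ (m ≡ 1) → ¬ (m ≡ 1 ℕ.+ q) → m ℕ.* m ℕ.+ (1 ℕ.+ q) < (2 ℕ.+ q) ℕ.* m
      strict {m} m≢0 m≤ m≢1 m≢1+q = ≡.subst (m ℕ.* m ℕ.+ (1 ℕ.+ q) <_) (factor m≢0 m≤)
        (ℕ.m<m+n _ (ℕ.*-mono-≤ (ℕ.m<n⇒0<n∸m (ℕ.≤∧≢⇒< (ℕ.n≢0⇒n>0 m≢0) (λ eq → m≢1 (≡.sym eq)))) (ℕ.m<n⇒0<n∸m (ℕ.≤∧≢⇒< m≤ m≢1+q))))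

    -- At N = 1 and N = q + 1 the two terms of `balance` agree, while at N = 0 the left one is
    -- larger by q + 1, so the sums could not be equal.
    0-not-value : (∀ a → f a ≡ 0 ⊎ f a ≡ 1 ⊎ f a ≡ 1 ℕ.+ q) → ∀ a → ¬ (f a ≡ 0)
    0-not-value values a f≡0 = contradiction (≡.sym balance) (ℕ.<⇒≢ (#.∑-mono-< rhs-cong lhs-cong
      (λ b → weak (values b)) a (strict f≡0)))
      where
      strict : ∀ {m} → m ≡ 0 → (2 ℕ.+ q) ℕ.* m < m ℕ.* m ℕ.+ (1 ℕ.+ q)
      strict ≡.refl = ≡.subst (_< 1 ℕ.+ q) (≡.sym (ℕ.*-zeroʳ (2 ℕ.+ q))) (s≤s z≤n)
      at-1 : ∀ q → (2 ℕ.+ q) ℕ.* 1 ≡ 1 ℕ.* 1 ℕ.+ (1 ℕ.+ q)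
      at-1 = ℕ-solve-∀
      at-1+q : ∀ q → (2 ℕ.+ q) ℕ.* (1 ℕ.+ q) ≡ (1 ℕ.+ q) ℕ.* (1 ℕ.+ q) ℕ.+ (1 ℕ.+ q)
      at-1+q = ℕ-solve-∀
      weak : ∀ {m} → m ≡ 0 ⊎ m ≡ 1 ⊎ m ≡ 1 ℕ.+ q → (2 ℕ.+ q) ℕ.* m ≤ m ℕ.* m ℕ.+ (1 ℕ.+ q)
      weak (inj₁ m≡0)           = ℕ.<⇒≤ (strict m≡0)
      weak (inj₂ (inj₁ ≡.refl)) = ℕ.≤-reflexive (at-1 q)
      weak (inj₂ (inj₂ ≡.refl)) = ℕ.≤-reflexive (at-1+q q)

    -- ∑ N (N - 2) = 0 and N(0) = 1.
    1-is-value : (∀ a → ¬ (a ≈ 0#) → ¬ (f a ≡ 1)) → ∀ a → ¬ (3 ≤ f a)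
    1-is-value f≢1 a₀ 3≤f = ℕ.<⇒≱ (ℕ.n<1+n _) (begin
      2 ℕ.+ 2 ℕ.* (q ℕ.+ q ℕ.* q)                             ≡⟨ ≡.cong₂ ℕ._+_ (#.∑-when-≈ _≟_ (λ _ → 2) a₀ (λ _ → ≡.refl)) (≡.trans (≡.sym (#.*-distribˡ-∑ 2 f)) (≡.cong (2 ℕ.*_) ∑N)) ⟨
      #.∑ (λ a → 2 #.when (a ≟ a₀)) ℕ.+ #.∑ (λ a → 2 ℕ.* f a) ≡⟨ #.∑-distrib _ _ ⟨
      #.∑ (λ a → 2 #.when (a ≟ a₀) ℕ.+ 2 ℕ.* f a)             ≤⟨ #.∑-mono-≤ term ⟩
      #.∑ (λ a → 1 #.when (a ≟ 0#) ℕ.+ f a ℕ.* f a)           ≡⟨ #.∑-distrib _ _ ⟩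
      #.count (_≟ 0#) ℕ.+ #.∑ (λ a → f a ℕ.* f a)             ≡⟨ ≡.cong₂ ℕ._+_ (count-≈ 0#) ∑N² ⟩
      1 ℕ.+ 2 ℕ.* (q ℕ.+ q ℕ.* q)                             ∎)
      where
      open ℕ.≤-Reasoning
      2m+2≤m² : ∀ {m} → 3 ≤ m → 2 ℕ.+ 2 ℕ.* m ≤ m ℕ.* m
      2m+2≤m² {m} 3≤m = ℕ.≤-trans (ℕ.+-monoˡ-≤ (2 ℕ.* m) (ℕ.≤-trans (s≤s (s≤s z≤n)) 3≤m)) (ℕ.*-monoˡ-≤ m 3≤m)
      2m≤m² : ∀ {m} → ¬ (m ≡ 1) → 2 ℕ.* m ≤ m ℕ.* m
      2m≤m² {zero}        _   = z≤n
      2m≤m² {suc zero}    m≢1 = contradiction ≡.refl m≢1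
      2m≤m² {suc (suc m)} _   = ℕ.*-monoˡ-≤ (suc (suc m)) (s≤s (s≤s (z≤n {m})))
      -- At a = 0 the term N (N - 2) is -1, which the 1 on the right makes up for. At a₀ it is at
      -- least 3, of which the 2 on the left is enough for a contradiction.
      term : ∀ a → 2 #.when (a ≟ a₀) ℕ.+ 2 ℕ.* f a ≤ 1 #.when (a ≟ 0#) ℕ.+ f a ℕ.* f a
      term a with a ≟ a₀ | a ≟ 0#
      ... | yes a≈a₀ | d      = ℕ.≤-trans (2m+2≤m² (≡.subst (3 ≤_) (f-cong (sym a≈a₀)) 3≤f)) (ℕ.m≤n+m _ (1 #.when d))
      ... | no  _    | yes a≈0 = ≡.subst (λ m → 2 ℕ.* m ≤ 1 ℕ.+ m ℕ.* m) (≡.sym (f-0 a≈0)) (s≤s (s≤s z≤n))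
      ... | no  _    | no a≉0  = 2m≤m² (f≢1 a a≉0)

    -- The form is x (1 + a), so W is a complete character sum, which vanishes unless a = -1.
    φ≈id⇒two-valued : (∀ x → φ x ≈ x) → ∀ a → f a ≡ 1 ⊎ f a ≡ 1 ℕ.+ q
    φ≈id⇒two-valued φ≈id a = cases ((1# + a) ≟ 0#)
      where
      form≈ : ∀ x → form 1# a x ≈ x * (1# + a)
      form≈ x = trans (+-congʳ (*-congˡ (φ≈id x))) (trans (sym (distribʳ x 1# a)) (*-comm _ x))
      cases : Dec (1# + a ≈ 0#) → f a ≡ 1 ⊎ f a ≡ 1 ℕ.+ q
      cases (yes 1+a≈0) = inj₂ (N-vanishing (λ x → trans (form≈ x) (trans (*-congˡ 1+a≈0) (zeroʳ x))))
      cases (no  1+a≉0) = inj₁ (W≈0⇒N≡1 (F.trans (∑-cong (λ x → ψ-cong (form≈ x)))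
                            (F.trans (∑ψ (1# + a)) (when-no ((1# + a) ≟ 0#) 1+a≉0))))

    N≡⇒W≈ : ∀ {a b} → f a ≡ f b → W 1# a F.≈ W 1# b
    N≡⇒W≈ {a} {b} eq = FR.+-cancelʳ (ι q) _ _ (F.trans (W-N 1# a) (F.trans (F.reflexive (≡.cong (λ m → ι (q ℕ.* m)) eq)) (F.sym (W-N 1# b))))

    W≈⇒N≡ : ∀ {a b} → W 1# a F.≈ W 1# b → f a ≡ f b
    W≈⇒N≡ {a} {b} eq = ℕ.*-cancelˡ-≡ _ _ q (×1-injective (F.trans (F.sym (W-N 1# a)) (F.trans (F.+-congʳ eq) (W-N 1# b))))

    unique-value : (∀ a → f a ≡ 1 ⊎ f a ≡ 1 ℕ.+ q) ⊎
                   (∀ m → (∀ a → ¬ (a ≈ 0#) → 2 ≤ f a → f a ≡ suc m) → q ℕ.∣ m)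
    unique-value = from (any? (λ x≈y φx≉x φy≈y → φx≉x (trans (φ-cong x≈y) (trans φy≈y (sym x≈y)))) (λ t → ¬? (φ t ≟ t)))
      where
      from : Dec (∃[ t ] ¬ (φ t ≈ t)) → _
      from (no φ≈id)        = inj₁ (φ≈id⇒two-valued (λ x → decidable-stable (φ x ≟ x) (λ φx≉x → φ≈id (x , φx≉x))))
      from (yes (t , φt≉t)) = inj₂ (Pencil.unique-value t φt≉t)

    not-three-valued : ¬ TakesExactly F._≈_ 3 (λ a → ¬ (a ≈ 0#)) (W 1#)
    not-three-valued (v , v-inj , attained , covered) = three-values-impossible (_≟ 0#) f q (N≤1+q 1#) f-0
      (any? (λ a≈b → ≡.trans (f-cong (sym a≈b))) (λ a → f a ℕ.≟ 0)) N≢0⇒two-valued 0-not-value 1-is-value unique-value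
      x (λ {i} {j} eq → v-inj (F.trans (F.sym (proj₂ (proj₂ (attained i)))) (F.trans (N≡⇒W≈ eq) (proj₂ (proj₂ (attained j))))))
      (λ a a≉0 → let i , Wa≈vi = covered a a≉0 in
        i , W≈⇒N≡ (F.trans Wa≈vi (F.sym (proj₂ (proj₂ (attained i))))))
      where
      x : Fin 3 → K.Carrier
      x i = proj₁ (attained i)

-- From the exponent d to an exponent congruent to 1 modulo q - 1

TakesExactly-resp : ∀ {a b ℓ p p′} {A : Set a} {B : Set b} {_≈_ : B → B → Set ℓ} {n} {P : A → Set p} {Q : A → Set p′} {f g : A → B} →
  (∀ {x y z} → x ≈ y → y ≈ z → x ≈ z) → (∀ x → g x ≈ f x) → (∀ {x} → P x → Q x) → (∀ {x} → Q x → P x) →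
  TakesExactly _≈_ n P f → TakesExactly _≈_ n Q g
TakesExactly-resp ≈-trans g≈f P⇒Q Q⇒P (v , v-inj , attained , covered) = v , v-inj ,
  (λ i → let x , Px , fx≈v = attained i in x , P⇒Q Px , ≈-trans (g≈f x) fx≈v) ,
  (λ x Qx → let i , fx≈v = covered x (Q⇒P Qx) in i , ≈-trans (g≈f x) fx≈v)

module NaturalExponent (K : FiniteField c ℓ ℓ′) (2<order : 2 < FiniteField.order K) where
  open FiniteField K hiding (zero)
  open CSExp (CommutativeRing.commutativeSemiring commutativeRing) using (^-congˡ; ^-congʳ; ^-assocʳ)
  open HeytingFieldProperties heytingField
  open FiniteFieldProperties K

  private
    3+[order-3]≡order : 3 ℕ.+ (order ∸ 3) ≡ order
    3+[order-3]≡order = ℕ.m+[n∸m]≡n 2<order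

  -- At x = 0 the power is 0 because the exponent |K| - 2 is positive, which is where `2<order`
  -- enters; elsewhere it is the inverse by Fermat.
  ⁻¹≈^ : ∀ x → x ⁻¹ ≈ x ^ (order ∸ 1 ∸ 1)
  ⁻¹≈^ x with x ≟ 0#
  ... | yes x≈0 = trans (⁻¹-zero x≈0) (sym (trans (^-congˡ (order ∸ 1 ∸ 1) x≈0)
                    (trans (^-congʳ 0# (≡.cong (λ m → m ∸ 1 ∸ 1) (≡.sym 3+[order-3]≡order))) (0^ (suc (order ∸ 3))))))
  ... | no  x≉0 = *-cancelˡ x≉0 (trans (⁻¹-inverseʳ x≉0) (sym (trans (^-congʳ x exponent)
                    (^-pred (order ∸ 1) x≉0 (trans (^-congʳ x (ℕ.m+[n∸m]≡n (ℕ.<⇒≤ order>1))) (fermat x))))))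
    where
    exponent : suc (order ∸ 1 ∸ 1) ≡ order ∸ 1
    exponent = ℕ.m+[n∸m]≡n {1} (ℕ.m<n⇒0<n∸m order>1)

  ^ᶻ≈^ : ∀ d x → x ^ᶻ d ≈ x ^ naturalExponent (order ∸ 1) d
  ^ᶻ≈^ (+ m)    x = refl
  ^ᶻ≈^ -[1+ m ] x = trans (^-congˡ (suc m) (⁻¹≈^ x)) (^-assocʳ x (order ∸ 1 ∸ 1) (suc m))

open import Data.Nat.Base using (_*_)
open import Data.Nat.Divisibility using (_∣_)

theorem1p9 : ∀ {c₁ ℓ₁ m₁ c₂ ℓ₂ m₂ : Level}
    (ℂ : ComplexNumbers c₁ ℓ₁ m₁) (K : FiniteField c₂ ℓ₂ m₂) →
    let module ℂ = ComplexNumbers ℂ in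
    let module K = FiniteField K in
    (p : ℕ) .{{_ : NonZero p}} → Prime p → K.HasCharacteristic p →
    (n : ℕ) → K.HasPrimeDegree p n → 2 ∣ n →
    (d : ℤ) → gcd d (+ (K.order ∸ 1)) ≡ + 1 →
    (s : ℕ) → s * s ≡ K.order →
    ∃[ j ] (d ≡ p ^ j mod (s ∸ 1)) →
    ¬ TakesExactly ℂ._≈_ 3 (λ a → a K.# K.0#) (WeilSum.W ℂ K p n d)
theorem1p9 ℂ K p p-prime char n degree (ℕ.divides m n≡m*2) d gcd≡1 s s*s≡order d≡pʲ three =
  not-three-valued (TakesExactly-resp {_≈_ = ℂ._≈_} {f = WeilSum.W ℂ K p n d} {g = W K.1#} ℂ.trans W≈ #⇒≉ ≉0⇒#0 three)
  where
  module ℂ = ComplexNumbers ℂ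
  module K = FiniteField K
  open HeytingFieldProperties K.heytingField using (#⇒≉)
  open FiniteFieldProperties K using (≉0⇒#0; order>1)
  open CharacteristicProperties K p-prime char degree using (order≡pⁿ; +-^pⁱ)
  open CanonicalCharacter ℂ K p-prime char degree
  open CSExp (CommutativeRing.commutativeSemiring K.commutativeRing) using (^-congˡ; ^-assocʳ)

  s≡pᵐ : s ≡ p ℕ.^ m
  s≡pᵐ = *-square-injective (begin
    s * s                      ≡⟨ s*s≡order ⟩
    K.order                    ≡⟨ order≡pⁿ ⟩
    p ℕ.^ n                    ≡⟨ ≡.cong (p ℕ.^_) (≡.trans n≡m*2 (≡.trans (ℕ.*-comm m 2) (≡.cong (m ℕ.+_) (ℕ.+-identityʳ m)))) ⟩
    p ℕ.^ (m ℕ.+ m)            ≡⟨ ℕ.^-distribˡ-+-* p m m ⟩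
    p ℕ.^ m * p ℕ.^ m          ∎)
    where open ≡.≡-Reasoning

  +-^s : ^-Additive K s
  +-^s = ≡.subst (^-Additive K) (≡.sym s≡pᵐ) (+-^pⁱ m)

  canonical : AdditiveCharacter ℂ.heytingField K
  canonical = record { ψ-cong = ψ-cong ; ψ-0 = ψ-0 ; ψ-+ = ψ-+ ; ψ≈1? = ψ≈1? ; ψ-nontrivial = ψ-nontrivial }

  module Sums = NihoSums {K = K} ℂ.char-0 canonical s s*s≡order +-^s
  open Sums using (1<q; q*q≡1+[1+q][q-1])

  2<order : 2 < K.order
  2<order = ≡.subst (2 <_) s*s≡order (ℕ.≤-trans (ℕ.n≤1+n 3) (ℕ.*-mono-≤ 1<q 1<q))

  open NaturalExponent K 2<order

  instance
    m-nonZero : NonZero m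
    m-nonZero = ℕ.≢-nonZero (λ { ≡.refl → ℕ.<⇒≢ 1<q (≡.sym s≡pᵐ) })

    n-nonZero : NonZero n
    n-nonZero = ≡.subst NonZero (≡.sym n≡m*2) (ℕ.m*n≢0 m 2)

    order-1-nonZero : NonZero (K.order ∸ 1)
    order-1-nonZero = ℕ.>-nonZero (ℕ.m<n⇒0<n∸m order>1)

  1+[order-1]≡order : suc (K.order ∸ 1) ≡ K.order
  1+[order-1]≡order = ℕ.m+[n∸m]≡n (ℕ.<⇒≤ order>1)

  e : ℕ
  e = naturalExponent (K.order ∸ 1) d

  e-coprime : Coprime e (K.order ∸ 1)
  e-coprime {g} = naturalExponent-coprime (K.order ∸ 1) d gcd≡1 {g}

  normalised : ∃[ J ] + (s ∸ 1) ℤ.∣ d ℤ.* + (p ℕ.^ J) ℤ.- + 1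
  normalised = frobenius-normalise {p} {m} {s} {d} s≡pᵐ d≡pʲ

  -- Since e ≡ d modulo |K| - 1 and d p^J ≡ 1 modulo s - 1, the twist by p^J makes E ≡ 1 modulo s -
  -- 1, and ψ does not see it.
  J E : ℕ
  J = proj₁ normalised
  E = e * p ℕ.^ J

  1<order-1 : 1 < K.order ∸ 1
  1<order-1 = ℕ.∸-monoˡ-≤ 1 2<order

  e-inverse : ∃[ u ] ∃[ v ] e * u ≡ 1 ℕ.+ v * (K.order ∸ 1)
  e-inverse = coprime⇒inverse {e} 1<order-1 (λ {g} → e-coprime {g})

  p-inverse : ∃[ w ] ∃[ x ] p ℕ.^ J * w ≡ 1 ℕ.+ x * (K.order ∸ 1)
  p-inverse = frobenius-inverse {p} {n} (≡.trans (≡.sym order≡pⁿ) (≡.sym 1+[order-1]≡order)) J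

  instance
    e-nonZero : NonZero e
    e-nonZero = ℕ.≢-nonZero (λ e≡0 → ℕ.0≢1+n (≡.trans (≡.cong (_* proj₁ e-inverse) (≡.sym e≡0)) (proj₂ (proj₂ e-inverse))))

    E-nonZero : NonZero E
    E-nonZero = ℕ.m*n≢0 e (p ℕ.^ J) {{e-nonZero}} {{ℕ.m^n≢0 p J}}

  s-1∣order-1 : + (s ∸ 1) ℤ.∣ + (K.order ∸ 1)
  -- The quotient comes from |K| - 1 = (s + 1)(s - 1).
  s-1∣order-1 = ℤ.∣ᵤ⇒∣ (ℕ.divides (suc s) (≡.cong (_∸ 1) (≡.trans (≡.sym s*s≡order) q*q≡1+[1+q][q-1])))

  E≡1 : ∃[ k ] E ≡ 1 ℕ.+ k * (s ∸ 1)
  E≡1 = ≡1-mod⁻ {{E-nonZero}} (≡.subst (+ (s ∸ 1) ℤ.∣_) split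
    (ℤ.∣m∣n⇒∣m+n (ℤ.∣m⇒∣m*n (+ (p ℕ.^ J)) (ℤ.∣-trans s-1∣order-1 (naturalExponent-≡ (K.order ∸ 1) d))) (proj₂ normalised)))
    where
    ℤ-identity : ∀ e d x → (e ℤ.- d) ℤ.* x ℤ.+ (d ℤ.* x ℤ.- + 1) ≡ e ℤ.* x ℤ.- + 1
    ℤ-identity = ℤ-solve-∀
    split : (+ e ℤ.- d) ℤ.* + (p ℕ.^ J) ℤ.+ (d ℤ.* + (p ℕ.^ J) ℤ.- + 1) ≡ + E ℤ.- + 1
    split = ≡.trans (ℤ-identity (+ e) d (+ (p ℕ.^ J))) (≡.cong (ℤ._- + 1) (≡.sym (ℤ.pos-* e (p ℕ.^ J))))

  E-inverse : ∃[ u ] ∃[ v ] E * u ≡ 1 ℕ.+ v * (K.order ∸ 1)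
  E-inverse = inverse-* {e} {p ℕ.^ J} e-inverse p-inverse

  open Sums.NihoExponent E (proj₁ E≡1) (proj₂ E≡1) (proj₁ E-inverse) (proj₁ (proj₂ E-inverse)) (proj₂ (proj₂ E-inverse))
    using (W; form; not-three-valued)

  -- Multiplicativity of ψ separates x^E = (x^d)^(p^J) from a x, so that Frobenius invariance can be
  -- applied to the first summand alone.
  ψ-form : ∀ a x → ψ (form K.1# a x) ℂ.≈ ψ (x K.^ᶻ d K.+ a K.* x)
  ψ-form a x = begin
    ψ (K.1# K.* x K.^ E K.+ a K.* x)          ≈⟨ ψ-+ _ _ ⟩
    ψ (K.1# K.* x K.^ E) ℂ.* ψ (a K.* x)      ≈⟨ ℂ.*-congʳ (ψ-cong (K.trans (K.*-identityˡ _) (K.trans (K.sym (^-assocʳ x e (p ℕ.^ J))) (^-congˡ (p ℕ.^ J) (K.sym (^ᶻ≈^ d x)))))) ⟩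
    ψ ((x K.^ᶻ d) K.^ (p ℕ.^ J)) ℂ.* ψ (a K.* x) ≈⟨ ℂ.*-congʳ (ψ-^pⁱ J _) ⟩
    ψ (x K.^ᶻ d) ℂ.* ψ (a K.* x)              ≈⟨ ψ-+ _ _ ⟨
    ψ (x K.^ᶻ d K.+ a K.* x)                  ∎
    where open ≈-Reasoning ℂ.setoid

  W≈ : ∀ a → W K.1# a ℂ.≈ WeilSum.W ℂ K p n d a
  W≈ a = ℂ.trans (∑-cong (ψ-form a)) (ℂ.reflexive (∑-unfold _))
    where open FiniteSum K.enumeration (CommutativeRing.+-commutativeMonoid ℂ.commutativeRing)
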